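{- Let $1\le k\le n$. For every $(k,n)$-partial noncrossing pairing $(\tau,T)\in\mathcal{A}_{k,n}$ we have $$\Delta_{(\tau,T)} = H(\theta(\tau,T))$$ in $R(k,n)_2=V(2\omega_k)^*$. Thus the Temperley–Lieb immanants $\{\Delta_{(\tau,T)}\mid(\tau,T)\in\mathcal{A}_{k,n}\}$ are exactly the dual canonical basis $\{H(S)\mid S\in B(2\omega_k)\}$.
   Context: $R(k,n)=\mathbb{C}[\Delta_I]/(\text{Plücker relations})$, $I\in\binom{[n]}{k}$ (the $k$-subsets of $[n]=\{1,\dots,n\}$), is the homogeneous coordinate ring of $\mathrm{Gr}(k,n)$, i.e. the coordinate ring of the affine cone $\widehat{\mathrm{Gr}}(k,n)\subset\Lambda^k\mathbb{C}^n$ of decomposable vectors; $R(k,n)_2$ is its degree $2$ part. A $(k,n)$-partial noncrossing pairing $(\tau,T)$ consists of a noncrossing perfect matching $\tau$ of a subset $S\subset[n]$ (points $1,\dots,n$ placed in order on a circle) together with a subset $T\subset[n]\setminus S$, satisfying $2|T|+|S|=2k$. The set of these is $\mathcal{A}_{k,n}$. A pair $(I,J)\in\binom{[n]}{k}^2$ is compatible with $(\tau,T)$ if (a) $I\cap J=T$ and (b) each pair of matched vertices in $\tau$ contains one element of $I$ and one element of $J$. $\mathcal{C}(I,J)$ is the set of $(k,n)$-partial noncrossing pairings compatible with $(I,J)$. The Temperley–Lieb immanants (invariants) $\Delta_{(\tau,T)}\in R(k,n)_2$ are the elements uniquely determined by the (known) identities $$\Delta_I\Delta_J=\sum_{(\tau,T)\in\mathcal{C}(I,J)}\Delta_{(\tau,T)}\qquad\text{for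 all } I,J\in\tbinom{[n]}{k};$$ they form a basis of $R(k,n)_2$. Let $\omega_k=(1^k)$. $B(2\omega_k)$ is the set of semistandard Young tableaux with $k$ rows, $2$ columns and entries in $[n]$. The bijection $\theta:\mathcal{A}_{k,n}\to B(2\omega_k)$ sends $(\tau,T)$ to the tableau with columns $I_1,I_2$ (left, right) where $I_1\cap I_2=T$ and for each strand $(a,b)\in\tau$ with $a<b$ we have $a\in I_1$, $b\in I_2$ (and there are no other entries). $V(2\omega_k)$ is the irreducible $GL(n)$-representation of highest weight $2\omega_k$, realized in $(\Lambda^k\mathbb{C}^n)^{\otimes2}$ as the subrepresentation generated by $v_+=(e_1\wedge\cdots\wedge e_k)^{\otimes2}$. By Borel–Weil $V(2\omega_k)^*=R(k,n)_2$, with $\varphi$ corresponding to the function $X\mapsto\varphi(X\otimes X)$ on $\widehat{\mathrm{Gr}}(k,n)$. $\{G(S)\mid S\in B(2\omega_k)\}$ is the canonical basis (Lusztig; Kashiwara's global basis) of the $U_q(\mathfrak{sl}_n)$-module $V_q(2\omega_k)$ with respect to $v_+$, specialized at $q=1$, labelled by tableaux via the crystal structure on $B(2\omega_k)$: read the rows of a tableau left to right starting from the bottom row, regard each $i$ as ")" and each $i+1$ as "(" and pair as usual; $\tilde f_i$ changes the $i$ of the rightmost unpaired ")" to $i+1$, and $\tilde e_i$ changes the $i+1$ of the leftmost unpaired "(" to $i$ (result $0$ if none). $\{H(S)\}$ is the dual basis of $V(2\omega_k)^*$, the dual canonical basis. -}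

module Defs where

open import Level using (Level; _⊔_)
open import Algebra.Bundles using (CommutativeRing)
open import Algebra.Apartness.Bundles using (HeytingField; HeytingCommutativeRing)
open import Data.Bool using (Bool; true; false; if_then_else_; not; _∧_; _∨_)
import Data.Bool.Properties as Bool
open import Data.Empty using (⊥-elim)
open import Data.Fin using (Fin; zero; suc; toℕ; inject≤; _<_; _≤_; _<?_; fromℕ<)
import Data.Fin.Properties as Fin
open import Data.Fin.Subset using (Subset; ∣_∣; _∈_; _∪_; _∩_; _-_)
open import Data.Fin.Subset.Properties using (_∈?_; x∈p∪q⁻; x∈p∪q⁺)
open import Data.Integer using (ℤ; +_; -[1+_]; 0ℤ; 1ℤ)
open import Data.List as List using (List; []; _∷_; _++_)
open import Data.List.Relation.Unary.Any using (Any; here; there)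
open import Data.Maybe using (Maybe; just; nothing)
open import Data.Nat as ℕ using (ℕ; zero; suc)
import Data.Nat.Properties as ℕ
open import Data.Product using (Σ; ∃; ∃₂; _×_; _,_; proj₁; proj₂; uncurry)
open import Data.Sum using (_⊎_; inj₁; inj₂)
open import Data.Vec as Vec using (Vec; []; _∷_; lookup; tabulate; _[_]≔_; _[_]%=_)
import Data.Vec.Properties as Vec
import Data.Vec.Functional as Vector
open import Function using (_∘_)
open import Function.Definitions using (Injective)
open import Relation.Binary using (tri<; tri≈; tri>)
open import Relation.Binary.PropositionalEquality
  using (_≡_; _≢_; refl; sym; trans; cong; cong₂; subst; subst₂)
open import Relation.Nullary using (¬_; Dec; yes; no; does; ¬?; _×-dec_; _⊎-dec_; _→-dec_)
open import Relation.Nullary.Decidable using (map′; dec-true; dec-false)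
open import Relation.Unary using (Pred)

private
  variable
    k l n : ℕ

------------------------------------------------------------------------
-- Subsets of [n]

KSubset : ℕ → ℕ → Set
KSubset k n = Σ (Subset n) λ I → ∣ I ∣ ≡ k

-- {0,…,m-1} ⊆ Fin n, i.e. the subset [m] of [n].
initial : ∀ n → ℕ → Subset n
initial n m = tabulate λ i → does (toℕ i ℕ.<? m)

_≟ₛ_ : (I J : Subset n) → Dec (I ≡ J)
_≟ₛ_ = Vec.≡-dec Bool._≟_

elements : (I : Subset n) → Vec (Fin n) ∣ I ∣
elements []          = []
elements (true  ∷ I) = zero ∷ Vec.map suc (elements I)
elements (false ∷ I) = Vec.map suc (elements I)

record Enumerates (I : Subset n) (xs : Vec (Fin n) k) : Set where
  field
    sorted   : ∀ {r s} → r < s → lookup xs r < lookup xs s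
    sound    : ∀ r → lookup xs r ∈ I
    complete : ∀ {i} → i ∈ I → ∃ λ r → lookup xs r ≡ i

------------------------------------------------------------------------
-- Partial noncrossing pairings

-- The matching is encoded by the involution σ of [n] that exchanges
-- matched points and fixes the points outside S.
matched : Vec (Fin n) n → Subset n
matched σ = tabulate λ i → not (does (lookup σ i Fin.≟ i))

record IsPairing (k : ℕ) (σ : Vec (Fin n) n) (T : Subset n) : Set where
  field
    involutive  : ∀ i → lookup σ (lookup σ i) ≡ i
    noncrossing : ∀ a b → ¬ (a < b × b < lookup σ a × lookup σ a < lookup σ b)
    disjoint    : ∀ i → i ∈ T → lookup σ i ≡ i
    size        : 2 ℕ.* ∣ T ∣ ℕ.+ ∣ matched σ ∣ ≡ 2 ℕ.* k

isPairing? : ∀ k (σ : Vec (Fin n) n) T → Dec (IsPairing k σ T)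
isPairing? k σ T = map′
  (λ (a , b , c , d) → record
    { involutive = a ; noncrossing = b ; disjoint = c ; size = d })
  (λ p → let open IsPairing p in involutive , noncrossing , disjoint , size)
  (Fin.all? (λ i → lookup σ (lookup σ i) Fin.≟ i)
   ×-dec Fin.all? (λ a → Fin.all? λ b →
           ¬? (a <? b ×-dec b <? lookup σ a ×-dec lookup σ a <? lookup σ b))
   ×-dec Fin.all? (λ i → i ∈? T →-dec lookup σ i Fin.≟ i)
   ×-dec (2 ℕ.* ∣ T ∣ ℕ.+ ∣ matched σ ∣ ℕ.≟ 2 ℕ.* k))

record Pairing (k n : ℕ) : Set where
  constructor pairing
  field
    σ          : Vec (Fin n) n
    T          : Subset n
    .isPairing : IsPairing k σ T

  partner : Fin n → Fin n
  partner = lookup σ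

allVecs : {A : Set} → List A → ∀ n → List (Vec A n)
allVecs xs zero    = [] ∷ []
allVecs xs (suc n) = List.cartesianProductWith _∷_ xs (allVecs xs n)

allPairings : ∀ k n → List (Pairing k n)
allPairings k n = List.mapMaybe check
  (List.cartesianProduct (allVecs (List.allFin n) n) (allVecs (true ∷ false ∷ []) n))
  where
  check : Vec (Fin n) n × Subset n → Maybe (Pairing k n)
  check (σ , T) with isPairing? k σ T
  ... | yes p = just (pairing σ T p)
  ... | no  _ = nothing

Compatible : Subset n → Subset n → Pairing k n → Set
Compatible I J τ =
  I ∩ J ≡ T × (∀ a → partner a ≢ a → (a ∈ I × partner a ∈ J) ⊎ (a ∈ J × partner a ∈ I))
  where open Pairing τ

compatible? : (I J : Subset n) (τ : Pairing k n) → Dec (Compatible I J τ)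
compatible? I J τ = ((I ∩ J) ≟ₛ T) ×-dec Fin.all? λ a →
  ¬? (partner a Fin.≟ a) →-dec
    ((a ∈? I ×-dec partner a ∈? J) ⊎-dec (a ∈? J ×-dec partner a ∈? I))
  where open Pairing τ

-- 𝒞(I,J)
compatibles : KSubset k n → KSubset k n → List (Pairing k n)
compatibles {k} {n} (I , _) (J , _) = List.filter (compatible? I J) (allPairings k n)

------------------------------------------------------------------------
-- Two-column tableaux and their crystal structure

-- The list of columns, left to right.
Filling : ℕ → ℕ → Set
Filling k n = Vec (Vec (Fin n) k) 2

Cell : ℕ → Set
Cell k = Fin k × Fin 2

entry : Filling k n → Cell k → Fin n
entry t (r , c) = lookup (lookup t c) r

record IsSemistandard (t : Filling k n) : Set where
  field
    columns : ∀ c {r s} → r < s → entry t (r , c) < entry t (s , c)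
    rows    : ∀ r {c d} → c ≤ d → entry t (r , c) ≤ entry t (r , d)

record SSYT (k n : ℕ) : Set where
  constructor ssyt
  field
    filling        : Filling k n
    .semistandard  : IsSemistandard filling

open SSYT public using (filling)

-- The vertex i of the Dynkin diagram of 𝔰𝔩ₙ, with hi = lo + 1 standing for i + 1.
record Node (n : ℕ) : Set where
  field
    lo hi    : Fin n
    adjacent : toℕ hi ≡ suc (toℕ lo)

readingOrder : ∀ k → List (Cell k)
readingOrder k =
  List.concatMap (λ r → (r , zero) ∷ (r , suc zero) ∷ []) (List.reverse (List.allFin k))

module _ (i : Node n) (t : Filling k n) where
  open Node i

  -- `opens` counts the "(" still waiting for a partner; a ")" met when there
  -- are none is unpaired and supersedes the previous unpaired one.
  rightmostUnpaired : (opens : ℕ) → Maybe (Cell k) → List (Cell k) → Maybe (Cell k)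
  rightmostUnpaired opens last []       = last
  rightmostUnpaired opens last (x ∷ xs) =
    if does (entry t x Fin.≟ hi) then rightmostUnpaired (suc opens) last xs
    else if does (entry t x Fin.≟ lo) then close opens
    else rightmostUnpaired opens last xs
    where
    close : ℕ → Maybe (Cell k)
    close zero        = rightmostUnpaired zero (just x) xs
    close (suc opens) = rightmostUnpaired opens last xs

  f̃-tableau : Maybe (Filling k n)
  f̃-tableau with rightmostUnpaired 0 nothing (readingOrder k)
  ... | just (r , c) = just (t [ c ]%= (_[ r ]≔ hi))
  ... | nothing      = nothing

-- Row r filled with r's.
highestFilling : k ℕ.≤ n → Filling k n
highestFilling k≤n = Vec.replicate 2 (tabulate λ r → inject≤ r k≤n)

------------------------------------------------------------------------
-- The bijection θ

openers closers : Vec (Fin n) n → Subset n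
openers σ = tabulate λ i → does (i <? lookup σ i)
closers σ = tabulate λ i → does (lookup σ i <? i)

module Semistandardness where

  ∈⇒true : ∀ {I : Subset n} {i} → i ∈ I → lookup I i ≡ true
  ∈⇒true = Vec.[]=⇒lookup

  ∈-tab⁻ : ∀ {P : Fin n → Set} (P? : ∀ i → Dec (P i)) {i} →
           i ∈ tabulate (λ j → does (P? j)) → P i
  ∈-tab⁻ P? {i} i∈ with P? i | trans (sym (Vec.lookup∘tabulate (λ j → does (P? j)) i)) (∈⇒true i∈)
  ... | yes p | _ = p

  ∈-tab⁺ : ∀ {P : Fin n → Set} (P? : ∀ i → Dec (P i)) {i} →
           P i → i ∈ tabulate (λ j → does (P? j))
  ∈-tab⁺ P? {i} p = Vec.lookup⇒[]= i _
    (trans (Vec.lookup∘tabulate (λ j → does (P? j)) i) (dec-true (P? i) p))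

  enumerates : (I : Subset n) → Enumerates I (elements I)
  enumerates [] = record { sorted = λ { {()} } ; sound = λ () ; complete = λ () }
  enumerates (false ∷ I) = record
    { sorted   = λ {r} {s} r<s → mono r s (E.sorted r<s)
    ; sound    = λ r → subst (_∈ (false ∷ I)) (sym (Vec.lookup-map r suc (elements I)))
                         (Vec.there (E.sound r))
    ; complete = λ { (Vec.there i∈) → let r , eq = E.complete i∈ in
                     r , trans (Vec.lookup-map r suc (elements I)) (cong suc eq) } }
    where
    module E = Enumerates (enumerates I)
    mono : ∀ r s → lookup (elements I) r < lookup (elements I) s →
           lookup (Vec.map suc (elements I)) r < lookup (Vec.map suc (elements I)) s
    mono r s p = subst₂ _<_ (sym (Vec.lookup-map r suc (elements I)))
                            (sym (Vec.lookup-map s suc (elements I))) (ℕ.s≤s p)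
  enumerates (true ∷ I) = record { sorted = λ {r} {s} → srt r s ; sound = snd ; complete = cmp }
    where
    module E = Enumerates (enumerates I)
    xs = elements (true ∷ I)
    srt : ∀ r s → r < s → lookup xs r < lookup xs s
    srt zero    (suc s) _ =
      subst (λ j → 0 ℕ.< toℕ j) (sym (Vec.lookup-map s suc (elements I))) (ℕ.s≤s ℕ.z≤n)
    srt (suc r) (suc s) (ℕ.s≤s r<s) =
      subst₂ _<_ (sym (Vec.lookup-map r suc (elements I)))
                 (sym (Vec.lookup-map s suc (elements I))) (ℕ.s≤s (E.sorted r<s))
    snd : ∀ r → lookup xs r ∈ (true ∷ I)
    snd zero    = Vec.here
    snd (suc r) = subst (_∈ (true ∷ I)) (sym (Vec.lookup-map r suc (elements I)))
                    (Vec.there (E.sound r))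
    cmp : ∀ {i} → i ∈ (true ∷ I) → ∃ λ r → lookup xs r ≡ i
    cmp Vec.here       = zero , refl
    cmp (Vec.there i∈) = let r , eq = E.complete i∈ in
      suc r , trans (Vec.lookup-map r suc (elements I)) (cong suc eq)

  enumerates-cast : (I : Subset n) (eq : ∣ I ∣ ≡ k) → Enumerates I (Vec.cast eq (elements I))
  enumerates-cast I refl = subst (Enumerates I) (sym (Vec.cast-is-id refl _)) (enumerates I)

  enum-injective : {I : Subset n} {xs : Vec (Fin n) k} → Enumerates I xs →
                   ∀ {r s} → lookup xs r ≡ lookup xs s → r ≡ s
  enum-injective E {r} {s} eq with Fin.<-cmp r s
  ... | tri< r<s _ _ = ⊥-elim (Fin.<-irrefl eq (Enumerates.sorted E r<s))
  ... | tri≈ _ r≡s _ = r≡s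
  ... | tri> _ _ s<r = ⊥-elim (Fin.<-irrefl (sym eq) (Enumerates.sorted E s<r))

  module _ {I J : Subset n} {xs : Vec (Fin n) k} {ys : Vec (Fin n) l}
           (E : Enumerates I xs) (F : Enumerates J ys)
           (φ : Fin n → Fin n) (φ-inj : ∀ {i j} → φ i ≡ φ j → i ≡ j)
           (φ-maps : ∀ {i} → i ∈ J → φ i ∈ I) where
    private
      module E = Enumerates E
      module F = Enumerates F

    position : Fin l → Fin k
    position s = proj₁ (E.complete (φ-maps (F.sound s)))

    position-eq : ∀ s → lookup xs (position s) ≡ φ (lookup ys s)
    position-eq s = proj₂ (E.complete (φ-maps (F.sound s)))

    position-inj : ∀ {s t} → position s ≡ position t → s ≡ t
    position-inj {s} {t} eq = enum-injective F (φ-inj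
      (trans (sym (position-eq s)) (trans (cong (lookup xs) eq) (position-eq t))))

    card-≤ : l ℕ.≤ k
    card-≤ = Fin.injective⇒≤ position-inj

  module _ {I J : Subset n} {xs ys : Vec (Fin n) k}
           (E : Enumerates I xs) (F : Enumerates J ys)
           (φ : Fin n → Fin n) (φ-inj : ∀ {i j} → φ i ≡ φ j → i ≡ j)
           (φ-maps : ∀ {i} → i ∈ J → φ i ∈ I) (φ-≤ : ∀ {i} → i ∈ J → φ i ≤ i) where
    private
      module E = Enumerates E
      module F = Enumerates F
      pos = position E F φ φ-inj φ-maps

    rowwise-≤ : ∀ r → lookup xs r ≤ lookup ys r
    rowwise-≤ r = ℕ.≮⇒≥ λ y<x →
      let pos<r : ∀ s → s ≤ r → pos s < r
          pos<r s s≤r = ℕ.≰⇒> λ r≤p → ℕ.<⇒≱ y<x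
            (ℕ.≤-trans (x≤ r≤p)
            (ℕ.≤-trans (ℕ.≤-reflexive (cong toℕ (position-eq E F φ φ-inj φ-maps s)))
            (ℕ.≤-trans (φ-≤ (F.sound s)) (y≤ s≤r))))
          emb : Fin (suc (toℕ r)) → Fin k
          emb s = inject≤ s (Fin.toℕ<n r)
          emb≤ : ∀ s → emb s ≤ r
          emb≤ s = ℕ.≤-trans (ℕ.≤-reflexive (Fin.toℕ-inject≤ s _)) (ℕ.s≤s⁻¹ (Fin.toℕ<n s))
          f : Fin (suc (toℕ r)) → Fin (toℕ r)
          f s = fromℕ< (pos<r (emb s) (emb≤ s))
          i , j , i<j , eq = Fin.pigeonhole (ℕ.n<1+n _) f
          pos-eq = Fin.toℕ-injective (Fin.fromℕ<-injective _ _ _ _ eq)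
      in Fin.<-irrefl (Fin.inject≤-injective _ _ i j
                        (position-inj E F φ φ-inj φ-maps pos-eq)) i<j
      where
      mono : ∀ {I : Subset n} {zs : Vec (Fin n) k} → Enumerates I zs →
             ∀ {s t} → s ≤ t → lookup zs s ≤ lookup zs t
      mono {zs = zs} Z {s} {t} s≤t with ℕ.m≤n⇒m<n∨m≡n s≤t
      ... | inj₁ s<t = ℕ.<⇒≤ (Enumerates.sorted Z s<t)
      ... | inj₂ s≡t = ℕ.≤-reflexive (cong (toℕ ∘ lookup zs) (Fin.toℕ-injective s≡t))
      x≤ = mono E
      y≤ = mono F

  ind : Bool → ℕ
  ind true  = 1
  ind false = 0

  count-∷ : ∀ b (I : Subset n) → ∣ b ∷ I ∣ ≡ ind b ℕ.+ ∣ I ∣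
  count-∷ true  I = refl
  count-∷ false I = refl

  count-split : (A B T S : Subset n) →
    (∀ i → ind (lookup A i) ℕ.+ ind (lookup B i) ≡ 2 ℕ.* ind (lookup T i) ℕ.+ ind (lookup S i)) →
    ∣ A ∣ ℕ.+ ∣ B ∣ ≡ 2 ℕ.* ∣ T ∣ ℕ.+ ∣ S ∣
  count-split [] [] [] [] _ = refl
  count-split (a ∷ A) (b ∷ B) (t ∷ T) (s ∷ S) h
    rewrite count-∷ a A | count-∷ b B | count-∷ t T | count-∷ s S =
    trans (shuffle (ind a) (∣ A ∣) (ind b) (∣ B ∣))
    (trans (cong₂ ℕ._+_ (h zero) (count-split A B T S (h ∘ suc)))
           (shuffle′ (ind t) (∣ T ∣) (ind s) (∣ S ∣)))
    where
    open import Data.Nat.Tactic.RingSolver using (solve-∀)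
    shuffle : ∀ a x b y → (a ℕ.+ x) ℕ.+ (b ℕ.+ y) ≡ (a ℕ.+ b) ℕ.+ (x ℕ.+ y)
    shuffle = solve-∀
    shuffle′ : ∀ t x s y → (2 ℕ.* t ℕ.+ s) ℕ.+ (2 ℕ.* x ℕ.+ y) ≡ 2 ℕ.* (t ℕ.+ x) ℕ.+ (s ℕ.+ y)
    shuffle′ = solve-∀

  module Columns {σ : Vec (Fin n) n} {T : Subset n} (p : IsPairing k σ T) where
    open IsPairing p

    A B : Subset n
    A = T ∪ openers σ
    B = T ∪ closers σ

    σ-inj : ∀ {i j} → lookup σ i ≡ lookup σ j → i ≡ j
    σ-inj {i} {j} eq = trans (sym (involutive i)) (trans (cong (lookup σ) eq) (involutive j))

    B→A : ∀ {i} → i ∈ B → lookup σ i ∈ A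
    B→A {i} i∈ with x∈p∪q⁻ T _ i∈
    ... | inj₁ i∈T = x∈p∪q⁺ (inj₁ (subst (_∈ T) (sym (disjoint i i∈T)) i∈T))
    ... | inj₂ i∈C = x∈p∪q⁺ (inj₂ (∈-tab⁺ (λ j → j <? lookup σ j)
          (subst (lookup σ i <_) (sym (involutive i)) (∈-tab⁻ (λ j → lookup σ j <? j) i∈C))))

    A→B : ∀ {i} → i ∈ A → lookup σ i ∈ B
    A→B {i} i∈ with x∈p∪q⁻ T _ i∈
    ... | inj₁ i∈T = x∈p∪q⁺ (inj₁ (subst (_∈ T) (sym (disjoint i i∈T)) i∈T))
    ... | inj₂ i∈O = x∈p∪q⁺ (inj₂ (∈-tab⁺ (λ j → lookup σ j <? j)
          (subst (_< lookup σ i) (sym (involutive i)) (∈-tab⁻ (λ j → j <? lookup σ j) i∈O))))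

    σ-≤ : ∀ {i} → i ∈ B → lookup σ i ≤ i
    σ-≤ {i} i∈ with x∈p∪q⁻ T _ i∈
    ... | inj₁ i∈T = ℕ.≤-reflexive (cong toℕ (disjoint i i∈T))
    ... | inj₂ i∈C = ℕ.<⇒≤ (∈-tab⁻ (λ j → lookup σ j <? j) i∈C)

    pointwise : ∀ i → ind (lookup A i) ℕ.+ ind (lookup B i) ≡ 2 ℕ.* ind (lookup T i) ℕ.+ ind (lookup (matched σ) i)
    pointwise i
      rewrite Vec.lookup-zipWith _∨_ i T (openers σ)
            | Vec.lookup-zipWith _∨_ i T (closers σ)
            | Vec.lookup∘tabulate (λ i → does (i <? lookup σ i)) i
            | Vec.lookup∘tabulate (λ i → does (lookup σ i <? i)) i
            | Vec.lookup∘tabulate (λ i → not (does (lookup σ i Fin.≟ i))) i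
      with lookup T i in eqT
    ... | true
      rewrite dec-true (lookup σ i Fin.≟ i) (disjoint i (Vec.lookup⇒[]= i T eqT)) = refl
    ... | false with Fin.<-cmp i (lookup σ i)
    ...   | tri< a ¬b ¬c rewrite dec-true (i <? lookup σ i) a
                               | dec-false (lookup σ i <? i) ¬c
                               | dec-false (lookup σ i Fin.≟ i) (¬b ∘ sym) = refl
    ...   | tri≈ ¬a b ¬c rewrite dec-false (i <? lookup σ i) ¬a
                               | dec-false (lookup σ i <? i) ¬c
                               | dec-true (lookup σ i Fin.≟ i) (sym b) = refl
    ...   | tri> ¬a ¬b c rewrite dec-false (i <? lookup σ i) ¬a
                               | dec-true (lookup σ i <? i) c
                               | dec-false (lookup σ i Fin.≟ i) (¬b ∘ sym) = refl

    ∣A∣≡∣B∣ : ∣ A ∣ ≡ ∣ B ∣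
    ∣A∣≡∣B∣ = ℕ.≤-antisym
      (card-≤ (enumerates B) (enumerates A) (lookup σ) σ-inj A→B)
      (card-≤ (enumerates A) (enumerates B) (lookup σ) σ-inj B→A)

    ∣A∣+∣B∣ : ∣ A ∣ ℕ.+ ∣ B ∣ ≡ 2 ℕ.* k
    ∣A∣+∣B∣ = trans (count-split A B T (matched σ) pointwise) size

    ∣A∣≡k : ∣ A ∣ ≡ k
    ∣A∣≡k = ℕ.*-cancelˡ-≡ ∣ A ∣ k 2 (trans
      (cong (∣ A ∣ ℕ.+_) (trans (ℕ.+-identityʳ ∣ A ∣) ∣A∣≡∣B∣)) ∣A∣+∣B∣)

    ∣B∣≡k : ∣ B ∣ ≡ k
    ∣B∣≡k = trans (sym ∣A∣≡∣B∣) ∣A∣≡k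

    filling-θ : Filling k n
    filling-θ = Vec.cast ∣A∣≡k (elements A) ∷ Vec.cast ∣B∣≡k (elements B) ∷ []

    private
      EA = enumerates-cast A ∣A∣≡k
      EB = enumerates-cast B ∣B∣≡k

    semistandard-θ : IsSemistandard filling-θ
    semistandard-θ = record { columns = cols ; rows = rws }
      where
      cols : ∀ c {r s} → r < s → entry filling-θ (r , c) < entry filling-θ (s , c)
      cols zero       = Enumerates.sorted EA
      cols (suc zero) = Enumerates.sorted EB
      rws : ∀ r {c d} → c ≤ d → entry filling-θ (r , c) ≤ entry filling-θ (r , d)
      rws r {zero}     {zero}     _ = ℕ.≤-refl
      rws r {zero}     {suc zero} _ = rowwise-≤ EA EB (lookup σ) σ-inj B→A σ-≤ r
      rws r {suc zero} {suc zero} _ = ℕ.≤-refl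

open Semistandardness using (module Columns)

θ : Pairing k n → SSYT k n
θ (pairing σ T p) = ssyt
  ( Vec.cast (Columns.∣A∣≡k p) (elements (T ∪ openers σ))
  ∷ Vec.cast (Columns.∣B∣≡k p) (elements (T ∪ closers σ))
  ∷ [])
  (Columns.semistandard-θ p)

------------------------------------------------------------------------
-- Integer polynomials, as coefficient lists (constant term first)

Poly : Set
Poly = List ℤ

NonZeroPoly : Poly → Set
NonZeroPoly = Any (_≢ 0ℤ)

module _ {c ℓ} (R : CommutativeRing c ℓ) where
  open CommutativeRing R hiding (zero) renaming (_-_ to _∸_)
  open import Algebra.Definitions.RawMonoid +-rawMonoid using () renaming (_×_ to _·_)

  fromℤ : ℤ → Carrier
  fromℤ (+ m)    = m · 1#
  fromℤ -[1+ m ] = - (suc m · 1#)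

  evalAt : Carrier → Poly → Carrier
  evalAt x = List.foldr (λ a y → fromℤ a + x * y) 0#

ringOf : ∀ {c ℓ₁ ℓ₂} → HeytingField c ℓ₁ ℓ₂ → CommutativeRing c ℓ₁
ringOf K = HeytingCommutativeRing.commutativeRing (HeytingField.heytingCommutativeRing K)

CharZero : ∀ {c ℓ₁ ℓ₂} → HeytingField c ℓ₁ ℓ₂ → Set ℓ₂
CharZero K = ∀ m → fromℤ (ringOf K) (+ suc m) # 0#
  where open HeytingField K

-- F is the field ℚ(q) of rational functions, i.e. the fraction field of ℤ[q]:
-- ℤ[q] → F inverts exactly the nonzero polynomials (hence is injective), and
-- every element of F is a fraction.
record IsRationalFunctionField {c ℓ} (F : CommutativeRing c ℓ)
                               (q : CommutativeRing.Carrier F) : Set (c ⊔ ℓ) where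
  open CommutativeRing F
  field
    nontrivial : ¬ (1# ≈ 0#)
    invert     : ∀ b → NonZeroPoly b → ∃ λ y → evalAt F q b * y ≈ 1#
    fraction   : ∀ x → ∃₂ λ a b → NonZeroPoly b × evalAt F q b * x ≈ evalAt F q a

------------------------------------------------------------------------
-- Exterior algebra and tensors, in coordinates with respect to e_I and e_I ⊗ e_J

module Tensors {c ℓ} (R : CommutativeRing c ℓ) (n : ℕ) where
  open CommutativeRing R hiding (zero) renaming (_-_ to _∸_)
  open import Algebra.Definitions.RawMonoid +-rawMonoid using (sum)

  Exterior : Set c
  Exterior = Subset n → Carrier

  Tensor : Set c
  Tensor = Subset n → Subset n → Carrier

  infix  4 _≋_
  infixl 6 _⊕_
  infixr 7 _•_

  _≋_ : Tensor → Tensor → Set ℓ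
  u ≋ w = ∀ I J → u I J ≈ w I J

  𝟎 : Tensor
  𝟎 I J = 0#

  _⊕_ : Tensor → Tensor → Tensor
  (u ⊕ w) I J = u I J + w I J

  _•_ : Carrier → Tensor → Tensor
  (a • u) I J = a * u I J

  ⨁ : ∀ {m} → (Fin m → Tensor) → Tensor
  ⨁ u I J = sum λ m → u m I J

  _⊗_ : Exterior → Exterior → Tensor
  (x ⊗ y) I J = x I * y J

  basis : Subset n → Exterior
  basis I J = if does (I ≟ₛ J) then 1# else 0#

  -- (e_1 ∧ … ∧ e_k)^{⊗2}
  v₊ : ℕ → Tensor
  v₊ k = basis (initial n k) ⊗ basis (initial n k)

  sign : ℕ → Carrier
  sign zero    = 1#
  sign (suc m) = - sign m

  -- v ∧ x, from e_i ∧ e_{I∖i} = (-1)^#{j ∈ I : j < i} e_I for i ∈ I.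
  _∧∧_ : (Fin n → Carrier) → Exterior → Exterior
  (v ∧∧ x) I = sum λ i →
    if lookup I i then sign ∣ I ∩ initial n (toℕ i) ∣ * (v i * x (I - i)) else 0#

  ⋀ : (Fin k → Fin n → Carrier) → Exterior
  ⋀ = Vector.foldr _∧∧_ (basis (initial n 0))

  data Span {a p} (A : Pred Carrier a) (P : Pred Tensor p) : Tensor → Set (c ⊔ ℓ ⊔ a ⊔ p) where
    incl  : ∀ {u} → P u → Span A P u
    add   : ∀ {u w} → Span A P u → Span A P w → Span A P (u ⊕ w)
    scale : ∀ {a u} → A a → Span A P u → Span A P (a • u)
    resp  : ∀ {u w} → u ≋ w → Span A P u → Span A P w

------------------------------------------------------------------------
-- R(k,n)₂, V(2ω_k) and V(2ω_k)^* over a ring K of scalars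

module Classical {c ℓ} (K : CommutativeRing c ℓ) (k n : ℕ) where
  open CommutativeRing K hiding (zero) renaming (_-_ to _∸_)
  open import Algebra.Definitions.RawMonoid +-rawMonoid using (sum)
  open import Data.Unit.Polymorphic using (⊤)
  open Tensors K n

  -- A quadratic form Σ c Δ_I Δ_J, as the list of its terms.
  Quadric : Set c
  Quadric = List (Carrier × KSubset k n × KSubset k n)

  Δ_·Δ_ : KSubset k n → KSubset k n → Quadric
  Δ I ·Δ J = (1# , I , J) ∷ []

  evaluate : Quadric → Exterior → Carrier
  evaluate p x = List.foldr (λ (a , (I , _) , (J , _)) y → a * (x I * x J) + y) 0# p

  -- Equality in R(k,n)₂: equality of functions on the cone of decomposable vectors.
  infix 4 _≈R_
  _≈R_ : Quadric → Quadric → Set (c ⊔ ℓ)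
  p ≈R p′ = ∀ (v : Fin k → Fin n → Carrier) → evaluate p (⋀ v) ≈ evaluate p′ (⋀ v)

  IsTemperleyLieb : (Pairing k n → Quadric) → Set (c ⊔ ℓ)
  IsTemperleyLieb Δτ = ∀ I J → (Δ I ·Δ J) ≈R List.concatMap Δτ (compatibles I J)

  Matrix : Set c
  Matrix = Fin n → Fin n → Carrier

  IsInverse : Matrix → Matrix → Set ℓ
  IsInverse g h = ∀ i j →
    sum (λ m → g i m * h m j) ≈ (if does (i Fin.≟ j) then 1# else 0#)

  module _ (k≤n : k ℕ.≤ n) where

    -- g e_1 ∧ … ∧ g e_k
    translate : Matrix → Exterior
    translate g = ⋀ λ (j : Fin k) i → g i (inject≤ j k≤n)

    -- The GL(n)-orbit of v₊.
    Orbit : Tensor → Set (c ⊔ ℓ)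
    Orbit u = ∃₂ λ g h → IsInverse g h × IsInverse h g × u ≋ translate g ⊗ translate g

    V : Tensor → Set (c ⊔ ℓ)
    V = Span {a = c} (λ _ → ⊤) Orbit

    record Dual : Set (c ⊔ ℓ) where
      field
        _⟨_⟩     : ∀ u → V u → Carrier
        cong-⟨⟩  : ∀ {u w} (p : V u) (p′ : V w) → u ≋ w → u ⟨ p ⟩ ≈ w ⟨ p′ ⟩
        add-⟨⟩   : ∀ {u w} (p : V u) (p′ : V w) → (u ⊕ w) ⟨ add p p′ ⟩ ≈ u ⟨ p ⟩ + w ⟨ p′ ⟩
        scale-⟨⟩ : ∀ a {u} (p : V u) → (a • u) ⟨ scale _ p ⟩ ≈ a * u ⟨ p ⟩

    -- Equality of f ∈ R(k,n)₂ and φ ∈ V(2ω_k)^* under R(k,n)₂ = V(2ω_k)^*: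
    -- f is the function x ↦ φ(x ⊗ x) on the cone.
    infix 4 _≈V*_
    _≈V*_ : Quadric → Dual → Set (c ⊔ ℓ)
    f ≈V* φ = ∀ (v : Fin k → Fin n → Carrier) → let x = ⋀ v in
      Σ (V (x ⊗ x)) λ p → evaluate f x ≈ Dual._⟨_⟩ φ (x ⊗ x) p

    IsDualBasis : (SSYT k n → Dual) → (SSYT k n → ∃ V) → Set ℓ
    IsDualBasis H G =
      (∀ S → Dual._⟨_⟩ (H S) (proj₁ (G S)) (proj₂ (G S)) ≈ 1#) ×
      (∀ S S′ → S ≢ S′ → Dual._⟨_⟩ (H S) (proj₁ (G S′)) (proj₂ (G S′)) ≈ 0#)

------------------------------------------------------------------------
-- The canonical basis of V_q(2ω_k), realised inside V_q(ω_k) ⊗ V_q(ω_k)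

module Quantum {c ℓ} (F : CommutativeRing c ℓ) (q : CommutativeRing.Carrier F)
               (isℚ⟨q⟩ : IsRationalFunctionField F q)
               (k n : ℕ) (k≤n : k ℕ.≤ n) where
  open CommutativeRing F hiding (zero) renaming (_-_ to _∸_)
  open import Algebra.Properties.Semiring.Exp semiring using (_^_)
  open IsRationalFunctionField isℚ⟨q⟩
  open Tensors F n

  q⁻¹ : Carrier
  q⁻¹ = proj₁ (invert (0ℤ ∷ 1ℤ ∷ []) (there (here λ ())))

  -- 1 + q² + … + q^{2r}
  evens : ℕ → Poly
  evens zero    = 1ℤ ∷ []
  evens (suc r) = 1ℤ ∷ 0ℤ ∷ evens r

  evens-nonZero : ∀ r → NonZeroPoly (evens r)
  evens-nonZero zero    = here λ ()
  evens-nonZero (suc r) = here λ ()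

  -- 1/[r+1], where [r+1] = (q^{r+1} - q^{-r-1})/(q - q⁻¹) = q^{-r}(1 + q² + … + q^{2r})
  1/[1+_] : ℕ → Carrier
  1/[1+ r ] = q ^ r * proj₁ (invert (evens r) (evens-nonZero r))

  -- Rational functions regular at q = 0.
  Regular : Carrier → Set ℓ
  Regular x = ∃₂ λ a b → ∃ λ b₀ → b₀ ≢ 0ℤ × evalAt F q (b₀ ∷ b) * x ≈ evalAt F q a

  -- ℤ[q,q⁻¹]
  Laurent : Carrier → Set ℓ
  Laurent x = ∃₂ λ a m → q ^ m * x ≈ evalAt F q a

  -- The field automorphism q ↦ q⁻¹ sends x to y.
  BarScalar : Carrier → Carrier → Set ℓ
  BarScalar x y = ∃₂ λ a b → NonZeroPoly b
    × evalAt F q b * x ≈ evalAt F q a × evalAt F q⁻¹ b * y ≈ evalAt F q⁻¹ a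

  module _ (i : Node n) where
    open Node i

    -- q^{⟨h_i, wt I⟩} and its inverse
    t t⁻¹ : Subset n → Carrier
    t I with lookup I lo | lookup I hi
    ... | true  | false = q
    ... | false | true  = q⁻¹
    ... | _     | _     = 1#
    t⁻¹ I with lookup I lo | lookup I hi
    ... | true  | false = q⁻¹
    ... | false | true  = q
    ... | _     | _     = 1#

    -- On V_q(ω_k), f_i e_I = e_{I∖{i}∪{i+1}} if i ∈ I, i+1 ∉ I, and 0 otherwise;
    -- e_i is its transpose.  These are the resulting maps on coordinates.
    fΛ eΛ : Exterior → Exterior
    fΛ x I = if not (lookup I lo) ∧ lookup I hi then x (I [ lo ]≔ true [ hi ]≔ false) else 0#
    eΛ x I = if lookup I lo ∧ not (lookup I hi) then x (I [ lo ]≔ false [ hi ]≔ true) else 0#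

    -- The coproduct is f_i ↦ f_i ⊗ t_i + 1 ⊗ f_i, e_i ↦ e_i ⊗ 1 + t_i⁻¹ ⊗ e_i.
    f e : Tensor → Tensor
    f u I J = t J * fΛ (λ I′ → u I′ J) I + fΛ (u I) J
    e u I J = eΛ (λ I′ → u I′ J) I + t⁻¹ I * eΛ (u I) J

    -- f_i^{(r)} = f_i^r / [r]!
    f⁽_⁾ : ℕ → Tensor → Tensor
    f⁽ zero  ⁾ u = u
    f⁽ suc r ⁾ u = 1/[1+ r ] • f (f⁽ r ⁾ u)

    -- Kashiwara's operator: f̃_i u = u′ when u = Σ_m f_i^{(m)} u_m with e_i u_m = 0
    -- and u′ = Σ_m f_i^{(m+1)} u_m.  As V_q(2ω_k) is a direct summand of the
    -- integrable module V_q(ω_k) ⊗ V_q(ω_k), the u_m may be taken in the latter.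
    Kashiwara-f̃ : Tensor → Tensor → Set (c ⊔ ℓ)
    Kashiwara-f̃ u u′ = ∃ λ N → Σ (Fin N → Tensor) λ w →
      (∀ m → e (w m) ≋ 𝟎)
      × u ≋ ⨁ (λ m → f⁽ toℕ m ⁾ (w m))
      × u′ ≋ ⨁ (λ m → f⁽ suc (toℕ m) ⁾ (w m))

  data DividedPowerMonomial : Tensor → Set c where
    start : DividedPowerMonomial (v₊ k)
    step  : ∀ i r {u} → DividedPowerMonomial u → DividedPowerMonomial (f⁽_⁾ i r u)

  IntegralForm : Tensor → Set (c ⊔ ℓ)
  IntegralForm = Span Laurent DividedPowerMonomial

  data Kashiwara-f̃Monomial : Tensor → Set (c ⊔ ℓ) where
    start : Kashiwara-f̃Monomial (v₊ k)
    step  : ∀ i {u u′} → Kashiwara-f̃ i u u′ → Kashiwara-f̃Monomial u → Kashiwara-f̃Monomial u′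

  -- The crystal lattice at q = 0.
  Lattice : Tensor → Set (c ⊔ ℓ)
  Lattice = Span Regular Kashiwara-f̃Monomial

  infix 4 _≡_[mod-qL]
  _≡_[mod-qL] : Tensor → Tensor → Set (c ⊔ ℓ)
  u ≡ w [mod-qL] = ∃ λ x → Lattice x × u ≋ w ⊕ q • x

  -- The graph of the bar involution P v₊ ↦ P̄ v₊ of V_q(2ω_k) = U_q⁻ v₊.
  data Bar : Tensor → Tensor → Set (c ⊔ ℓ) where
    bar-v₊    : Bar (v₊ k) (v₊ k)
    bar-f     : ∀ i {u u′} → Bar u u′ → Bar (f i u) (f i u′)
    bar-add   : ∀ {u u′ w w′} → Bar u u′ → Bar w w′ → Bar (u ⊕ w) (u′ ⊕ w′)
    bar-scale : ∀ {a a′ u u′} → BarScalar a a′ → Bar u u′ → Bar (a • u) (a′ • u′)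
    bar-resp  : ∀ {u u′ w w′} → u ≋ w → u′ ≋ w′ → Bar u u′ → Bar w w′

  -- The last three conditions say that S ↦ G(S) mod qL is the isomorphism from
  -- the crystal of tableaux to that of V_q(2ω_k).
  record IsCanonicalBasis (G : SSYT k n → Tensor) : Set (c ⊔ ℓ) where
    field
      integral      : ∀ S → IntegralForm (G S)
      barInvariant  : ∀ S → Bar (G S) (G S)
      inLattice     : ∀ S → Lattice (G S)
      highest       : ∀ S → filling S ≡ highestFilling k≤n → G S ≡ v₊ k [mod-qL]
      crystal       : ∀ i S S′ → f̃-tableau i (filling S) ≡ just (filling S′) →
                      ∃ λ u → Kashiwara-f̃ i (G S) u × u ≡ G S′ [mod-qL]
      crystal-zero  : ∀ i S → f̃-tableau i (filling S) ≡ nothing →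
                      ∃ λ u → Kashiwara-f̃ i (G S) u × u ≡ 𝟎 [mod-qL]

  module _ {c′ ℓ′} (K : CommutativeRing c′ ℓ′) where
    private module K = CommutativeRing K

    -- x ∈ ℤ[q,q⁻¹] takes the value y at q = 1.
    ValueAt1 : Carrier → K.Carrier → Set (ℓ ⊔ ℓ′)
    ValueAt1 x y = ∃₂ λ a m → q ^ m * x ≈ evalAt F q a × y K.≈ evalAt K K.1# a

    -- w is the specialization of u at q = 1.
    SpecializesTo : Tensor → Tensors.Tensor K n → Set (ℓ ⊔ ℓ′)
    SpecializesTo u w = ∀ I J → ValueAt1 (u I J) (w I J)

{-# OPTIONS --safe #-}

-- If S = θ(τ, T), the coordinate of G(S) at e_I ⊗ e_J is q^m when (I, J) is
-- compatible with (τ, T), where m is the number of strands whose smaller end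
-- lies in J, and 0 otherwise.  At q = 1 the identities defining the immanants
-- therefore say that x ⊗ x = Σ Δ_(τ,T)(x) G(θ(τ, T)) for all decomposable x, and
-- it remains to apply H(θ(τ, T)).
--
-- To find G(S), note that V_q(2ω_k) lies in the kernel of the raising operator of
-- the U_q(𝔰𝔩₂) that commutes with U_q(𝔰𝔩ₙ) on Λ ⊗ Λ (skew Howe duality).  The
-- tensors C_w described above, indexed by ballot words w, form a basis of this
-- kernel in weight zero, and the coefficients of an expansion can be read off,
-- modulo q, from the coordinates at the pairs of columns of tableaux.  In
-- coordinates, the bar involution replaces q by q⁻¹, exchanges the two factors
-- and multiplies by a power of q that fixes every C_w.  Hence the coefficients of
-- G(S) are bar invariant Laurent polynomials that are regular at q = 0, and they
-- are the residues there.  Following f̃_i from the highest tableau shows that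
-- G(S) ≡ e_A ⊗ e_B modulo q, where A and B are the columns of S, so exactly one
-- coefficient is 1 and the others are 0.

module Submission where

open import Defs
open import Level using (Level; _⊔_)
open import Algebra.Bundles using (CommutativeRing)
open import Algebra.Apartness.Bundles using (HeytingField)
open import Data.Bool using (Bool; true; false; not; _∧_; _∨_; _xor_; if_then_else_)
import Data.Bool.Properties as Bool
open import Data.Empty using (⊥-elim)
open import Data.Fin as Fin using (Fin; zero; suc; toℕ; inject₁; inject≤; fromℕ<)
import Data.Fin.Induction as Fin
import Data.Fin.Properties as Fin
open import Data.Fin.Subset as Subset using (Subset; ∣_∣; _∈_; _∪_; _∩_)
open import Data.Fin.Subset.Properties using (p⊂q⇒∣p∣<∣q∣; p─⊥≡p)
open import Data.Integer as ℤ using (ℤ; +_; -[1+_]; 0ℤ; 1ℤ)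
import Data.Integer.Properties as ℤ
open import Data.List as List using (List; []; _∷_; _++_; concatMap)
open import Data.List.Membership.Propositional using () renaming (_∈_ to _∈ᴸ_)
open import Data.List.Membership.Propositional.Properties using (∈-allFin; ∈-concatMap⁺; ∈-cartesianProduct⁺; ∈-cartesianProductWith⁺)
import Data.List.Properties as List
open import Data.List.Relation.Unary.All as All using (All; []; _∷_)
import Data.List.Relation.Unary.All.Properties as All
open import Data.List.Relation.Unary.AllPairs as AllPairs using (AllPairs; []; _∷_)
import Data.List.Relation.Unary.AllPairs.Properties as AllPairs
open import Data.List.Relation.Unary.Any as Any using (here; there)
import Data.List.Relation.Unary.Any.Properties as Any
open import Data.List.Relation.Unary.Unique.Propositional using (Unique)
open import Data.List.Relation.Unary.Unique.Propositional.Properties using (allFin⁺; cartesianProduct⁺; cartesianProductWith⁺)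
open import Data.Maybe as Maybe using (Maybe; just; nothing)
open import Data.Nat as ℕ using (ℕ; zero; suc)
import Data.Nat.Induction as ℕ
import Data.Nat.Properties as ℕ
open import Data.Product using (Σ; ∃; ∃₂; _×_; _,_; proj₁; proj₂; uncurry)
open import Data.Sum as Sum using (_⊎_; inj₁; inj₂)
open import Data.Sum.Properties using (inj₂-injective)
open import Data.Vec as Vec using (Vec; []; _∷_; lookup; tabulate; replicate; _[_]≔_; _[_]%=_)
import Data.Vec.Properties as Vec
open import Data.Vec.Relation.Binary.Pointwise.Extensional using (ext; Pointwise-≡⇒≡)
open import Data.Vec.Relation.Unary.Any as VecAny using (here; there)
open import Function using (_∘_; flip)
open import Induction.WellFounded using (Acc; acc)
open import Relation.Binary using (tri<; tri≈; tri>)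
open import Relation.Binary.PropositionalEquality as ≡ using (_≡_; _≢_)
open import Relation.Nullary using (¬_; Dec; yes; no; does; contradiction; _×-dec_; _→-dec_)
open import Relation.Nullary.Decidable using (dec-true; dec-false; recompute; map′)

-- `Bar` and `Kashiwara-f̃` are relations, given by generators and by an unspecified decomposition,
-- so no value can be computed from them. Each is replaced by identities between coordinates that
-- hold for all related pairs. For f̃_i this works because each tensor factor can be lowered at most
-- once: f_i^(3) = 0, and the identities can be chosen linear and independent of the divided power,
-- so that they may be checked on each summand f_i^(m) u_m and added up. The expansion in the C_w
-- goes by induction on the number of letters. Deleting the first letter leads out of the kernel of
-- the raising operator E, so the statement is generalised to suffixes of words: the h openers still
-- to be closed are kept on a stack, and ker E in weight 0 becomes ker E^(h+1) in weight h. The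
-- field ℚ(q) is accessible only through the inversion of nonzero polynomials. The arguments about
-- it rest on the resulting embedding of ℤ[q], by which an identity at q is one between coefficients
-- and transfers to q⁻¹, to 0 and, in the ring K, to 1.

private
  variable
    k n h N : ℕ

All-reverse : ∀ {a p} {A : Set a} {P : A → Set p} {xs} → All P xs → All P (List.reverse xs)
All-reverse [] = []
All-reverse {P = P} {x ∷ xs} (px ∷ pxs) =
  ≡.subst (All P) (≡.sym (List.unfold-reverse x xs)) (All.++⁺ (All-reverse pxs) (px ∷ []))

-- Integer polynomials and their values in a commutative ring.

module IntegerCoefficients {c ℓ} (R : CommutativeRing c ℓ) where
  open CommutativeRing R hiding (zero)
  open import Algebra.Properties.Ring ring using (-0#≈0#; -‿+-comm; -‿involutive; -‿distribˡ-*; -‿distribʳ-*)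
  open import Algebra.Definitions.RawMonoid +-rawMonoid using () renaming (_×_ to _·_)
  open import Algebra.Properties.Semiring.Mult semiring using (×-homo-+; ×1-homo-*)
  open import Relation.Binary.Reasoning.Setoid setoid
  import Algebra.Properties.CommutativeSemigroup +-commutativeSemigroup as +-CS

  fromℤ-⊖ : ∀ m n → fromℤ R (m ℤ.⊖ n) ≈ m · 1# - n · 1#
  fromℤ-⊖ m zero = sym (trans (+-congˡ -0#≈0#) (+-identityʳ _))
  fromℤ-⊖ zero (suc n) = sym (+-identityˡ _)
  fromℤ-⊖ (suc m) (suc n) = begin
    fromℤ R (suc m ℤ.⊖ suc n)              ≡⟨ ≡.cong (fromℤ R) (ℤ.[1+m]⊖[1+n]≡m⊖n m n) ⟩
    fromℤ R (m ℤ.⊖ n)                      ≈⟨ fromℤ-⊖ m n ⟩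
    m · 1# - n · 1#                        ≈⟨ +-identityˡ _ ⟨
    0# + (m · 1# - n · 1#)                 ≈⟨ +-congʳ (-‿inverseʳ 1#) ⟨
    (1# - 1#) + (m · 1# - n · 1#)          ≈⟨ +-CS.interchange _ _ _ _ ⟩
    (1# + m · 1#) + (- 1# - n · 1#)        ≈⟨ +-congˡ (-‿+-comm _ _) ⟩
    suc m · 1# - suc n · 1#                ∎

  fromℤ-neg : ∀ a → fromℤ R (ℤ.- a) ≈ - fromℤ R a
  fromℤ-neg (+ zero)  = sym -0#≈0#
  fromℤ-neg (+ suc n) = refl
  fromℤ-neg -[1+ n ]  = sym (-‿involutive _)

  fromℤ-+ : ∀ a b → fromℤ R (a ℤ.+ b) ≈ fromℤ R a + fromℤ R b
  fromℤ-+ (+ m)    (+ n)    = ×-homo-+ 1# m n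
  fromℤ-+ (+ m)    -[1+ n ] = fromℤ-⊖ m (suc n)
  fromℤ-+ -[1+ m ] (+ n)    = trans (fromℤ-⊖ n (suc m)) (+-comm _ _)
  fromℤ-+ -[1+ m ] -[1+ n ] = begin
    - (suc (suc (m ℕ.+ n)) · 1#)           ≈⟨ -‿cong (+-congˡ (×-homo-+ 1# (suc m) n)) ⟩
    - (1# + (suc m · 1# + n · 1#))         ≈⟨ -‿cong (+-CS.x∙yz≈y∙xz _ _ _) ⟩
    - (suc m · 1# + suc n · 1#)            ≈⟨ -‿+-comm _ _ ⟨
    - (suc m · 1#) - suc n · 1#            ∎

  private
    fromℤ-pos*neg : ∀ m n → fromℤ R (+ m ℤ.* (ℤ.- (+ n))) ≈ m · 1# * - (n · 1#)
    fromℤ-pos*neg m n = begin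
      fromℤ R (+ m ℤ.* (ℤ.- (+ n)))  ≡⟨ ≡.cong (fromℤ R) (≡.sym (ℤ.neg-distribʳ-* (+ m) (+ n))) ⟩
      fromℤ R (ℤ.- (+ m ℤ.* + n))    ≡⟨ ≡.cong (λ z → fromℤ R (ℤ.- z)) (≡.sym (ℤ.pos-* m n)) ⟩
      fromℤ R (ℤ.- (+ (m ℕ.* n)))    ≈⟨ fromℤ-neg (+ (m ℕ.* n)) ⟩
      - ((m ℕ.* n) · 1#)             ≈⟨ -‿cong (×1-homo-* m n) ⟩
      - (m · 1# * n · 1#)            ≈⟨ -‿distribʳ-* _ _ ⟩
      m · 1# * - (n · 1#)            ∎

  fromℤ-* : ∀ a b → fromℤ R (a ℤ.* b) ≈ fromℤ R a * fromℤ R b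
  fromℤ-* (+ m)    (+ n)    = trans (reflexive (≡.cong (fromℤ R) (≡.sym (ℤ.pos-* m n)))) (×1-homo-* m n)
  fromℤ-* (+ m)    -[1+ n ] = fromℤ-pos*neg m (suc n)
  fromℤ-* -[1+ m ] (+ n)    = begin
    fromℤ R (-[1+ m ] ℤ.* + n)  ≡⟨ ≡.cong (fromℤ R) (ℤ.*-comm -[1+ m ] (+ n)) ⟩
    fromℤ R (+ n ℤ.* -[1+ m ])  ≈⟨ fromℤ-pos*neg n (suc m) ⟩
    n · 1# * - (suc m · 1#)     ≈⟨ *-comm _ _ ⟩
    - (suc m · 1#) * n · 1#     ∎
  fromℤ-* -[1+ m ] -[1+ n ] = begin
    fromℤ R (+ (suc m ℕ.* suc n))     ≈⟨ ×1-homo-* (suc m) (suc n) ⟩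
    suc m · 1# * suc n · 1#           ≈⟨ -‿involutive _ ⟨
    - - (suc m · 1# * suc n · 1#)     ≈⟨ -‿cong (-‿distribʳ-* _ _) ⟩
    - (suc m · 1# * - (suc n · 1#))   ≈⟨ -‿distribˡ-* _ _ ⟩
    - (suc m · 1#) * - (suc n · 1#)   ∎

  import Algebra.Solver.Ring as Solver
  open import Algebra.Solver.Ring.AlmostCommutativeRing using (fromCommutativeRing; _-Raw-AlmostCommutative⟶_)

  private
    coefficients : ℤ.+-*-rawRing -Raw-AlmostCommutative⟶ fromCommutativeRing R
    coefficients = record
      { ⟦_⟧    = fromℤ R
      ; +-homo = fromℤ-+
      ; *-homo = fromℤ-*
      ; -‿homo = fromℤ-neg
      ; 0-homo = refl
      ; 1-homo = +-identityʳ 1#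
      }

    -- Equality in R need not be decidable, so normal forms are compared through integer
    -- coefficients; a cancellation is recognised because its coefficient is the integer 0.
    equal? : ∀ a b → Maybe (fromℤ R a ≈ fromℤ R b)
    equal? a b with a ℤ.≟ b
    ... | yes a≡b = just (reflexive (≡.cong (fromℤ R) a≡b))
    ... | no _    = nothing

  module RingSolver = Solver ℤ.+-*-rawRing (fromCommutativeRing R) coefficients equal?

infixl 6 _+ᵖ_
infixl 7 _*ᵖ_

_+ᵖ_ _*ᵖ_ : Poly → Poly → Poly
[]      +ᵖ r       = r
(a ∷ p) +ᵖ []      = a ∷ p
(a ∷ p) +ᵖ (b ∷ r) = a ℤ.+ b ∷ p +ᵖ r

-ᵖ_ : Poly → Poly
-ᵖ_ = List.map (ℤ.-_)

scaleᵖ : ℤ → Poly → Poly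
scaleᵖ a = List.map (a ℤ.*_)

[]      *ᵖ r = []
(a ∷ p) *ᵖ r = scaleᵖ a r +ᵖ (0ℤ ∷ p *ᵖ r)

Xᵖ_ : ℕ → Poly
Xᵖ zero  = 1ℤ ∷ []
Xᵖ suc m = 0ℤ ∷ Xᵖ m

IsZeroPoly : Poly → Set
IsZeroPoly = All (_≡ 0ℤ)

isZero⊎nonZero : ∀ p → IsZeroPoly p ⊎ NonZeroPoly p
isZero⊎nonZero [] = inj₁ []
isZero⊎nonZero (a ∷ p) with a ℤ.≟ 0ℤ | isZero⊎nonZero p
... | no a≢0  | _           = inj₂ (here a≢0)
... | yes a≡0 | inj₁ p≡0    = inj₁ (a≡0 ∷ p≡0)
... | yes a≡0 | inj₂ p≢0    = inj₂ (there p≢0)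

module Evaluation {c ℓ} (R : CommutativeRing c ℓ) (x : CommutativeRing.Carrier R) where
  open CommutativeRing R hiding (zero)
  open IntegerCoefficients R
  open import Algebra.Properties.Ring ring using (-0#≈0#)
  open import Algebra.Properties.Semiring.Exp semiring using (_^_)
  open import Relation.Binary.Reasoning.Setoid setoid
  open RingSolver using (solve; _:=_; _:+_; _:*_; :-_; con)

  ⟦_⟧ : Poly → Carrier
  ⟦_⟧ = evalAt R x

  eval-+ : ∀ p r → ⟦ p +ᵖ r ⟧ ≈ ⟦ p ⟧ + ⟦ r ⟧
  eval-+ []      r       = sym (+-identityˡ _)
  eval-+ (a ∷ p) []      = sym (+-identityʳ _)
  eval-+ (a ∷ p) (b ∷ r) = begin
    fromℤ R (a ℤ.+ b) + x * ⟦ p +ᵖ r ⟧              ≈⟨ +-cong (fromℤ-+ a b) (*-congˡ (eval-+ p r)) ⟩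
    fromℤ R a + fromℤ R b + x * (⟦ p ⟧ + ⟦ r ⟧)     ≈⟨ solve 5 (λ a b x p r → a :+ b :+ x :* (p :+ r)
        := (a :+ x :* p) :+ (b :+ x :* r)) refl _ _ _ _ _ ⟩
    ⟦ a ∷ p ⟧ + ⟦ b ∷ r ⟧                           ∎

  eval-neg : ∀ p → ⟦ -ᵖ p ⟧ ≈ - ⟦ p ⟧
  eval-neg []      = sym -0#≈0#
  eval-neg (a ∷ p) = begin
    fromℤ R (ℤ.- a) + x * ⟦ -ᵖ p ⟧  ≈⟨ +-cong (fromℤ-neg a) (*-congˡ (eval-neg p)) ⟩
    - fromℤ R a + x * - ⟦ p ⟧       ≈⟨ solve 3 (λ a x p → :- a :+ x :* :- p := :- (a :+ x :* p)) refl _ _ _ ⟩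
    - ⟦ a ∷ p ⟧                     ∎

  eval-scale : ∀ a p → ⟦ scaleᵖ a p ⟧ ≈ fromℤ R a * ⟦ p ⟧
  eval-scale a []      = sym (zeroʳ _)
  eval-scale a (b ∷ p) = begin
    fromℤ R (a ℤ.* b) + x * ⟦ scaleᵖ a p ⟧           ≈⟨ +-cong (fromℤ-* a b) (*-congˡ (eval-scale a p)) ⟩
    fromℤ R a * fromℤ R b + x * (fromℤ R a * ⟦ p ⟧)  ≈⟨ solve 4 (λ a b x p → a :* b :+ x :* (a :* p) := a :* (b :+ x :* p)) refl _ _ _ _ ⟩
    fromℤ R a * ⟦ b ∷ p ⟧                            ∎

  eval-* : ∀ p r → ⟦ p *ᵖ r ⟧ ≈ ⟦ p ⟧ * ⟦ r ⟧
  eval-* []      r = sym (zeroˡ _)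
  eval-* (a ∷ p) r = begin
    ⟦ scaleᵖ a r +ᵖ (0ℤ ∷ p *ᵖ r) ⟧                ≈⟨ eval-+ (scaleᵖ a r) _ ⟩
    ⟦ scaleᵖ a r ⟧ + (0# + x * ⟦ p *ᵖ r ⟧)         ≈⟨ +-cong (eval-scale a r) (+-congˡ (*-congˡ (eval-* p r))) ⟩
    fromℤ R a * ⟦ r ⟧ + (0# + x * (⟦ p ⟧ * ⟦ r ⟧)) ≈⟨ solve 4 (λ a r x p → a :* r :+ (con 0ℤ :+ x :* (p :* r))
        := (a :+ x :* p) :* r) refl _ _ _ _ ⟩
    ⟦ a ∷ p ⟧ * ⟦ r ⟧                              ∎

  eval-X : ∀ m → ⟦ Xᵖ m ⟧ ≈ x ^ m
  eval-X zero    = trans (+-cong (+-identityʳ 1#) (zeroʳ x)) (+-identityʳ 1#)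
  eval-X (suc m) = trans (+-identityˡ _) (*-congˡ (eval-X m))

  eval-++ : ∀ p r → ⟦ p List.++ r ⟧ ≈ ⟦ p ⟧ + x ^ List.length p * ⟦ r ⟧
  eval-++ []      r = sym (trans (+-identityˡ _) (*-identityˡ _))
  eval-++ (a ∷ p) r = trans (+-congˡ (*-congˡ (eval-++ p r)))
    (solve 5 (λ a x p y r → a :+ x :* (p :+ y :* r) := (a :+ x :* p) :+ (x :* y) :* r) refl _ _ _ _ _)

  eval-zero : ∀ {p} → IsZeroPoly p → ⟦ p ⟧ ≈ 0#
  eval-zero []              = refl
  eval-zero (≡.refl ∷ p≡0)  = trans (+-identityˡ _) (trans (*-congˡ (eval-zero p≡0)) (zeroʳ x))

  -- Coefficient lists may end in zeros, so two lists for the same polynomial can differ. Equality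
  -- of polynomials is therefore expressed by a difference all of whose coefficients vanish.
  eval-equal : ∀ p r → IsZeroPoly (p +ᵖ -ᵖ r) → ⟦ p ⟧ ≈ ⟦ r ⟧
  eval-equal p r p-r≡0 = begin
    ⟦ p ⟧                       ≈⟨ solve 2 (λ p r → p := (p :+ :- r) :+ r) refl _ _ ⟩
    (⟦ p ⟧ - ⟦ r ⟧) + ⟦ r ⟧     ≈⟨ +-congʳ (trans (eval-+ p (-ᵖ r)) (+-congˡ (eval-neg r))) ⟨
    ⟦ p +ᵖ -ᵖ r ⟧ + ⟦ r ⟧       ≈⟨ +-congʳ (eval-zero p-r≡0) ⟩
    0# + ⟦ r ⟧                  ≈⟨ +-identityˡ _ ⟩
    ⟦ r ⟧                       ∎

-- The inductive form of `toℕ hi ≡ suc (toℕ lo)`. Induction on it moves i to the first position,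
-- where statements about f_i become finite case checks on the bits at i and i + 1.
data Adjacent : ∀ {n} → Fin n → Fin n → Set where
  base : ∀ {n} → Adjacent {suc (suc n)} zero (suc zero)
  step : ∀ {n} {lo hi : Fin n} → Adjacent lo hi → Adjacent (suc lo) (suc hi)

adjacent⁺ : ∀ {n} {lo hi : Fin n} → toℕ hi ≡ suc (toℕ lo) → Adjacent lo hi
adjacent⁺ {lo = zero}  {suc zero}     e = base
adjacent⁺ {lo = suc lo} {suc hi}      e = step (adjacent⁺ (ℕ.suc-injective e))

-- Ballot words and pairs of subsets.

-- Ballot sequences: the words of height h are the suffixes of a word of
-- balanced parentheses (up, down) that follow a prefix with h unmatched
-- openers; `none` and `both` are neutral letters.
data Word : ℕ → ℕ → Set where
  []   : Word 0 0
  none : ∀ {h N} → Word h N → Word h (suc N)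
  both : ∀ {h N} → Word h N → Word h (suc N)
  up   : ∀ {h N} → Word (suc h) N → Word h (suc N)
  down : ∀ {h N} → Word h N → Word (suc h) (suc N)

left right : ∀ {h N} → Word h N → Subset N
left []       = []
left (none w) = false ∷ left w
left (both w) = true ∷ left w
left (up w)   = true ∷ left w
left (down w) = false ∷ left w
right []       = []
right (none w) = false ∷ right w
right (both w) = true ∷ right w
right (up w)   = false ∷ right w
right (down w) = true ∷ right w

-- The size of the symmetric difference. Half of it is the exponent of q that the bar involution
-- contributes at the coordinate (I, J).
distance : ∀ {N} → Subset N → Subset N → ℕ
distance []          []          = 0
distance (true ∷ I)  (false ∷ J) = suc (distance I J)
distance (false ∷ I) (true ∷ J)  = suc (distance I J)
distance (true ∷ I)  (true ∷ J)  = distance I J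
distance (false ∷ I) (false ∷ J) = distance I J

none-injective : ∀ {h N} {w w′ : Word h N} → none w ≡ none w′ → w ≡ w′
none-injective ≡.refl = ≡.refl

both-injective : ∀ {h N} {w w′ : Word h N} → both w ≡ both w′ → w ≡ w′
both-injective ≡.refl = ≡.refl

up-injective : ∀ {h N} {w w′ : Word (suc h) N} → up w ≡ up w′ → w ≡ w′
up-injective ≡.refl = ≡.refl

down-injective : ∀ {h N} {w w′ : Word h N} → down w ≡ down w′ → w ≡ w′
down-injective ≡.refl = ≡.refl

-- The exponent of q in the coefficient of C_w at e_I ⊗ e_J.
exponent : ∀ {h N} → Word h N → Vec Bool h → Subset N → Subset N → Maybe ℕ
exponent []       []           []          []          = just 0
exponent (none w) st           (false ∷ I) (false ∷ J) = exponent w st I J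
exponent (none w) st           (_ ∷ I)     (_ ∷ J)     = nothing
exponent (both w) st           (true ∷ I)  (true ∷ J)  = exponent w st I J
exponent (both w) st           (_ ∷ I)     (_ ∷ J)     = nothing
exponent (up w)   st           (true ∷ I)  (false ∷ J) = exponent w (true ∷ st) I J
exponent (up w)   st           (false ∷ I) (true ∷ J)  = exponent w (false ∷ st) I J
exponent (up w)   st           (_ ∷ I)     (_ ∷ J)     = nothing
exponent (down w) (true ∷ st)  (false ∷ I) (true ∷ J)  = exponent w st I J
exponent (down w) (false ∷ st) (true ∷ I)  (false ∷ J) = Maybe.map suc (exponent w st I J)
exponent (down w) (_ ∷ st)     (_ ∷ I)     (_ ∷ J)     = nothing

-- The 𝔰𝔩₂-types of (I, J) that matter for f̃_i.  In each factor, l means that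
-- i ∈ I and i + 1 ∉ I, h that i ∉ I and i + 1 ∈ I, and · stands for the others.
data Kind : Set where
  hh lh hl h· ·h trivial : Kind

kind : (i∈I i+1∈I i∈J i+1∈J : Bool) → Kind
kind false true  false true  = hh
kind true  false false true  = lh
kind false true  true  false = hl
kind false true  _     _     = h·
kind true  true  false true  = ·h
kind false false false true  = ·h
kind _     _     _     _     = trivial

infix 9 _↓[_,_]
-- If i + 1 but not i lies in I, this is the subset whose basis vector f_i sends to e_I. Tensors are
-- handled by coordinates, so the value of `f i u` at I is read off from u here.
_↓[_,_] : ∀ {n} → Subset n → Fin n → Fin n → Subset n
I ↓[ lo , hi ] = I [ lo ]≔ true [ hi ]≔ false

size-↓ : ∀ {n} {lo hi : Fin n} → Adjacent lo hi → ∀ I → not (lookup I lo) ∧ lookup I hi ≡ true →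
         ∣ I ↓[ lo , hi ] ∣ ≡ ∣ I ∣
size-↓ base       (false ∷ true ∷ I) e = ≡.refl
size-↓ (step adj) (true ∷ I)         e = ≡.cong suc (size-↓ adj I e)
size-↓ (step adj) (false ∷ I)        e = size-↓ adj I e

∣initial∣ : ∀ {n k} → k ℕ.≤ n → ∣ initial n k ∣ ≡ k
∣initial∣ {zero}  {zero}  _           = ≡.refl
∣initial∣ {suc n} {zero}  _           = ∣initial∣ {n} ℕ.z≤n
∣initial∣ {suc n} {suc k} (ℕ.s≤s k≤n) = ≡.cong suc (∣initial∣ k≤n)

distance-self : ∀ {n} (I : Subset n) → distance I I ≡ 0
distance-self []          = ≡.refl
distance-self (true ∷ I)  = distance-self I
distance-self (false ∷ I) = distance-self I

infix 9 _↑[_,_]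
_↑[_,_] : ∀ {n} → Subset n → Fin n → Fin n → Subset n
I ↑[ lo , hi ] = I [ lo ]≔ false [ hi ]≔ true

↓-lo : ∀ {lo hi : Fin n} → Adjacent lo hi → ∀ I → lookup (I ↓[ lo , hi ]) lo ≡ true
↓-lo base       (_ ∷ _ ∷ I) = ≡.refl
↓-lo (step adj) (_ ∷ I)     = ↓-lo adj I

↓-hi : ∀ {lo hi : Fin n} → Adjacent lo hi → ∀ I → lookup (I ↓[ lo , hi ]) hi ≡ false
↓-hi base       (_ ∷ _ ∷ I) = ≡.refl
↓-hi (step adj) (_ ∷ I)     = ↓-hi adj I

↑-lo : ∀ {lo hi : Fin n} → Adjacent lo hi → ∀ I → lookup (I ↑[ lo , hi ]) lo ≡ false
↑-lo base       (_ ∷ _ ∷ I) = ≡.refl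
↑-lo (step adj) (_ ∷ I)     = ↑-lo adj I

↑-hi : ∀ {lo hi : Fin n} → Adjacent lo hi → ∀ I → lookup (I ↑[ lo , hi ]) hi ≡ true
↑-hi base       (_ ∷ _ ∷ I) = ≡.refl
↑-hi (step adj) (_ ∷ I)     = ↑-hi adj I

↓-↑ : ∀ {lo hi : Fin n} → Adjacent lo hi → ∀ I → lookup I lo ≡ false → lookup I hi ≡ true → I ↓[ lo , hi ] ↑[ lo , hi ] ≡ I
↓-↑ base       (_ ∷ _ ∷ I) ≡.refl ≡.refl = ≡.refl
↓-↑ (step adj) (x ∷ I)     e      e′     = ≡.cong (x ∷_) (↓-↑ adj I e e′)

↑-↓ : ∀ {lo hi : Fin n} → Adjacent lo hi → ∀ I → lookup I lo ≡ true → lookup I hi ≡ false → I ↑[ lo , hi ] ↓[ lo , hi ] ≡ I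
↑-↓ base       (_ ∷ _ ∷ I) ≡.refl ≡.refl = ≡.refl
↑-↓ (step adj) (x ∷ I)     e      e′     = ≡.cong (x ∷_) (↑-↓ adj I e e′)

-- The two instances of the tensor product rule (A, B) ↦ (A′, B′) for f̃_i that
-- suffice to reach every tableau from the highest one.
data CrystalStep {n} (lo hi : Fin n) (A B : Subset n) : Subset n → Subset n → Set where
  raise-left  : lookup A lo ≡ true → lookup A hi ≡ false → lookup B lo ≡ false → lookup B hi ≡ true →
                CrystalStep lo hi A B (A ↑[ lo , hi ]) B
  raise-right : ¬ (lookup A lo ≡ false × lookup A hi ≡ true) → lookup B lo ≡ true → lookup B hi ≡ false →
                CrystalStep lo hi A B A (B ↑[ lo , hi ])

-- The noncrossing matching of a ballot word.

module Matchings where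
  open ≡
  open import Data.Fin using (_<_; _≤_; _<?_; _≤?_)

  -- Index 0 of the stack is its top.
  closerOf  : Word h N → Fin h → Fin N
  partnerOf : Word h N → Fin N → Fin h ⊎ Fin N
  closerOf (none w) j       = suc (closerOf w j)
  closerOf (both w) j       = suc (closerOf w j)
  closerOf (up w)   j       = suc (closerOf w (suc j))
  closerOf (down w) zero    = zero
  closerOf (down w) (suc j) = suc (closerOf w j)

  -- Putting `up` in front of a word turns the opener on top of the stack into position 0 of the
  -- longer word; the openers below it move up by one index.
  pop : Fin (suc h) ⊎ Fin N → Fin h ⊎ Fin (suc N)
  pop (inj₁ zero)    = inj₂ zero
  pop (inj₁ (suc j)) = inj₁ j
  pop (inj₂ i)       = inj₂ (suc i)

  partnerOf (none w) zero    = inj₂ zero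
  partnerOf (none w) (suc i) = Sum.map₂ suc (partnerOf w i)
  partnerOf (both w) zero    = inj₂ zero
  partnerOf (both w) (suc i) = Sum.map₂ suc (partnerOf w i)
  partnerOf (up w)   zero    = inj₂ (suc (closerOf w zero))
  partnerOf (up w)   (suc i) = pop (partnerOf w i)
  partnerOf (down w) zero    = inj₁ zero
  partnerOf (down w) (suc i) = Sum.map suc suc (partnerOf w i)

  partner-closer : (w : Word h N) → ∀ j → partnerOf w (closerOf w j) ≡ inj₁ j
  partner-closer (none w) j       rewrite partner-closer w j       = refl
  partner-closer (both w) j       rewrite partner-closer w j       = refl
  partner-closer (up w)   j       rewrite partner-closer w (suc j) = refl
  partner-closer (down w) zero    = refl
  partner-closer (down w) (suc j) rewrite partner-closer w j       = refl

  closer-partner : (w : Word h N) → ∀ i {j} → partnerOf w i ≡ inj₁ j → closerOf w j ≡ i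
  closer-partner (none w) (suc i) e with partnerOf w i in eq
  closer-partner (none w) (suc i) refl | inj₁ j = cong suc (closer-partner w i eq)
  closer-partner (both w) (suc i) e with partnerOf w i in eq
  closer-partner (both w) (suc i) refl | inj₁ j = cong suc (closer-partner w i eq)
  closer-partner (up w)   (suc i) e with partnerOf w i in eq
  closer-partner (up w)   (suc i) refl | inj₁ (suc j) = cong suc (closer-partner w i eq)
  closer-partner (down w) zero    refl = refl
  closer-partner (down w) (suc i) e with partnerOf w i in eq
  closer-partner (down w) (suc i) refl | inj₁ j = cong suc (closer-partner w i eq)

  partner-involutive : (w : Word h N) → ∀ i {i′} → partnerOf w i ≡ inj₂ i′ → partnerOf w i′ ≡ inj₂ i
  partner-involutive (none w) zero    refl = refl
  partner-involutive (none w) (suc i) e with partnerOf w i in eq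
  partner-involutive (none w) (suc i) refl | inj₂ i′ rewrite partner-involutive w i eq = refl
  partner-involutive (both w) zero    refl = refl
  partner-involutive (both w) (suc i) e with partnerOf w i in eq
  partner-involutive (both w) (suc i) refl | inj₂ i′ rewrite partner-involutive w i eq = refl
  partner-involutive (up w)   zero    refl rewrite partner-closer w zero = refl
  partner-involutive (up w)   (suc i) e with partnerOf w i in eq
  partner-involutive (up w)   (suc i) refl | inj₁ zero = cong (inj₂ ∘ suc) (closer-partner w i eq)
  partner-involutive (up w)   (suc i) refl | inj₂ i′ rewrite partner-involutive w i eq = refl
  partner-involutive (down w) (suc i) e with partnerOf w i in eq
  partner-involutive (down w) (suc i) refl | inj₂ i′ rewrite partner-involutive w i eq = refl

  closer-increasing : (w : Word h N) → ∀ {j j′} → j < j′ → closerOf w j < closerOf w j′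
  closer-increasing (none w) j<j′ = ℕ.s≤s (closer-increasing w j<j′)
  closer-increasing (both w) j<j′ = ℕ.s≤s (closer-increasing w j<j′)
  closer-increasing (up w)   j<j′ = ℕ.s≤s (closer-increasing w (ℕ.s≤s j<j′))
  closer-increasing (down w) {zero}  {suc j′} _             = ℕ.s≤s ℕ.z≤n
  closer-increasing (down w) {suc j} {suc j′} (ℕ.s≤s j<j′) = ℕ.s≤s (closer-increasing w j<j′)

  -- The stack is last in, first out: an opener inside the word lies above all openers from before
  -- it, so none of these is closed until it has been closed itself.
  closer-uncrossed : (w : Word h N) → ∀ a j {a′} → partnerOf w a ≡ inj₂ a′ → ¬ (a < closerOf w j × closerOf w j < a′)
  closer-uncrossed (none w) zero    j refl (_ , ())
  closer-uncrossed (none w) (suc a) j e (a< , <a′) with partnerOf w a in eq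
  closer-uncrossed (none w) (suc a) j refl (ℕ.s≤s a< , ℕ.s≤s <a′) | inj₂ _ = closer-uncrossed w a j eq (a< , <a′)
  closer-uncrossed (both w) zero    j refl (_ , ())
  closer-uncrossed (both w) (suc a) j e (a< , <a′) with partnerOf w a in eq
  closer-uncrossed (both w) (suc a) j refl (ℕ.s≤s a< , ℕ.s≤s <a′) | inj₂ _ = closer-uncrossed w a j eq (a< , <a′)
  closer-uncrossed (up w)   zero    j refl (_ , ℕ.s≤s <a′) = ℕ.<-asym <a′ (closer-increasing w {zero} {suc j} (ℕ.s≤s ℕ.z≤n))
  closer-uncrossed (up w)   (suc a) j e (a< , <a′) with partnerOf w a in eq
  closer-uncrossed (up w)   (suc a) j refl (_ , ()) | inj₁ zero
  closer-uncrossed (up w)   (suc a) j refl (ℕ.s≤s a< , ℕ.s≤s <a′) | inj₂ _ = closer-uncrossed w a (suc j) eq (a< , <a′)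
  closer-uncrossed (down w) (suc a) (suc j) e (a< , <a′) with partnerOf w a in eq
  closer-uncrossed (down w) (suc a) (suc j) refl (ℕ.s≤s a< , ℕ.s≤s <a′) | inj₂ _ = closer-uncrossed w a j eq (a< , <a′)

  -- Only the arc that starts at a leading `up` is new. An arc crossing it would contain the closer
  -- of the top of the stack strictly inside, which `closer-uncrossed` excludes.
  partner-noncrossing : (w : Word h N) → ∀ a b {a′ b′} → partnerOf w a ≡ inj₂ a′ → partnerOf w b ≡ inj₂ b′ →
    ¬ (a < b × b < a′ × a′ < b′)
  partner-noncrossing (none w) zero    b       refl e′ (_ , () , _)
  partner-noncrossing (none w) (suc a) (suc b) e e′ (p , p′ , p″) with partnerOf w a in eq | partnerOf w b in eq′
  partner-noncrossing (none w) (suc a) (suc b) refl refl (ℕ.s≤s p , ℕ.s≤s p′ , ℕ.s≤s p″) | inj₂ _ | inj₂ _ =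
    partner-noncrossing w a b eq eq′ (p , p′ , p″)
  partner-noncrossing (both w) zero    b       refl e′ (_ , () , _)
  partner-noncrossing (both w) (suc a) (suc b) e e′ (p , p′ , p″) with partnerOf w a in eq | partnerOf w b in eq′
  partner-noncrossing (both w) (suc a) (suc b) refl refl (ℕ.s≤s p , ℕ.s≤s p′ , ℕ.s≤s p″) | inj₂ _ | inj₂ _ =
    partner-noncrossing w a b eq eq′ (p , p′ , p″)
  partner-noncrossing (up w) zero (suc b) refl e′ (_ , p′ , p″) with partnerOf w b in eq′
  partner-noncrossing (up w) zero (suc b) refl refl (_ , _ , ()) | inj₁ zero
  partner-noncrossing (up w) zero (suc b) refl refl (_ , ℕ.s≤s p′ , ℕ.s≤s p″) | inj₂ _ =
    closer-uncrossed w b zero eq′ (p′ , p″)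
  partner-noncrossing (up w) (suc a) (suc b) e e′ (p , p′ , p″) with partnerOf w a in eq | partnerOf w b in eq′
  partner-noncrossing (up w) (suc a) (suc b) refl e′ (_ , () , _) | inj₁ zero | _
  partner-noncrossing (up w) (suc a) (suc b) refl refl (_ , _ , ()) | inj₂ _ | inj₁ zero
  partner-noncrossing (up w) (suc a) (suc b) refl refl (ℕ.s≤s p , ℕ.s≤s p′ , ℕ.s≤s p″) | inj₂ _ | inj₂ _ =
    partner-noncrossing w a b eq eq′ (p , p′ , p″)
  partner-noncrossing (down w) (suc a) (suc b) e e′ (p , p′ , p″) with partnerOf w a in eq | partnerOf w b in eq′
  partner-noncrossing (down w) (suc a) (suc b) refl refl (ℕ.s≤s p , ℕ.s≤s p′ , ℕ.s≤s p″) | inj₂ _ | inj₂ _ =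
    partner-noncrossing w a b eq eq′ (p , p′ , p″)

  -- In Bits i a b p, a and b say whether i lies in the left and right column, and p is the partner of i.
  data Bits {h N} (i : Fin N) : Bool → Bool → Fin h ⊎ Fin N → Set where
    fixed   : ∀ {a} → Bits i a a (inj₂ i)
    opener  : ∀ {i′} → i < i′ → Bits i true false (inj₂ i′)
    closer  : ∀ {i′} → i′ < i → Bits i false true (inj₂ i′)
    pending : ∀ {j} → Bits i false true (inj₁ j)

  bits : (w : Word h N) → ∀ i → Bits i (lookup (left w) i) (lookup (right w) i) (partnerOf w i)
  bits (none w) zero    = fixed
  bits (none w) (suc i) with lookup (left w) i | lookup (right w) i | partnerOf w i | bits w i
  ... | _ | _ | _ | fixed      = fixed
  ... | _ | _ | _ | opener i<  = opener (ℕ.s≤s i<)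
  ... | _ | _ | _ | closer <i  = closer (ℕ.s≤s <i)
  ... | _ | _ | _ | pending    = pending
  bits (both w) zero    = fixed
  bits (both w) (suc i) with lookup (left w) i | lookup (right w) i | partnerOf w i | bits w i
  ... | _ | _ | _ | fixed      = fixed
  ... | _ | _ | _ | opener i<  = opener (ℕ.s≤s i<)
  ... | _ | _ | _ | closer <i  = closer (ℕ.s≤s <i)
  ... | _ | _ | _ | pending    = pending
  bits (up w)   zero    = opener (ℕ.s≤s ℕ.z≤n)
  bits (up w)   (suc i) with lookup (left w) i | lookup (right w) i | partnerOf w i | bits w i
  ... | _ | _ | _ | fixed             = fixed
  ... | _ | _ | _ | opener i<         = opener (ℕ.s≤s i<)
  ... | _ | _ | _ | closer <i         = closer (ℕ.s≤s <i)
  ... | _ | _ | _ | pending {zero}    = closer (ℕ.s≤s ℕ.z≤n)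
  ... | _ | _ | _ | pending {suc j}   = pending
  bits (down w) zero    = pending
  bits (down w) (suc i) with lookup (left w) i | lookup (right w) i | partnerOf w i | bits w i
  ... | _ | _ | _ | fixed      = fixed
  ... | _ | _ | _ | opener i<  = opener (ℕ.s≤s i<)
  ... | _ | _ | _ | closer <i  = closer (ℕ.s≤s <i)
  ... | _ | _ | _ | pending    = pending

  -- Compatibility in a form that passes to suffixes: closers of pending openers are constrained
  -- through the stack, and both bits are prescribed at every fixed point, where `Compatible` only
  -- speaks of the intersection.
  record StronglyCompatible (w : Word h N) (st : Vec Bool h) (I J : Subset N) : Set where
    field
      at-fixed   : ∀ i → partnerOf w i ≡ inj₂ i → lookup I i ≡ lookup (left w) i × lookup J i ≡ lookup (left w) i
      at-matched : ∀ i {i′} → partnerOf w i ≡ inj₂ i′ → i ≢ i′ → lookup J i ≡ not (lookup I i) × lookup I i′ ≡ not (lookup I i)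
      at-pending : ∀ i {j} → partnerOf w i ≡ inj₁ j → lookup J i ≡ not (lookup I i) × lookup st j ≡ not (lookup I i)

  private
    module SC = StronglyCompatible

    suc-≢ : ∀ {i i′ : Fin N} → i ≢ i′ → Fin.suc i ≢ suc i′
    suc-≢ ne refl = ne refl

    not-flip : ∀ {a b} → a ≡ not b → b ≡ not a
    not-flip {b = b} refl = sym (Bool.not-involutive b)

    -- `none` and `both` act alike on partners, so they share one argument about a word `w′` that
    -- extends `w` by a letter matched with nothing.
    neutral⁻ : (w : Word h N) (w′ : Word h (suc N)) →
      (∀ i → partnerOf w′ (suc i) ≡ Sum.map₂ suc (partnerOf w i)) → (∀ i → lookup (left w′) (suc i) ≡ lookup (left w) i) →
      ∀ {st a b I J} → StronglyCompatible w′ st (a ∷ I) (b ∷ J) → StronglyCompatible w st I J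
    neutral⁻ w w′ pe le sc = record
      { at-fixed   = λ i e → let x , y = SC.at-fixed sc (suc i) (trans (pe i) (cong (Sum.map₂ suc) e))
                             in trans x (le i) , trans y (le i)
      ; at-matched = λ i e ne → SC.at-matched sc (suc i) (trans (pe i) (cong (Sum.map₂ suc) e)) (suc-≢ ne)
      ; at-pending = λ i e → SC.at-pending sc (suc i) (trans (pe i) (cong (Sum.map₂ suc) e))
      }

    neutral⁺ : (w : Word h N) (w′ : Word h (suc N)) → partnerOf w′ zero ≡ inj₂ zero →
      (∀ i → partnerOf w′ (suc i) ≡ Sum.map₂ suc (partnerOf w i)) → (∀ i → lookup (left w′) (suc i) ≡ lookup (left w) i) →
      ∀ {st a b I J} → a ≡ lookup (left w′) zero → b ≡ lookup (left w′) zero →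
      StronglyCompatible w st I J → StronglyCompatible w′ st (a ∷ I) (b ∷ J)
    neutral⁺ {h = h} {N} w w′ p0 pe le {st} {a} {b} {I} {J} ae be sc = record
      { at-fixed = at-fixed′ ; at-matched = at-matched′ ; at-pending = at-pending′ }
      where
      at-fixed′ : ∀ i → partnerOf w′ i ≡ inj₂ i → lookup (a ∷ I) i ≡ lookup (left w′) i × lookup (b ∷ J) i ≡ lookup (left w′) i
      at-fixed′ zero    e = ae , be
      at-fixed′ (suc i) e with partnerOf w i in eq | trans (sym (pe i)) e
      ... | inj₁ _ | ()
      ... | inj₂ .i | refl = let x , y = SC.at-fixed sc i eq in trans x (sym (le i)) , trans y (sym (le i))
      at-matched′ : ∀ i {i′} → partnerOf w′ i ≡ inj₂ i′ → i ≢ i′ →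
        lookup (b ∷ J) i ≡ not (lookup (a ∷ I) i) × lookup (a ∷ I) i′ ≡ not (lookup (a ∷ I) i)
      at-matched′ zero    e ne = contradiction (inj₂-injective (trans (sym p0) e)) ne
      at-matched′ (suc i) e ne with partnerOf w i in eq | trans (sym (pe i)) e
      ... | inj₁ _ | ()
      ... | inj₂ i′ | refl = SC.at-matched sc i eq (ne ∘ cong suc)
      at-pending′ : ∀ i {j} → partnerOf w′ i ≡ inj₁ j → lookup (b ∷ J) i ≡ not (lookup (a ∷ I) i) × lookup st j ≡ not (lookup (a ∷ I) i)
      at-pending′ zero    e with () ← trans (sym p0) e
      at-pending′ (suc i) e with partnerOf w i in eq | trans (sym (pe i)) e
      ... | inj₂ _ | ()
      ... | inj₁ j | refl = SC.at-pending sc i eq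

    up⁻ : (w : Word (suc h) N) → ∀ {st a b I J} → StronglyCompatible (up w) st (a ∷ I) (b ∷ J) → StronglyCompatible w (a ∷ st) I J
    up⁻ w {st} {a} {b} {I} {J} sc = record
      { at-fixed   = λ i e → SC.at-fixed sc (suc i) (cong pop e)
      ; at-matched = λ i e ne → SC.at-matched sc (suc i) (cong pop e) (suc-≢ ne)
      -- A closer of the top of the stack is, in the longer word, matched with position 0.
      ; at-pending = λ { i {zero} e → SC.at-matched sc (suc i) (cong pop e) (λ ()) ; i {suc j} e → SC.at-pending sc (suc i) (cong pop e) }
      }

    up⁺ : (w : Word (suc h) N) → ∀ {st a b I J} → b ≡ not a → StronglyCompatible w (a ∷ st) I J →
        StronglyCompatible (up w) st (a ∷ I) (b ∷ J)
    up⁺ w {st} {a} {b} {I} {J} b≡ sc = record { at-fixed = at-fixed′ ; at-matched = at-matched′ ; at-pending = at-pending′ }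
      where
      at-fixed′ : ∀ i → partnerOf (up w) i ≡ inj₂ i →
          lookup (a ∷ I) i ≡ lookup (true ∷ left w) i × lookup (b ∷ J) i ≡ lookup (true ∷ left w) i
      at-fixed′ (suc i) e with partnerOf w i in eq
      at-fixed′ (suc i) () | inj₁ zero
      at-fixed′ (suc i) () | inj₁ (suc _)
      at-fixed′ (suc i) refl | inj₂ .i = SC.at-fixed sc i eq
      at-matched′ : ∀ i {i′} → partnerOf (up w) i ≡ inj₂ i′ → i ≢ i′ →
        lookup (b ∷ J) i ≡ not (lookup (a ∷ I) i) × lookup (a ∷ I) i′ ≡ not (lookup (a ∷ I) i)
      at-matched′ zero    refl ne = b≡ , not-flip (proj₂ (SC.at-pending sc (closerOf w zero) (partner-closer w zero)))
      at-matched′ (suc i) e ne with partnerOf w i in eq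
      at-matched′ (suc i) refl ne | inj₁ zero = SC.at-pending sc i eq
      at-matched′ (suc i) refl ne | inj₂ i′   = SC.at-matched sc i eq (ne ∘ cong suc)
      at-pending′ : ∀ i {j} → partnerOf (up w) i ≡ inj₁ j → lookup (b ∷ J) i ≡ not (lookup (a ∷ I) i) × lookup st j ≡ not (lookup (a ∷ I) i)
      at-pending′ (suc i) e with partnerOf w i in eq
      at-pending′ (suc i) refl | inj₁ (suc j) = SC.at-pending sc i eq

    down⁻ : (w : Word h N) → ∀ {s st a b I J} → StronglyCompatible (down w) (s ∷ st) (a ∷ I) (b ∷ J) → StronglyCompatible w st I J
    down⁻ w sc = record
      { at-fixed   = λ i e → SC.at-fixed sc (suc i) (cong (Sum.map suc suc) e)
      ; at-matched = λ i e ne → SC.at-matched sc (suc i) (cong (Sum.map suc suc) e) (suc-≢ ne)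
      ; at-pending = λ i e → SC.at-pending sc (suc i) (cong (Sum.map suc suc) e)
      }

    down⁺ : (w : Word h N) → ∀ {s st a b I J} → b ≡ not a → s ≡ not a → StronglyCompatible w st I J →
      StronglyCompatible (down w) (s ∷ st) (a ∷ I) (b ∷ J)
    down⁺ w {s} {st} {a} {b} {I} {J} b≡ s≡ sc = record { at-fixed = at-fixed′ ; at-matched = at-matched′ ; at-pending = at-pending′ }
      where
      at-fixed′ : ∀ i → partnerOf (down w) i ≡ inj₂ i →
          lookup (a ∷ I) i ≡ lookup (false ∷ left w) i × lookup (b ∷ J) i ≡ lookup (false ∷ left w) i
      at-fixed′ (suc i) e with partnerOf w i in eq
      at-fixed′ (suc i) refl | inj₂ .i = SC.at-fixed sc i eq
      at-matched′ : ∀ i {i′} → partnerOf (down w) i ≡ inj₂ i′ → i ≢ i′ →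
        lookup (b ∷ J) i ≡ not (lookup (a ∷ I) i) × lookup (a ∷ I) i′ ≡ not (lookup (a ∷ I) i)
      at-matched′ (suc i) e ne with partnerOf w i in eq
      at-matched′ (suc i) refl ne | inj₂ i′ = SC.at-matched sc i eq (ne ∘ cong suc)
      at-pending′ : ∀ i {j} → partnerOf (down w) i ≡ inj₁ j →
          lookup (b ∷ J) i ≡ not (lookup (a ∷ I) i) × lookup (s ∷ st) j ≡ not (lookup (a ∷ I) i)
      at-pending′ zero    refl = b≡ , s≡
      at-pending′ (suc i) e with partnerOf w i in eq
      at-pending′ (suc i) refl | inj₁ j = SC.at-pending sc i eq

  exponent-compatible : (w : Word h N) → ∀ st I J → StronglyCompatible w st I J → ∃ λ m → exponent w st I J ≡ just m
  exponent-compatible [] [] [] [] sc = 0 , refl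
  exponent-compatible (none w) st (a ∷ I) (b ∷ J) sc with SC.at-fixed sc zero refl
  ... | refl , refl = exponent-compatible w st I J (neutral⁻ w (none w) (λ _ → refl) (λ _ → refl) sc)
  exponent-compatible (both w) st (a ∷ I) (b ∷ J) sc with SC.at-fixed sc zero refl
  ... | refl , refl = exponent-compatible w st I J (neutral⁻ w (both w) (λ _ → refl) (λ _ → refl) sc)
  exponent-compatible (up w) st (a ∷ I) (b ∷ J) sc with SC.at-matched sc zero refl (λ ())
  exponent-compatible (up w) st (true ∷ I)  (b ∷ J) sc | refl , _ = exponent-compatible w _ I J (up⁻ w sc)
  exponent-compatible (up w) st (false ∷ I) (b ∷ J) sc | refl , _ = exponent-compatible w _ I J (up⁻ w sc)
  exponent-compatible (down w) (s ∷ st) (a ∷ I) (b ∷ J) sc with SC.at-pending sc zero refl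
  exponent-compatible (down w) (s ∷ st) (true ∷ I)  (b ∷ J) sc | refl , refl =
    let m , e = exponent-compatible w st I J (down⁻ w sc) in suc m , cong (Maybe.map suc) e
  exponent-compatible (down w) (s ∷ st) (false ∷ I) (b ∷ J) sc | refl , refl = exponent-compatible w st I J (down⁻ w sc)

  compatible-exponent : (w : Word h N) → ∀ st I J {m} → exponent w st I J ≡ just m → StronglyCompatible w st I J
  compatible-exponent [] [] [] [] e = record { at-fixed = λ () ; at-matched = λ () ; at-pending = λ () }
  compatible-exponent (none w) st (false ∷ I) (false ∷ J) e =
    neutral⁺ w (none w) refl (λ _ → refl) (λ _ → refl) refl refl (compatible-exponent w st I J e)
  compatible-exponent (both w) st (true ∷ I) (true ∷ J) e =
    neutral⁺ w (both w) refl (λ _ → refl) (λ _ → refl) refl refl (compatible-exponent w st I J e)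
  compatible-exponent (both w) st (true ∷ I)  (false ∷ J) ()
  compatible-exponent (both w) st (false ∷ I) (_ ∷ J)     ()
  compatible-exponent (up w) st (true ∷ I)  (false ∷ J) e = up⁺ w refl (compatible-exponent w (true ∷ st) I J e)
  compatible-exponent (up w) st (false ∷ I) (true ∷ J)  e = up⁺ w refl (compatible-exponent w (false ∷ st) I J e)
  compatible-exponent (down w) (true ∷ st) (false ∷ I) (true ∷ J) e = down⁺ w refl refl (compatible-exponent w st I J e)
  compatible-exponent (down w) (false ∷ st) (true ∷ I) (false ∷ J) e with exponent w st I J in eq
  ... | just m = down⁺ w refl refl (compatible-exponent w st I J eq)

open Matchings public

-- Injectivity of θ, and the pairing of a word.

module Pairings where
  open ≡
  open import Data.Fin using (_<_; _≤_; _<?_; _≤?_)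
  open Semistandardness using (module Columns; ind; count-split; ∈⇒true; rowwise-≤; card-≤; enumerates; enumerates-cast)

  lookup-ext : ∀ {a} {A : Set a} {xs ys : Vec A n} → (∀ i → lookup xs i ≡ lookup ys i) → xs ≡ ys
  lookup-ext eq = Pointwise-≡⇒≡ (ext eq)

  true≢false : true ≢ false
  true≢false ()

  -- `rowwise-≤` for the identity map bounds each of the two lists by the other.
  enumerates-vec : ∀ {I : Subset n} {xs ys : Vec (Fin n) k} → Enumerates I xs → Enumerates I ys → xs ≡ ys
  enumerates-vec E F = lookup-ext λ r → Fin.≤-antisym
    (rowwise-≤ E F (λ i → i) (λ e → e) (λ i∈ → i∈) (λ _ → ℕ.≤-refl) r)
    (rowwise-≤ F E (λ i → i) (λ e → e) (λ i∈ → i∈) (λ _ → ℕ.≤-refl) r)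

  enumerates-⊆ : ∀ {I J : Subset n} {xs : Vec (Fin n) k} → Enumerates I xs → Enumerates J xs → ∀ {i} → i ∈ I → i ∈ J
  enumerates-⊆ {J = J} E F i∈ = let r , e = Enumerates.complete E i∈ in subst (_∈ J) e (Enumerates.sound F r)

  ∈-ext : ∀ {I J : Subset n} → (∀ {i} → i ∈ I → i ∈ J) → (∀ {i} → i ∈ J → i ∈ I) → I ≡ J
  ∈-ext {I = I} {J} f g = lookup-ext λ i → pointwise i
    where
    pointwise : ∀ i → lookup I i ≡ lookup J i
    pointwise i with lookup I i in eqI | lookup J i in eqJ
    ... | true  | true  = refl
    ... | false | false = refl
    ... | true  | false = contradiction (trans (sym (∈⇒true (f (Vec.lookup⇒[]= i I eqI)))) eqJ) true≢false
    ... | false | true  = contradiction (trans (sym (∈⇒true (g (Vec.lookup⇒[]= i J eqJ)))) eqI) true≢false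

  enumerates-set : ∀ {I J : Subset n} {xs : Vec (Fin n) k} → Enumerates I xs → Enumerates J xs → I ≡ J
  enumerates-set E F = ∈-ext (enumerates-⊆ E F) (enumerates-⊆ F E)

  enumerates-size : ∀ {I : Subset n} {xs : Vec (Fin n) k} → Enumerates I xs → ∣ I ∣ ≡ k
  enumerates-size {I = I} E = ℕ.≤-antisym
    (card-≤ E (enumerates I) (λ i → i) (λ e → e) (λ i∈ → i∈))
    (card-≤ (enumerates I) E (λ i → i) (λ e → e) (λ i∈ → i∈))

  module _ (σ : Fin n → Fin n) (σ-inv : ∀ i → σ (σ i) ≡ i)
           (σ-nc : ∀ a b → ¬ (a < b × b < σ a × σ a < σ b))
           (σ′ : Fin n → Fin n) (σ′-inv : ∀ i → σ′ (σ′ i) ≡ i)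
           (σ′-nc : ∀ a b → ¬ (a < b × b < σ′ a × σ′ a < σ′ b))
           (closers-agree : ∀ i → σ i < i → σ′ i < i) (openers-agree : ∀ i → i < σ i → i < σ′ i)
           (openers-agree′ : ∀ i → i < σ′ i → i < σ i) where

    -- If the partners of the closers before b agree, then σ b ≮ σ′ b, since the
    -- σ-partner of σ′ b would cross the arc ending at b.
    not-nested : ∀ b → (∀ {c} → c < b → σ c < c → σ c ≡ σ′ c) → σ b < b → ¬ (σ b < σ′ b)
    not-nested b agree σb<b σb<a′ with Fin.<-cmp (σ (σ′ b)) b
    ... | tri≈ _ e _ = Fin.<-irrefl (trans (cong σ (sym e)) (σ-inv _)) σb<a′
    ... | tri> _ _ b<σa′ = σ-nc (σ b) (σ′ b)
            (σb<a′ , subst (σ′ b <_) (sym (σ-inv b)) (closers-agree b σb<b) , subst (_< σ (σ′ b)) (sym (σ-inv b)) b<σa′)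
    ... | tri< d<b _ _ = Fin.<-irrefl (trans (sym (σ′-inv d)) (trans (cong σ′ σ′d≡a′) (σ′-inv b))) d<b
      where
      d = σ (σ′ b)
      σd≡a′ : σ d ≡ σ′ b
      σd≡a′ = σ-inv (σ′ b)
      a′<d : σ′ b < d
      a′<d = openers-agree′ (σ′ b) (subst (σ′ b <_) (sym (σ′-inv b)) (closers-agree b σb<b))
      σ′d≡a′ : σ′ d ≡ σ′ b
      σ′d≡a′ = trans (sym (agree d<b (subst (_< d) (sym σd≡a′) a′<d))) σd≡a′

  module _ (σ : Fin n → Fin n) (σ-inv : ∀ i → σ (σ i) ≡ i)
           (σ-nc : ∀ a b → ¬ (a < b × b < σ a × σ a < σ b))
           (σ′ : Fin n → Fin n) (σ′-inv : ∀ i → σ′ (σ′ i) ≡ i)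
           (σ′-nc : ∀ a b → ¬ (a < b × b < σ′ a × σ′ a < σ′ b))
           (closers→ : ∀ i → σ i < i → σ′ i < i) (closers← : ∀ i → σ′ i < i → σ i < i)
           (openers→ : ∀ i → i < σ i → i < σ′ i) (openers← : ∀ i → i < σ′ i → i < σ i) where

    -- At the first closer where the involutions differ, one of the two partners is the smaller one.
    -- `not-nested` excludes either order, since the hypotheses are symmetric in `σ` and `σ′`.
    closers-equal : ∀ b → Acc _<_ b → σ b < b → σ b ≡ σ′ b
    closers-equal b (acc rec) σb<b with Fin.<-cmp (σ b) (σ′ b)
    ... | tri≈ _ e _ = e
    ... | tri< lt _ _ = ⊥-elim (not-nested σ σ-inv σ-nc σ′ σ′-inv σ′-nc closers→ openers→ openers← b
            (λ c<b → closers-equal _ (rec c<b)) σb<b lt)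
    ... | tri> _ _ gt = ⊥-elim (not-nested σ′ σ′-inv σ′-nc σ σ-inv σ-nc closers← openers← openers→ b
            (λ {c} c<b σ′c<c → sym (closers-equal c (rec c<b) (closers← c σ′c<c))) (closers→ b σb<b) gt)

    noncrossing-unique : ∀ i → σ i ≡ σ′ i
    noncrossing-unique i with Fin.<-cmp (σ i) i
    ... | tri< σi<i _ _ = closers-equal i (Fin.<-wellFounded i) σi<i
    ... | tri> _ _ i<σi = begin
      σ i            ≡⟨ sym (σ′-inv (σ i)) ⟩
      σ′ (σ′ (σ i))  ≡⟨ cong σ′ (sym (closers-equal (σ i) (Fin.<-wellFounded _) (subst (_< σ i) (sym (σ-inv i)) i<σi))) ⟩
      σ′ (σ (σ i))   ≡⟨ cong σ′ (σ-inv i) ⟩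
      σ′ i           ∎
      where open ≡-Reasoning
    ... | tri≈ ¬c e ¬o with Fin.<-cmp (σ′ i) i
    ...   | tri< c _ _ = contradiction (closers← i c) ¬c
    ...   | tri≈ _ e′ _ = trans e (sym e′)
    ...   | tri> _ _ o = contradiction (openers← i o) ¬o

  -- Likewise for the columns of θ(σ, T), t saying whether i lies in T.
  data ColumnBits (i : Fin n) : (t a b : Bool) → Fin n → Set where
    fixed  : ∀ {t} → ColumnBits i t t t i
    opener : ∀ {i′} → i < i′ → ColumnBits i false true false i′
    closer : ∀ {i′} → i′ < i → ColumnBits i false false true i′

  module _ (σ : Vec (Fin n) n) (T : Subset n) (disjoint : ∀ i → i ∈ T → lookup σ i ≡ i) where

    columnBits : ∀ i → ColumnBits i (lookup T i) (lookup (T ∪ openers σ) i) (lookup (T ∪ closers σ) i) (lookup σ i)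
    columnBits i
      rewrite Vec.lookup-zipWith _∨_ i T (openers σ)
            | Vec.lookup-zipWith _∨_ i T (closers σ)
            | Vec.lookup∘tabulate (λ i → does (i <? lookup σ i)) i
            | Vec.lookup∘tabulate (λ i → does (lookup σ i <? i)) i
      with lookup T i in eqT
    ... | true rewrite disjoint i (Vec.lookup⇒[]= i T eqT) = fixed
    ... | false with Fin.<-cmp i (lookup σ i)
    ...   | tri< a ¬b ¬c rewrite dec-true (i <? lookup σ i) a | dec-false (lookup σ i <? i) ¬c = opener a
    ...   | tri≈ ¬a b ¬c rewrite dec-false (i <? lookup σ i) ¬a | dec-false (lookup σ i <? i) ¬c | sym b = fixed
    ...   | tri> ¬a ¬b c rewrite dec-false (i <? lookup σ i) ¬a | dec-true (lookup σ i <? i) c = closer c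

  meet : ∀ {i i′ : Fin n} {t a b} → ColumnBits i t a b i′ → t ≡ a ∧ b
  meet (fixed {true})  = refl
  meet (fixed {false}) = refl
  meet (opener _)      = refl
  meet (closer _)      = refl

  opener-bits : ∀ {i i′ : Fin n} {t a b} → ColumnBits i t a b i′ → i < i′ → a ≡ true × b ≡ false
  opener-bits fixed      i<i  = contradiction i<i (Fin.<-irrefl refl)
  opener-bits (opener _) i<i′ = refl , refl
  opener-bits (closer p) i<i′ = contradiction p (Fin.<-asym i<i′)

  bits-opener : ∀ {i i′ : Fin n} {t a b} → ColumnBits i t a b i′ → a ≡ true → b ≡ false → i < i′
  bits-opener (fixed {true}) _  ()
  bits-opener (fixed {false}) () _
  bits-opener (opener p)      _  _ = p
  bits-opener (closer _)      () _

  closer-bits : ∀ {i i′ : Fin n} {t a b} → ColumnBits i t a b i′ → i′ < i → a ≡ false × b ≡ true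
  closer-bits fixed      i<i  = contradiction i<i (Fin.<-irrefl refl)
  closer-bits (closer _) i′<i = refl , refl
  closer-bits (opener p) i′<i = contradiction p (Fin.<-asym i′<i)

  bits-closer : ∀ {i i′ : Fin n} {t a b} → ColumnBits i t a b i′ → a ≡ false → b ≡ true → i′ < i
  bits-closer (fixed {false}) _  ()
  bits-closer (fixed {true})  () _
  bits-closer (closer p)      _  _ = p
  bits-closer (opener _)      () _

  -- T and the matching determine both columns. This identifies the columns of θ, applied to the
  -- pairing of a word, with `left` and `right` of the word.
  columnBits-functional : ∀ {i i′ : Fin n} {t a b a′ b′} → ColumnBits i t a b i′ → ColumnBits i t a′ b′ i′ → a ≡ a′ × b ≡ b′
  columnBits-functional x@fixed x′ = columnBits-fixed x x′
    where
    columnBits-fixed : ∀ {i : Fin n} {t a b a′ b′} → ColumnBits i t a b i → ColumnBits i t a′ b′ i → a ≡ a′ × b ≡ b′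
    columnBits-fixed fixed      fixed      = refl , refl
    columnBits-fixed (opener p) _          = contradiction p (Fin.<-irrefl refl)
    columnBits-fixed (closer p) _          = contradiction p (Fin.<-irrefl refl)
    columnBits-fixed _          (opener p) = contradiction p (Fin.<-irrefl refl)
    columnBits-fixed _          (closer p) = contradiction p (Fin.<-irrefl refl)
  columnBits-functional (opener p) x′ with opener-bits x′ p
  ... | refl , refl = refl , refl
  columnBits-functional (closer p) x′ with closer-bits x′ p
  ... | refl , refl = refl , refl

  pairing-≡ : ∀ {σ σ′ : Vec (Fin n) n} {T T′} .{p : IsPairing k σ T} .{p′ : IsPairing k σ′ T′} →
    σ ≡ σ′ → T ≡ T′ → pairing σ T p ≡ pairing σ′ T′ p′
  pairing-≡ refl refl = refl

  -- The columns recover T as their intersection and the openers and closers as their differences,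
  -- and a noncrossing matching is determined by its openers and closers.
  θ-injective : ∀ {τ τ′ : Pairing k n} → filling (θ τ) ≡ filling (θ τ′) → τ ≡ τ′
  θ-injective {k} {n} {pairing σ T p} {pairing σ′ T′ p′} eq = pairing-≡ σ≡σ′ T≡T′
    where
    -- The field of `Pairing` is irrelevant; its content is recovered by deciding the property.
    P : IsPairing k σ T
    P = recompute (isPairing? k σ T) p
    P′ : IsPairing k σ′ T′
    P′ = recompute (isPairing? k σ′ T′) p′
    module P  = IsPairing P
    module P′ = IsPairing P′
    A≡A′ : T ∪ openers σ ≡ T′ ∪ openers σ′
    A≡A′ = enumerates-set (enumerates-cast (T ∪ openers σ) (Columns.∣A∣≡k P))
      (subst (Enumerates _) (sym (cong Vec.head eq)) (enumerates-cast (T′ ∪ openers σ′) (Columns.∣A∣≡k P′)))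
    B≡B′ : T ∪ closers σ ≡ T′ ∪ closers σ′
    B≡B′ = enumerates-set (enumerates-cast (T ∪ closers σ) (Columns.∣B∣≡k P))
      (subst (Enumerates _) (sym (cong (Vec.head ∘ Vec.tail) eq)) (enumerates-cast (T′ ∪ closers σ′) (Columns.∣B∣≡k P′)))
    b : ∀ i → ColumnBits i (lookup T i) (lookup (T ∪ openers σ) i) (lookup (T ∪ closers σ) i) (lookup σ i)
    b = columnBits σ T P.disjoint
    b′ : ∀ i → ColumnBits i (lookup T′ i) (lookup (T ∪ openers σ) i) (lookup (T ∪ closers σ) i) (lookup σ′ i)
    b′ i = subst₂ (λ A B → ColumnBits i (lookup T′ i) (lookup A i) (lookup B i) (lookup σ′ i)) (sym A≡A′) (sym B≡B′)
      (columnBits σ′ T′ P′.disjoint i)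
    T≡T′ : T ≡ T′
    T≡T′ = lookup-ext λ i → trans (meet (b i)) (sym (meet (b′ i)))
    σ≡σ′ : σ ≡ σ′
    σ≡σ′ = lookup-ext (noncrossing-unique (lookup σ) P.involutive P.noncrossing (lookup σ′) P′.involutive P′.noncrossing
      (λ i lt → uncurry (bits-closer (b′ i)) (closer-bits (b i) lt))
      (λ i lt → uncurry (bits-closer (b i)) (closer-bits (b′ i) lt))
      (λ i lt → uncurry (bits-opener (b′ i)) (opener-bits (b i) lt))
      (λ i lt → uncurry (bits-opener (b i)) (opener-bits (b′ i) lt)))

  module WordPairing (w : Word 0 n) where

    mate : Fin n → Fin n
    mate i = Sum.fromInj₂ (λ ()) (partnerOf w i)

    partner≡mate : ∀ i → partnerOf w i ≡ inj₂ (mate i)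
    partner≡mate i with partnerOf w i
    ... | inj₂ _ = refl

    σ : Vec (Fin n) n
    σ = tabulate mate

    lookup-σ : ∀ i → lookup σ i ≡ mate i
    lookup-σ = Vec.lookup∘tabulate mate

    T : Subset n
    T = left w ∩ right w

    lookup-T : ∀ i → lookup T i ≡ lookup (left w) i ∧ lookup (right w) i
    lookup-T i = Vec.lookup-zipWith _∧_ i (left w) (right w)

    wordBits : ∀ i → ColumnBits i (lookup T i) (lookup (left w) i) (lookup (right w) i) (lookup σ i)
    wordBits i rewrite lookup-σ i | lookup-T i
      with lookup (left w) i | lookup (right w) i | partnerOf w i | bits w i
    ... | true  | true  | _ | fixed    = fixed
    ... | false | false | _ | fixed    = fixed
    ... | _     | _     | _ | opener p = opener p
    ... | _     | _     | _ | closer p = closer p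

    disjoint : ∀ i → i ∈ T → lookup σ i ≡ i
    disjoint i i∈T with lookup T i | ∈⇒true i∈T | lookup (left w) i | lookup (right w) i | lookup σ i | wordBits i
    ... | true | refl | _ | _ | _ | fixed = refl

    left≡ : T ∪ openers σ ≡ left w
    left≡ = lookup-ext λ i → proj₁ (columnBits-functional (columnBits σ T disjoint i) (wordBits i))

    right≡ : T ∪ closers σ ≡ right w
    right≡ = lookup-ext λ i → proj₂ (columnBits-functional (columnBits σ T disjoint i) (wordBits i))

    involutive : ∀ i → lookup σ (lookup σ i) ≡ i
    involutive i = begin
      lookup σ (lookup σ i) ≡⟨ cong (lookup σ) (lookup-σ i) ⟩
      lookup σ (mate i)     ≡⟨ lookup-σ (mate i) ⟩
      mate (mate i)         ≡⟨ inj₂-injective (trans (sym (partner≡mate (mate i))) (partner-involutive w i (partner≡mate i))) ⟩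
      i                     ∎
      where open ≡-Reasoning

    noncrossing : ∀ a b → ¬ (a < b × b < lookup σ a × lookup σ a < lookup σ b)
    noncrossing a b rewrite lookup-σ a | lookup-σ b = partner-noncrossing w a b (partner≡mate a) (partner≡mate b)

    ind-bits : ∀ {i i′ : Fin n} {t a b} → ColumnBits i t a b i′ → ind a ℕ.+ ind b ≡ 2 ℕ.* ind t ℕ.+ ind (not (does (i′ Fin.≟ i)))
    ind-bits {i} (fixed {true})  rewrite dec-true (i Fin.≟ i) refl = refl
    ind-bits {i} (fixed {false}) rewrite dec-true (i Fin.≟ i) refl = refl
    ind-bits {i} (opener {i′} p) rewrite dec-false (i′ Fin.≟ i) (λ e → Fin.<-irrefl (sym e) p) = refl
    ind-bits {i} (closer {i′} p) rewrite dec-false (i′ Fin.≟ i) (λ e → Fin.<-irrefl e p) = refl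

    column-count : ∀ i → ind (lookup (left w) i) ℕ.+ ind (lookup (right w) i) ≡ 2 ℕ.* ind (lookup T i) ℕ.+ ind (lookup (matched σ) i)
    column-count i rewrite Vec.lookup∘tabulate (λ i → not (does (lookup σ i Fin.≟ i))) i = ind-bits (wordBits i)

    size : ∣ left w ∣ ℕ.+ ∣ right w ∣ ≡ 2 ℕ.* ∣ T ∣ ℕ.+ ∣ matched σ ∣
    size = count-split (left w) (right w) T (matched σ) column-count

    module _ (left-size : ∣ left w ∣ ≡ k) (right-size : ∣ right w ∣ ≡ k) where

      size-k : 2 ℕ.* ∣ T ∣ ℕ.+ ∣ matched σ ∣ ≡ 2 ℕ.* k
      size-k = trans (sym size) (trans (cong₂ ℕ._+_ left-size right-size) (cong (k ℕ.+_) (sym (ℕ.+-identityʳ k))))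

      isPairing : IsPairing k σ T
      isPairing = record { involutive = involutive ; noncrossing = noncrossing ; disjoint = disjoint ; size = size-k }

      wordPairing : Pairing k n
      wordPairing = pairing σ T isPairing

      θ-wordPairing : ∀ {xs ys} → Enumerates (left w) xs → Enumerates (right w) ys → filling (θ wordPairing) ≡ xs ∷ ys ∷ []
      θ-wordPairing E F = cong₂ (λ u v → u ∷ v ∷ [])
        (enumerates-vec (enumerates-cast (T ∪ openers σ) (Columns.∣A∣≡k isPairing)) (subst (λ A → Enumerates A _) (sym left≡) E))
        (enumerates-vec (enumerates-cast (T ∪ closers σ) (Columns.∣B∣≡k isPairing)) (subst (λ B → Enumerates B _) (sym right≡) F))

      stronglyCompatible⇒compatible : ∀ {I J} → StronglyCompatible w [] I J → Compatible I J wordPairing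
      stronglyCompatible⇒compatible {I} {J} sc = lookup-ext meets , split
        where
        module SC = StronglyCompatible sc
        at-matched : ∀ i → i ≢ lookup σ i → lookup J i ≡ not (lookup I i) × lookup I (lookup σ i) ≡ not (lookup I i)
        at-matched i ne = SC.at-matched i (trans (partner≡mate i) (cong inj₂ (sym (lookup-σ i)))) ne
        meets : ∀ i → lookup (I ∩ J) i ≡ lookup T i
        meets i rewrite Vec.lookup-zipWith _∧_ i I J with lookup T i | lookup (left w) i in eqL | lookup (right w) i | lookup σ i in eqσ | wordBits i
        ... | _ | _ | _ | _ | fixed with SC.at-fixed i (trans (partner≡mate i) (cong inj₂ (trans (sym (lookup-σ i)) eqσ)))
        ...   | eI , eJ rewrite eI | eJ | eqL = Bool.∧-idem _
        meets i | _ | _ | _ | _ | opener p =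
          trans (cong (lookup I i ∧_) (proj₁ (at-matched i λ e → Fin.<-irrefl (trans e eqσ) p))) (Bool.∧-inverseʳ (lookup I i))
        meets i | _ | _ | _ | _ | closer p =
          trans (cong (lookup I i ∧_) (proj₁ (at-matched i λ e → Fin.<-irrefl (sym (trans e eqσ)) p))) (Bool.∧-inverseʳ (lookup I i))
        split : ∀ a → lookup σ a ≢ a → (a ∈ I × lookup σ a ∈ J) ⊎ (a ∈ J × lookup σ a ∈ I)
        split a ne with lookup I a in eqI | at-matched a (ne ∘ sym) | at-matched (lookup σ a) (λ e → ne (trans e (involutive a)))
        ... | true  | _ , e₂ | e₃ , _ = inj₁ (Vec.lookup⇒[]= a I eqI , Vec.lookup⇒[]= (lookup σ a) J (trans e₃ (cong not e₂)))
        ... | false | e₁ , e₂ | _ = inj₂ (Vec.lookup⇒[]= a J e₁ , Vec.lookup⇒[]= (lookup σ a) I e₂)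

      -- What has to be shown is that an unmatched point outside T lies in neither I nor J. This is
      -- a count: as |I| + |J| = 2k, the symmetric difference X of I and J has as many elements as
      -- the matched set, which it contains.
      compatible⇒stronglyCompatible : ∀ {I J} → ∣ I ∣ ≡ k → ∣ J ∣ ≡ k → Compatible I J wordPairing → StronglyCompatible w [] I J
      compatible⇒stronglyCompatible {I} {J} ∣I∣≡k ∣J∣≡k (I∩J≡T , split) = record
        { at-fixed   = at-fixed
        ; at-matched = λ i {i′} e ne → at-matched i i′ (trans (lookup-σ i) (inj₂-injective (trans (sym (partner≡mate i)) e))) ne
        ; at-pending = λ i {j} _ → ⊥-elim (no-index j)
        }
        where
        no-index : ¬ Fin 0
        no-index ()
        meets : ∀ i → lookup I i ∧ lookup J i ≡ lookup T i
        meets i = trans (sym (Vec.lookup-zipWith _∧_ i I J)) (cong (λ A → lookup A i) I∩J≡T)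
        unmatched : ∀ i → lookup σ i ≢ i → lookup T i ≡ false
        unmatched i ne with lookup T i | lookup (left w) i | lookup (right w) i | lookup σ i | wordBits i
        ... | _ | _ | _ | _ | fixed    = contradiction refl ne
        ... | _ | _ | _ | _ | opener _ = refl
        ... | _ | _ | _ | _ | closer _ = refl
        other : ∀ i → lookup σ i ≢ i → ∀ {a} → lookup I i ≡ true → lookup J i ≡ a → a ≡ false
        other i ne e e′ = trans (sym e′) (trans (cong (_∧ lookup J i) (sym e)) (trans (meets i) (unmatched i ne)))
        other′ : ∀ i → lookup σ i ≢ i → ∀ {a} → lookup J i ≡ true → lookup I i ≡ a → a ≡ false
        other′ i ne e e′ = trans (sym e′) (trans (sym (Bool.∧-identityʳ _)) (trans (cong (lookup I i ∧_) (sym e))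
            (trans (meets i) (unmatched i ne))))
        at-matched : ∀ i i′ → lookup σ i ≡ i′ → i ≢ i′ → lookup J i ≡ not (lookup I i) × lookup I i′ ≡ not (lookup I i)
        at-matched i .(lookup σ i) refl ne with split i (ne ∘ sym)
        ... | inj₁ (i∈I , i′∈J) rewrite ∈⇒true i∈I = other i (ne ∘ sym) (∈⇒true i∈I) refl ,
                other′ (lookup σ i) (λ e → ne (trans (sym (involutive i)) e)) (∈⇒true i′∈J) refl
        ... | inj₂ (i∈J , i′∈I) rewrite other′ i (ne ∘ sym) (∈⇒true i∈J) refl = ∈⇒true i∈J , ∈⇒true i′∈I
        X : Subset n
        X = tabulate λ i → lookup I i xor lookup J i
        lookup-X : ∀ i → lookup X i ≡ lookup I i xor lookup J i
        lookup-X = Vec.lookup∘tabulate _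
        ind-xor : ∀ a b → ind a ℕ.+ ind b ≡ 2 ℕ.* ind (a ∧ b) ℕ.+ ind (a xor b)
        ind-xor true  true  = refl
        ind-xor true  false = refl
        ind-xor false true  = refl
        ind-xor false false = refl
        count : ∀ i → ind (lookup I i) ℕ.+ ind (lookup J i) ≡ 2 ℕ.* ind (lookup T i) ℕ.+ ind (lookup X i)
        count i rewrite lookup-X i | sym (meets i) = ind-xor (lookup I i) (lookup J i)
        same-size : ∣ matched σ ∣ ≡ ∣ X ∣
        same-size = ℕ.+-cancelˡ-≡ (2 ℕ.* ∣ T ∣) _ _ (trans size-k (trans (cong (k ℕ.+_) (ℕ.+-identityʳ k))
          (trans (sym (cong₂ ℕ._+_ ∣I∣≡k ∣J∣≡k)) (count-split I J T X count))))
        matched-≢ : ∀ {i} → i ∈ matched σ → lookup σ i ≢ i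
        matched-≢ {i} i∈ with lookup σ i Fin.≟ i | trans (sym (Vec.lookup∘tabulate (λ i → not (does (lookup σ i Fin.≟ i))) i)) (∈⇒true i∈)
        ... | no ne | _ = ne
        matched⊆X : ∀ {i} → i ∈ matched σ → i ∈ X
        matched⊆X {i} i∈ = Vec.lookup⇒[]= i X (trans (lookup-X i) (trans
          (cong (lookup I i xor_) (proj₁ (at-matched i _ refl (matched-≢ i∈ ∘ sym)))) (xor-not (lookup I i))))
          where
          xor-not : ∀ a → a xor not a ≡ true
          xor-not true  = refl
          xor-not false = refl
        unmatched-agree : ∀ i → lookup σ i ≡ i → lookup I i xor lookup J i ≡ false
        unmatched-agree i e with lookup I i xor lookup J i in eq
        ... | false = refl
        ... | true  = contradiction same-size (ℕ.<⇒≢ (p⊂q⇒∣p∣<∣q∣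
                (matched⊆X , i , Vec.lookup⇒[]= i X (trans (lookup-X i) eq) , λ i∈ → matched-≢ i∈ e)))
        at-fixed : ∀ i → partnerOf w i ≡ inj₂ i → lookup I i ≡ lookup (left w) i × lookup J i ≡ lookup (left w) i
        at-fixed i e = agree (lookup I i) (lookup J i) (meets i) (unmatched-agree i σi≡i)
          (subst (ColumnBits i (lookup T i) (lookup (left w) i) (lookup (right w) i)) σi≡i (wordBits i))
          where
          σi≡i : lookup σ i ≡ i
          σi≡i = trans (lookup-σ i) (inj₂-injective (trans (sym (partner≡mate i)) e))
          agree : ∀ a b {t l r} → a ∧ b ≡ t → a xor b ≡ false → ColumnBits i t l r i → a ≡ l × b ≡ l
          agree a     b     e₁ e₂ (opener p) = contradiction p (Fin.<-irrefl refl)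
          agree a     b     e₁ e₂ (closer p) = contradiction p (Fin.<-irrefl refl)
          agree true  true  e₁ e₂ fixed = e₁ , e₁
          agree false false e₁ e₂ fixed = e₁ , e₁
          agree true  false e₁ () fixed
          agree false true  e₁ () fixed

open Pairings public

-- Tableaux: their ballot words and the arrows of their crystal.

module Tableaux where
  open ≡
  open import Data.Fin using (_<_; _≤_; _<?_; _≤?_)
  open Semistandardness using (∈⇒true; ∈-tab⁺; ∈-tab⁻)

  -- The prefix has used h more entries of the left column than of the right one. A row of the
  -- tableau therefore pairs entry r of what remains on the left with entry h + r of what remains on
  -- the right.
  ballotWord : ∀ h (A B : Subset N) → ∣ B ∣ ≡ h ℕ.+ ∣ A ∣ →
    (∀ r s → toℕ s ≡ h ℕ.+ toℕ r → lookup (elements A) r ≤ lookup (elements B) s) →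
    ∃ λ (w : Word h N) → left w ≡ A × right w ≡ B
  ballotWord zero    [] [] size dominated = [] , refl , refl
  ballotWord h (false ∷ A) (false ∷ B) size dominated =
    let w , l , r = ballotWord h A B size λ r s e → ℕ.s≤s⁻¹
          (subst₂ _≤_ (Vec.lookup-map r suc (elements A)) (Vec.lookup-map s suc (elements B)) (dominated r s e))
    in none w , cong (false ∷_) l , cong (false ∷_) r
  ballotWord h (true ∷ A) (true ∷ B) size dominated =
    let w , l , r = ballotWord h A B (ℕ.suc-injective (trans size (ℕ.+-suc h _))) λ r s e → ℕ.s≤s⁻¹
          (subst₂ _≤_ (Vec.lookup-map r suc (elements A)) (Vec.lookup-map s suc (elements B))
            (dominated (suc r) (suc s) (trans (cong suc e) (sym (ℕ.+-suc h _)))))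
    in both w , cong (true ∷_) l , cong (true ∷_) r
  ballotWord h (true ∷ A) (false ∷ B) size dominated =
    let w , l , r = ballotWord (suc h) A B (trans size (ℕ.+-suc h _)) λ r s e → ℕ.s≤s⁻¹
          (subst₂ _≤_ (Vec.lookup-map r suc (elements A)) (Vec.lookup-map s suc (elements B))
            (dominated (suc r) s (trans e (sym (ℕ.+-suc h _)))))
    in up w , cong (true ∷_) l , cong (false ∷_) r
  ballotWord (suc h) (false ∷ A) (true ∷ B) size dominated =
    let w , l , r = ballotWord h A B (ℕ.suc-injective size) λ r s e → ℕ.s≤s⁻¹
          (subst₂ _≤_ (Vec.lookup-map r suc (elements A)) (Vec.lookup-map s suc (elements B))
            (dominated r (suc s) (cong suc e)))
    in down w , cong (false ∷_) l , cong (true ∷_) r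
  -- With no opener pending, a first element that belongs to B alone would make the next row
  -- decrease.
  ballotWord zero (false ∷ A) (true ∷ B) size dominated = contradiction first≤0 λ ()
    where
    first : Fin ∣ A ∣
    first = Fin.cast size zero
    first≤0 : suc (toℕ (lookup (elements A) first)) ℕ.≤ 0
    first≤0 = subst (ℕ._≤ 0) (cong toℕ (Vec.lookup-map first suc (elements A)))
      (dominated first zero (sym (Fin.toℕ-cast size zero)))

  -- Decidability lets `recompute` recover the irrelevant field `semistandard`.
  isSemistandard? : (t : Filling k n) → Dec (IsSemistandard t)
  isSemistandard? t = map′
    (λ (c , r) → record { columns = λ c′ {r} {s} → c c′ r s ; rows = λ r′ {c} {d} → r r′ c d })
    (λ p → (λ c r s → IsSemistandard.columns p c) , (λ r c d → IsSemistandard.rows p r))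
    ((Fin.all? λ c → Fin.all? λ r → Fin.all? λ s → (r <? s) →-dec (entry t (r , c) <? entry t (s , c)))
     ×-dec (Fin.all? λ r → Fin.all? λ c → Fin.all? λ d → (c ≤? d) →-dec (entry t (r , c) ≤? entry t (r , d))))

  Increasing : Vec (Fin n) k → Set
  Increasing xs = ∀ {r s} → r < s → lookup xs r < lookup xs s

  column : Vec (Fin n) k → Subset n
  column xs = tabulate λ i → does (Fin.any? λ r → lookup xs r Fin.≟ i)

  column-enumerates : ∀ {xs : Vec (Fin n) k} → Increasing xs → Enumerates (column xs) xs
  column-enumerates {xs = xs} increasing = record
    { sorted   = increasing
    ; sound    = λ r → ∈-tab⁺ (λ i → Fin.any? λ r → lookup xs r Fin.≟ i) (r , refl)
    ; complete = ∈-tab⁻ (λ i → Fin.any? λ r → lookup xs r Fin.≟ i)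
    }

  columns-word : ∀ {A B : Subset n} {xs ys : Vec (Fin n) k} → Enumerates A xs → Enumerates B ys →
    (∀ r → lookup xs r ≤ lookup ys r) → ∃ λ (w : Word 0 n) → left w ≡ A × right w ≡ B
  columns-word {A = A} {B} {xs} {ys} EA EB xs≤ys = ballotWord 0 A B (trans ∣B∣≡k (sym ∣A∣≡k)) λ r s e →
    subst₂ _≤_ (position EA ∣A∣≡k r (Fin.cast ∣A∣≡k r) refl)
      (position EB ∣B∣≡k s (Fin.cast ∣A∣≡k r) (Fin.toℕ-injective (trans (Fin.toℕ-cast ∣A∣≡k r)
          (trans (sym e) (sym (Fin.toℕ-cast ∣B∣≡k s))))))
      (xs≤ys (Fin.cast ∣A∣≡k r))
    where
    ∣A∣≡k = enumerates-size EA
    ∣B∣≡k = enumerates-size EB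
    position : ∀ {k} {I : Subset n} {zs : Vec (Fin n) k} → Enumerates I zs → (e : ∣ I ∣ ≡ k) → ∀ r r′ → r′ ≡ Fin.cast e r →
      lookup zs r′ ≡ lookup (elements I) r
    position {I = I} {zs} EI refl r r′ refl = begin
      lookup zs (Fin.cast refl r)  ≡⟨ cong (lookup zs) (Fin.cast-is-id refl r) ⟩
      lookup zs r                  ≡⟨ cong (λ v → lookup v r) (enumerates-vec EI (Semistandardness.enumerates I)) ⟩
      lookup (elements I) r        ∎
      where open ≡-Reasoning

  infix 4 _≺_
  -- `x ≺ y` means that x is read before y: lower rows, which have larger indices, come first.
  _≺_ : Cell k → Cell k → Set
  (r , c) ≺ (s , d) = s < r ⊎ (r ≡ s × c < d)

  private
    module _ {a ℓ} {A : Set a} {R : A → A → Set ℓ} where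

      AllPairs-reverse : ∀ {xs} → AllPairs R xs → AllPairs (flip R) (List.reverse xs)
      AllPairs-reverse [] = []
      AllPairs-reverse {x ∷ xs} (px ∷ pxs) = subst (AllPairs (flip R)) (sym (List.unfold-reverse x xs))
        (AllPairs.++⁺ (AllPairs-reverse pxs) ([] ∷ []) (All.map (_∷ []) (All-reverse px)))

      record SplitAt (xs : List A) (x : A) : Set (a ⊔ ℓ) where
        constructor split
        field
          {before after} : List A
          splits      : xs ≡ before ++ x ∷ after
          all-before  : All (λ y → R y x) before
          all-after   : All (R x) after
          ordered     : AllPairs R after

      splitAt : ∀ {xs x} → AllPairs R xs → x ∈ᴸ xs → SplitAt xs x
      splitAt (px ∷ pxs) (here refl) = split refl [] px pxs
      splitAt (px ∷ pxs) (there x∈) with splitAt pxs x∈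
      ... | split refl b a o = split refl (All.lookup px (Any.++⁺ʳ _ (here refl)) ∷ b) a o

  ≺-trans : ∀ {x y z : Cell k} → x ≺ y → y ≺ z → x ≺ z
  ≺-trans (inj₁ p)          (inj₁ p′)          = inj₁ (ℕ.<-trans p′ p)
  ≺-trans (inj₁ p)          (inj₂ (refl , _))  = inj₁ p
  ≺-trans (inj₂ (refl , _)) (inj₁ p′)          = inj₁ p′
  ≺-trans (inj₂ (refl , p)) (inj₂ (refl , p′)) = inj₂ (refl , ℕ.<-trans p p′)

  ≺-irrefl : ∀ {x : Cell k} → ¬ (x ≺ x)
  ≺-irrefl (inj₁ p)       = Fin.<-irrefl refl p
  ≺-irrefl (inj₂ (_ , p)) = Fin.<-irrefl refl p

  later : ∀ {xs : List (Cell k)} {x y} (s : SplitAt {R = _≺_} xs y) → x ∈ᴸ xs → y ≺ x → x ∈ᴸ SplitAt.after s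
  later (split {before} refl b _ _) x∈ y≺x with Any.++⁻ before x∈
  ... | inj₁ x∈before     = contradiction (≺-trans y≺x (All.lookup b x∈before)) ≺-irrefl
  ... | inj₂ (here refl)  = contradiction y≺x ≺-irrefl
  ... | inj₂ (there x∈after) = x∈after

  readingOrder-ordered : ∀ k → AllPairs _≺_ (readingOrder k)
  readingOrder-ordered k = AllPairs.concat⁺
    (All.map⁺ (All.universal (λ r → (inj₂ (refl , ℕ.s≤s ℕ.z≤n) ∷ []) ∷ [] ∷ []) (List.reverse (List.allFin k))))
    (AllPairs.map⁺ (AllPairs.map (λ s<r → (inj₁ s<r ∷ inj₁ s<r ∷ []) ∷ (inj₁ s<r ∷ inj₁ s<r ∷ []) ∷ [])
      (AllPairs-reverse (AllPairs.tabulate⁺-< {f = λ i → i} (λ i<j → i<j)))))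

  ∈-readingOrder : (x : Cell k) → x ∈ᴸ readingOrder k
  ∈-readingOrder {k} (r , c) = ∈-concatMap⁺ (λ r → (r , zero) ∷ (r , suc zero) ∷ []) (Any.map (cell c) (Any.reverse⁺ (∈-allFin r)))
    where
    cell : ∀ c {s} → r ≡ s → (r , c) ∈ᴸ (s , zero) ∷ (s , suc zero) ∷ []
    cell zero       refl = here refl
    cell (suc zero) refl = there (here refl)

  module _ (i : Node n) where
    open Node i

    lo≢hi : lo ≢ hi
    lo≢hi e = ℕ.1+n≢n (trans (sym adjacent) (sym (cong toℕ e)))

    module _ (t : Filling k n) where

      private
        scan : ℕ → Maybe (Cell k) → List (Cell k) → Maybe (Cell k)
        scan = rightmostUnpaired i t

      scan-other : ∀ o l {x} xs → entry t x ≢ hi → entry t x ≢ lo → scan o l (x ∷ xs) ≡ scan o l xs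
      scan-other o l {x} xs ≢hi ≢lo rewrite dec-false (entry t x Fin.≟ hi) ≢hi | dec-false (entry t x Fin.≟ lo) ≢lo = refl

      scan-hi : ∀ o l {x} xs → entry t x ≡ hi → scan o l (x ∷ xs) ≡ scan (suc o) l xs
      scan-hi o l {x} xs ≡hi rewrite dec-true (entry t x Fin.≟ hi) ≡hi = refl

      scan-unpaired : ∀ l {x} xs → entry t x ≡ lo → scan 0 l (x ∷ xs) ≡ scan 0 (just x) xs
      scan-unpaired l {x} xs ≡lo
        rewrite dec-false (entry t x Fin.≟ hi) (λ e → lo≢hi (trans (sym ≡lo) e)) | dec-true (entry t x Fin.≟ lo) ≡lo = refl

      scan-paired : ∀ o l {x} xs → entry t x ≡ lo → scan (suc o) l (x ∷ xs) ≡ scan o l xs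
      scan-paired o l {x} xs ≡lo
        rewrite dec-false (entry t x Fin.≟ hi) (λ e → lo≢hi (trans (sym ≡lo) e)) | dec-true (entry t x Fin.≟ lo) ≡lo = refl

      scan-without-lo : ∀ o l {xs} → All (λ x → entry t x ≢ lo) xs → scan o l xs ≡ l
      scan-without-lo o l [] = refl
      scan-without-lo o l {x ∷ xs} (≢lo ∷ p) = by-cases (entry t x Fin.≟ hi)
        where
        by-cases : Dec (entry t x ≡ hi) → scan o l (x ∷ xs) ≡ l
        by-cases (yes ≡hi) = trans (scan-hi o l xs ≡hi) (scan-without-lo (suc o) l p)
        by-cases (no ≢hi)  = trans (scan-other o l xs ≢hi ≢lo) (scan-without-lo o l p)

      -- No "(" precedes x, so x stays unpaired, and as the last ")" it supersedes all earlier ones.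
      scan-last-lo : ∀ l {before x after} → All (λ y → entry t y ≢ hi) before → entry t x ≡ lo →
        All (λ y → entry t y ≢ lo) after → scan 0 l (before ++ x ∷ after) ≡ just x
      scan-last-lo l {after = after} [] ≡lo p = trans (scan-unpaired l after ≡lo) (scan-without-lo 0 _ p)
      scan-last-lo l {y ∷ before} {x} {after} (≢hi ∷ p′) ≡lo p = by-cases (entry t y Fin.≟ lo)
        where
        by-cases : Dec (entry t y ≡ lo) → scan 0 l (y ∷ before ++ x ∷ after) ≡ just x
        by-cases (yes y≡lo) = trans (scan-unpaired l (before ++ x ∷ after) y≡lo) (scan-last-lo (just y) p′ ≡lo p)
        by-cases (no  y≢lo) = trans (scan-other 0 l (before ++ x ∷ after) ≢hi y≢lo) (scan-last-lo l p′ ≡lo p)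

      scan-quiet : ∀ o l {before} after → All (λ y → entry t y ≢ hi × entry t y ≢ lo) before →
        scan o l (before ++ after) ≡ scan o l after
      scan-quiet o l after [] = refl
      scan-quiet o l after ((≢hi , ≢lo) ∷ p) = trans (scan-other o l _ ≢hi ≢lo) (scan-quiet o l after p)

      f̃-tableau-just : ∀ {r c} → scan 0 nothing (readingOrder k) ≡ just (r , c) → f̃-tableau i t ≡ just (t [ c ]%= (_[ r ]≔ hi))
      f̃-tableau-just e rewrite e = refl

      f̃-tableau-last : ∀ r c → entry t (r , c) ≡ lo → (∀ y → y ≺ (r , c) → entry t y ≢ hi) →
        (∀ y → (r , c) ≺ y → entry t y ≢ lo) → f̃-tableau i t ≡ just (t [ c ]%= (_[ r ]≔ hi))
      f̃-tableau-last r c ≡lo before after with splitAt (readingOrder-ordered k) (∈-readingOrder (r , c))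
      ... | split e b a _ = f̃-tableau-just (trans (cong (scan 0 nothing) e)
              (scan-last-lo nothing (All.map (before _) b) ≡lo (All.map (after _) a)))

      -- A pair of cells (y, z) carrying i + 1 and i with nothing in between is bracketed away.
      f̃-tableau-paired : ∀ y z r c → entry t y ≡ hi → entry t z ≡ lo → entry t (r , c) ≡ lo → y ≺ z → z ≺ (r , c) →
        (∀ x → x ≺ y → entry t x ≢ hi × entry t x ≢ lo) → (∀ x → y ≺ x → x ≺ z → entry t x ≢ hi × entry t x ≢ lo) →
        (∀ x → z ≺ x → x ≺ (r , c) → entry t x ≢ hi) → (∀ x → (r , c) ≺ x → entry t x ≢ lo) →
        f̃-tableau i t ≡ just (t [ c ]%= (_[ r ]≔ hi))
      f̃-tableau-paired y z r c y≡hi z≡lo x≡lo y≺z z≺x before-y y-z z-x after-x =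
        from-y (splitAt (readingOrder-ordered k) (∈-readingOrder y))
        where
        x = (r , c)
        from-x : ∀ {zs} → SplitAt {R = _≺_} zs x → All (z ≺_) zs → scan 0 nothing zs ≡ just x
        from-x (split {before} refl b a _) z≺ = scan-last-lo nothing
          (All.zipWith (λ (≺x , z≺) → z-x _ z≺ ≺x) (b , All.++⁻ˡ before z≺)) x≡lo (All.map (after-x _) a)
        from-z : ∀ {ys} → SplitAt {R = _≺_} ys z → All (y ≺_) ys → x ∈ᴸ ys → scan 1 nothing ys ≡ just x
        from-z s@(split {before} {after} refl b a o) y≺ x∈ = trans
          (scan-quiet 1 nothing (z ∷ after) (All.zipWith (λ (≺z , y≺) → y-z _ y≺ ≺z) (b , All.++⁻ˡ before y≺)))
          (trans (scan-paired 0 nothing after z≡lo) (from-x (splitAt o (later s x∈ z≺x)) a))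
        from-y : SplitAt {R = _≺_} (readingOrder k) y → f̃-tableau i t ≡ just (t [ c ]%= (_[ r ]≔ hi))
        from-y s@(split {before} {after} e b a o) = f̃-tableau-just (trans (cong (scan 0 nothing) e) (trans
          (scan-quiet 0 nothing (y ∷ after) (All.map (before-y _) b))
          (trans (scan-hi 0 nothing after y≡hi)
            (from-z (splitAt o (later s (∈-readingOrder z) y≺z)) a (later s (∈-readingOrder x) (≺-trans y≺z z≺x))))))

  sum-decreases : ∀ (xs : Vec (Fin n) k) r {v} → v < lookup xs r →
    Vec.sum (Vec.map toℕ (xs [ r ]≔ v)) ℕ.< Vec.sum (Vec.map toℕ xs)
  sum-decreases (x ∷ xs) zero    v<x = ℕ.+-monoˡ-< (Vec.sum (Vec.map toℕ xs)) v<x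
  sum-decreases (x ∷ xs) (suc r) v<  = ℕ.+-monoʳ-< (toℕ x) (sum-decreases xs r v<)

  size : Filling k n → ℕ
  size (xs ∷ ys ∷ []) = Vec.sum (Vec.map toℕ xs) ℕ.+ Vec.sum (Vec.map toℕ ys)

  update-restore : ∀ (xs : Vec (Fin n) k) {r v} u → lookup xs r ≡ v → (xs [ r ]≔ u) [ r ]≔ v ≡ xs
  update-restore xs {r} u refl = trans (Vec.[]≔-idempotent xs r) (Vec.[]≔-lookup xs r)

  lookup-↓ : ∀ {lo hi v : Fin n} (A : Subset n) → v ≢ lo → v ≢ hi → lookup (A ↓[ lo , hi ]) v ≡ lookup A v
  lookup-↓ {lo = lo} A ≢lo ≢hi = trans (Vec.lookup∘update′ ≢hi (A [ lo ]≔ true) false) (Vec.lookup∘update′ ≢lo A true)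

  -- Undoing f̃_i within one column: as i is absent, replacing i + 1 by i keeps the column
  -- increasing.
  module Predecessor (i : Node n) (xs : Vec (Fin n) k) (increasing : Increasing xs) (s : Fin k) (xs[s]≡hi : lookup xs s ≡ Node.hi i)
                     (lo∉xs : ∀ r → lookup xs r ≢ Node.lo i) where
    open Node i

    lo<hi : lo < hi
    lo<hi = ℕ.≤-reflexive (sym adjacent)

    xs′ : Vec (Fin n) k
    xs′ = xs [ s ]≔ lo

    xs′-s : lookup xs′ s ≡ lo
    xs′-s = Vec.lookup∘update s xs lo

    xs′-other : ∀ {r} → r ≢ s → lookup xs′ r ≡ lookup xs r
    xs′-other r≢s = Vec.lookup∘update′ r≢s xs lo

    <lo : ∀ {r} → r < s → lookup xs r < lo
    <lo {r} r<s = ℕ.≤∧≢⇒< (ℕ.s≤s⁻¹ (subst (toℕ (lookup xs r) ℕ.<_) adjacent (subst (lookup xs r <_) xs[s]≡hi (increasing r<s))))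
      (λ e → lo∉xs r (Fin.toℕ-injective e))

    >hi : ∀ {r} → s < r → hi < lookup xs r
    >hi {r} s<r = subst (_< lookup xs r) xs[s]≡hi (increasing s<r)

    <⇒≢ : ∀ {a} {r r′ : Fin a} → r < r′ → r ≢ r′
    <⇒≢ r<r′ refl = Fin.<-irrefl refl r<r′

    increasing′ : Increasing xs′
    increasing′ {r} {r′} r<r′ with r Fin.≟ s | r′ Fin.≟ s
    ... | yes refl | yes refl = contradiction r<r′ (Fin.<-irrefl refl)
    ... | yes refl | no r′≢s  = subst₂ _<_ (sym xs′-s) (sym (xs′-other r′≢s)) (ℕ.<-trans lo<hi (>hi r<r′))
    ... | no r≢s   | yes refl = subst₂ _<_ (sym (xs′-other r≢s)) (sym xs′-s) (<lo r<r′)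
    ... | no r≢s   | no r′≢s  = subst₂ _<_ (sym (xs′-other r≢s)) (sym (xs′-other r′≢s)) (increasing r<r′)

    xs′≤xs : ∀ r → lookup xs′ r ≤ lookup xs r
    xs′≤xs r with r Fin.≟ s
    ... | yes refl = subst₂ _≤_ (sym xs′-s) (sym xs[s]≡hi) (ℕ.<⇒≤ lo<hi)
    ... | no r≢s   = ℕ.≤-reflexive (cong toℕ (xs′-other r≢s))

    hi∉xs′ : ∀ r → lookup xs′ r ≢ hi
    hi∉xs′ r e with r Fin.≟ s
    ... | yes refl = lo≢hi i (trans (sym xs′-s) e)
    ... | no r≢s with Fin.<-cmp r s
    ...   | tri< r<s _ _ = <⇒≢ (ℕ.<-trans (<lo r<s) lo<hi) (trans (sym (xs′-other r≢s)) e)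
    ...   | tri≈ _ r≡s _ = r≢s r≡s
    ...   | tri> _ _ s<r = <⇒≢ (>hi s<r) (trans (sym e) (xs′-other r≢s))

    xs′-smaller : ∀ {r} → r < s → lookup xs′ r ≢ lo
    xs′-smaller r<s e = <⇒≢ (<lo r<s) (trans (sym (xs′-other (<⇒≢ r<s))) e)

    module _ {A : Subset n} (EA : Enumerates A xs) where

      A-lo : lookup A lo ≡ false
      A-lo with lookup A lo in eq
      ... | false = refl
      ... | true  = let r , e = Enumerates.complete EA (Vec.lookup⇒[]= lo A eq) in contradiction e (lo∉xs r)

      A-hi : lookup A hi ≡ true
      A-hi = ∈⇒true (subst (_∈ A) xs[s]≡hi (Enumerates.sound EA s))

      enumerates↓ : Enumerates (A ↓[ lo , hi ]) xs′
      enumerates↓ = record { sorted = increasing′ ; sound = sound ; complete = complete }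
        where
        sound : ∀ r → lookup xs′ r ∈ A ↓[ lo , hi ]
        sound r with r Fin.≟ s
        ... | yes refl = subst (_∈ A ↓[ lo , hi ]) (sym xs′-s) (Vec.lookup⇒[]= lo _ (↓-lo (adjacent⁺ adjacent) A))
        ... | no r≢s   = Vec.lookup⇒[]= (lookup xs′ r) _ (trans
                (lookup-↓ A (λ e → lo∉xs r (trans (sym (xs′-other r≢s)) e)) (hi∉xs′ r))
                (trans (cong (lookup A) (xs′-other r≢s)) (∈⇒true (Enumerates.sound EA r))))
        complete : ∀ {v} → v ∈ A ↓[ lo , hi ] → ∃ λ r → lookup xs′ r ≡ v
        complete {v} v∈ with v Fin.≟ lo | v Fin.≟ hi
        ... | yes refl | _        = s , xs′-s
        ... | no _     | yes refl = contradiction (trans (sym (∈⇒true v∈)) (↓-hi (adjacent⁺ adjacent) A)) true≢false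
        ... | no v≢lo  | no v≢hi  =
          let r , e = Enumerates.complete EA (Vec.lookup⇒[]= v A (trans (sym (lookup-↓ A v≢lo v≢hi)) (∈⇒true v∈)))
          in r , trans (xs′-other λ { refl → v≢hi (trans (sym e) xs[s]≡hi) }) e

  -- An arrow of the crystal graph together with its effect on the two columns. The sum of the
  -- entries drops when arrows are followed backwards, which makes induction along them
  -- well-founded.
  record Precedes (S′ S : SSYT k n) : Set where
    field
      node        : Node n
      arrow       : f̃-tableau node (filling S′) ≡ just (filling S)
      smaller     : size (filling S′) ℕ.< size (filling S)
      crystalStep : ∀ {A B} → Enumerates A (Vec.head (filling S)) → Enumerates B (Vec.head (Vec.tail (filling S))) →
                ∃₂ λ A′ B′ → Enumerates A′ (Vec.head (filling S′)) × Enumerates B′ (Vec.head (Vec.tail (filling S′)))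
                  × CrystalStep (Node.lo node) (Node.hi node) A′ B′ A B

  node-below : (v : Fin n) → 0 ℕ.< toℕ v → ∃ λ (i : Node n) → Node.hi i ≡ v
  node-below (suc v) _ = record { lo = inject₁ v ; hi = suc v ; adjacent = cong suc (sym (Fin.toℕ-inject₁ v)) } , refl

  increasing-≥ : (xs : Vec (Fin n) k) → Increasing xs → ∀ r → r ≤ lookup xs r
  increasing-≥ xs increasing r = go (toℕ r) r refl
    where
    go : ∀ m r → toℕ r ≡ m → toℕ r ℕ.≤ toℕ (lookup xs r)
    go zero    r e = subst (ℕ._≤ toℕ (lookup xs r)) (sym e) ℕ.z≤n
    go (suc m) r e = subst (ℕ._≤ toℕ (lookup xs r)) (sym e)
      (ℕ.≤-trans (ℕ.s≤s (subst (ℕ._≤ toℕ (lookup xs r′)) r′≡m (go m r′ r′≡m))) (increasing r′<r))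
      where
      m<k = ℕ.<-trans (ℕ.≤-reflexive (sym e)) (Fin.toℕ<n r)
      r′ = fromℕ< m<k
      r′≡m = Fin.toℕ-fromℕ< m<k
      r′<r : r′ < r
      r′<r = ℕ.≤-reflexive (trans (cong suc r′≡m) (sym e))

  module _ (k≤n : k ℕ.≤ n) {xs ys : Vec (Fin n) k} (p : IsSemistandard (xs ∷ ys ∷ [])) where

    private
      S : SSYT k n
      S = ssyt (xs ∷ ys ∷ []) p

      increasing-xs : Increasing xs
      increasing-xs = IsSemistandard.columns p zero

      increasing-ys : Increasing ys
      increasing-ys = IsSemistandard.columns p (suc zero)

      xs≤ys : ∀ r → lookup xs r ≤ lookup ys r
      xs≤ys r = IsSemistandard.rows p r {zero} {suc zero} ℕ.z≤n

      semistandard′ : ∀ {xs ys : Vec (Fin n) k} → Increasing xs → Increasing ys → (∀ r → lookup xs r ≤ lookup ys r) →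
                      IsSemistandard (xs ∷ ys ∷ [])
      semistandard′ {xs} {ys} x y x≤y = record { columns = λ { zero → x ; (suc zero) → y } ; rows = rows }
        where
        rows : ∀ r {c d} → c ≤ d → entry (xs ∷ ys ∷ []) (r , c) ≤ entry (xs ∷ ys ∷ []) (r , d)
        rows r {zero}     {zero}     _ = ℕ.≤-refl
        rows r {zero}     {suc zero} _ = x≤y r
        rows r {suc zero} {suc zero} _ = ℕ.≤-refl

    -- Row r is the first in which the right column departs from the highest tableau. Its entry i +
    -- 1 exceeds r, and i is absent from the right column because each row above carries its own
    -- index there.
    module _ (r : Fin k) (minimal : ∀ s → s < r → toℕ (lookup ys s) ≡ toℕ s)
             (i : Node n) (hi≡ : lookup ys r ≡ Node.hi i) (r<hi : toℕ r ℕ.< toℕ (Node.hi i)) where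
     private
      open Node i

      r≤lo : toℕ r ℕ.≤ toℕ lo
      r≤lo = ℕ.s≤s⁻¹ (subst (toℕ r ℕ.<_) adjacent r<hi)

      <⇒≢ : ∀ {a} {v v′ : Fin a} → v < v′ → v ≢ v′
      <⇒≢ v<v′ refl = Fin.<-irrefl refl v<v′

      lo∉ys : ∀ s → lookup ys s ≢ lo
      lo∉ys s e with Fin.<-cmp s r
      ... | tri< s<r _ _  = <⇒≢ (ℕ.<-≤-trans (subst (ℕ._< toℕ r) (sym (minimal s s<r)) s<r) r≤lo) e
      ... | tri≈ _ refl _ = lo≢hi i (trans (sym e) hi≡)
      ... | tri> _ _ r<s  = Fin.<-asym (subst₂ _<_ hi≡ e (increasing-ys r<s)) (ℕ.≤-reflexive (sym adjacent))

      xs<lo : ∀ {s} → s < r → lookup xs s < lo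
      xs<lo {s} s<r = ℕ.≤-<-trans (xs≤ys s) (ℕ.<-≤-trans (subst (ℕ._< toℕ r) (sym (minimal s s<r)) s<r) r≤lo)

      module Y = Predecessor i ys increasing-ys r hi≡ lo∉ys

      r≤ : ∀ {s} → lo ≤ lookup xs s → r ≤ s
      r≤ lo≤ = ℕ.≮⇒≥ λ s<r → ℕ.<⇒≱ (xs<lo s<r) lo≤

      left-precedes : ∀ s → lookup xs s ≡ hi → (∀ p → lookup xs p ≢ lo) → ∃ λ S′ → Precedes S′ S
      left-precedes s s≡hi lo∉xs = ssyt (X.xs′ ∷ ys ∷ []) (semistandard′ X.increasing′ increasing-ys (λ r → ℕ.≤-trans (X.xs′≤xs r) (xs≤ys r))) , record
        { node        = i
        ; arrow       = trans (f̃-tableau-last i (X.xs′ ∷ ys ∷ []) s zero X.xs′-s before after)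
                          (cong (λ v → just (v ∷ ys ∷ [])) (update-restore xs lo s≡hi))
        ; smaller     = ℕ.+-monoˡ-< _ (sum-decreases xs s (subst (lo <_) (sym s≡hi) Y.lo<hi))
        ; crystalStep = λ {A} {B} EA EB → A ↓[ lo , hi ] , B , X.enumerates↓ EA , EB ,
            subst (λ A′ → CrystalStep lo hi (A ↓[ lo , hi ]) B A′ B) (↓-↑ (adjacent⁺ adjacent) A (X.A-lo EA) (X.A-hi EA))
              (raise-left (↓-lo (adjacent⁺ adjacent) A) (↓-hi (adjacent⁺ adjacent) A) (Y.A-lo EB) (Y.A-hi EB))
        }
        where
        module X = Predecessor i xs increasing-xs s s≡hi lo∉xs
        r≤s : r ≤ s
        r≤s = r≤ (subst (lo ≤_) (sym s≡hi) (ℕ.<⇒≤ X.lo<hi))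
        before : ∀ y → y ≺ (s , zero) → entry (X.xs′ ∷ ys ∷ []) y ≢ hi
        before (j , zero)     _          = X.hi∉xs′ j
        before (j , suc zero) (inj₁ s<j) = <⇒≢ (Y.>hi (ℕ.≤-<-trans r≤s s<j)) ∘ sym
        before (j , suc zero) (inj₂ (_ , ()))
        after : ∀ y → (s , zero) ≺ y → entry (X.xs′ ∷ ys ∷ []) y ≢ lo
        after (j , zero)     (inj₁ j<s) = X.xs′-smaller j<s
        after (j , zero)     (inj₂ (_ , ()))
        after (j , suc zero) _          = lo∉ys j

      module _ (xs[r]≢hi : lookup xs r ≢ hi) where

        t : Filling k n
        t = xs ∷ Y.xs′ ∷ []

        semistandard-t : IsSemistandard t
        semistandard-t = semistandard′ increasing-xs Y.increasing′ rows
          where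
          rows : ∀ s → lookup xs s ≤ lookup Y.xs′ s
          rows s with s Fin.≟ r
          ... | no s≢r   = subst (lookup xs s ≤_) (sym (Y.xs′-other s≢r)) (xs≤ys s)
          -- The left entry of row r is at most i + 1 and different from it, hence at most i.
          ... | yes refl = subst (lookup xs s ≤_) (sym Y.xs′-s) (ℕ.s≤s⁻¹ (subst (toℕ (lookup xs s) ℕ.<_) adjacent
                  (ℕ.≤∧≢⇒< (subst (lookup xs s ≤_) hi≡ (xs≤ys s)) (λ e → xs[r]≢hi (Fin.toℕ-injective e)))))

        right-precedes : f̃-tableau i t ≡ just (t [ suc zero ]%= (_[ r ]≔ hi)) →
          (∀ {A} → Enumerates A xs → ¬ (lookup A lo ≡ false × lookup A hi ≡ true)) → ∃ λ S′ → Precedes S′ S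
        right-precedes f̃t A-type = ssyt t semistandard-t , record
          { node        = i
          ; arrow       = trans f̃t (cong (λ v → just (xs ∷ v ∷ [])) (update-restore ys lo hi≡))
          ; smaller     = ℕ.+-monoʳ-< (Vec.sum (Vec.map toℕ xs)) (sum-decreases ys r (subst (lo <_) (sym hi≡) Y.lo<hi))
          ; crystalStep = λ {A} {B} EA EB → A , B ↓[ lo , hi ] , EA , Y.enumerates↓ EB ,
              subst (CrystalStep lo hi A (B ↓[ lo , hi ]) A) (↓-↑ (adjacent⁺ adjacent) B (Y.A-lo EB) (Y.A-hi EB))
                (raise-right (A-type EA) (↓-lo (adjacent⁺ adjacent) B) (↓-hi (adjacent⁺ adjacent) B))
          }

        after : ∀ y → (r , suc zero) ≺ y → entry t y ≢ lo
        after (j , zero)     (inj₁ j<r) = <⇒≢ (xs<lo j<r)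
        after (j , suc zero) (inj₁ j<r) = Y.xs′-smaller j<r
        after (j , suc zero) (inj₂ (_ , ℕ.s≤s ()))

      precedes-without-hi : (∀ s → lookup xs s ≢ hi) → ∃ λ S′ → Precedes S′ S
      precedes-without-hi hi∉xs = right-precedes (hi∉xs r)
        (f̃-tableau-last i (t (hi∉xs r)) r (suc zero) Y.xs′-s before (after (hi∉xs r)))
        (λ EA (_ , A-hi) → let s , e = Enumerates.complete EA (Vec.lookup⇒[]= hi _ A-hi) in hi∉xs s e)
        where
        before : ∀ y → y ≺ (r , suc zero) → entry (t (hi∉xs r)) y ≢ hi
        before (j , zero)     _ = hi∉xs j
        before (j , suc zero) _ = Y.hi∉xs′ j

      -- The left column has i in row p and i + 1 in row s, with p < s. They are read as "(" and ")"
      -- with neither symbol in between and cancel. The i put into row r ≤ p of the right column is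
      -- read later and remains unpaired.
      precedes-with-lo : ∀ s p → lookup xs s ≡ hi → lookup xs p ≡ lo → ∃ λ S′ → Precedes S′ S
      precedes-with-lo s p s≡hi p≡lo = right-precedes xs[r]≢hi
        (f̃-tableau-paired i (t xs[r]≢hi) (s , zero) (p , zero) r (suc zero) s≡hi p≡lo Y.xs′-s (inj₁ p<s) p≺r
          before-s between (λ y p≺y _ → before-r y p≺y) (after xs[r]≢hi))
        (λ EA (A-lo , _) → true≢false (trans (sym (∈⇒true (subst (_∈ _) p≡lo (Enumerates.sound EA p)))) A-lo))
        where
        r≤p : r ≤ p
        r≤p = r≤ (ℕ.≤-reflexive (cong toℕ (sym p≡lo)))
        injective : ∀ {u v} → lookup xs u ≡ lookup xs v → u ≡ v
        injective {u} {v} e with Fin.<-cmp u v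
        ... | tri< u<v _ _ = contradiction e (<⇒≢ (increasing-xs u<v))
        ... | tri≈ _ u≡v _ = u≡v
        ... | tri> _ _ v<u = contradiction (sym e) (<⇒≢ (increasing-xs v<u))
        p<s : p < s
        p<s with Fin.<-cmp p s
        ... | tri< p<s _ _  = p<s
        ... | tri≈ _ refl _ = contradiction (trans (sym p≡lo) s≡hi) (lo≢hi i)
        ... | tri> _ _ s<p  = contradiction (subst₂ _<_ s≡hi p≡lo (increasing-xs s<p)) (Fin.<-asym Y.lo<hi)
        xs[r]≢hi : lookup xs r ≢ hi
        xs[r]≢hi e = ℕ.<⇒≱ p<s (subst (_≤ p) (injective (trans e (sym s≡hi))) r≤p)
        p≺r : (p , zero) ≺ (r , suc zero)
        p≺r with Fin.<-cmp r p
        ... | tri< r<p _ _  = inj₁ r<p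
        ... | tri≈ _ refl _ = inj₂ (refl , ℕ.s≤s ℕ.z≤n)
        ... | tri> _ _ p<r  = contradiction r≤p (ℕ.<⇒≱ p<r)
        above : ∀ {v} → hi < v → v ≢ hi × v ≢ lo
        above hi<v = <⇒≢ hi<v ∘ sym , <⇒≢ (ℕ.<-trans Y.lo<hi hi<v) ∘ sym
        ys′-above : ∀ {j} → r < j → hi < lookup Y.xs′ j
        ys′-above r<j = subst (hi <_) (sym (Y.xs′-other (<⇒≢ r<j ∘ sym))) (Y.>hi r<j)
        before-s : ∀ y → y ≺ (s , zero) → entry (t xs[r]≢hi) y ≢ hi × entry (t xs[r]≢hi) y ≢ lo
        before-s (j , zero)     (inj₁ s<j) = above (subst (_< lookup xs j) s≡hi (increasing-xs s<j))
        before-s (j , zero)     (inj₂ (_ , ()))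
        before-s (j , suc zero) (inj₁ s<j) = above (ys′-above (ℕ.≤-<-trans r≤p (ℕ.<-trans p<s s<j)))
        before-s (j , suc zero) (inj₂ (_ , ()))
        between : ∀ y → (s , zero) ≺ y → y ≺ (p , zero) → entry (t xs[r]≢hi) y ≢ hi × entry (t xs[r]≢hi) y ≢ lo
        between (j , zero) (inj₁ j<s) (inj₁ p<j) =
          (λ e → <⇒≢ j<s (injective (trans e (sym s≡hi)))) , (λ e → <⇒≢ p<j (injective (trans p≡lo (sym e))))
        between (j , zero) (inj₂ (_ , ())) _
        between (j , zero) (inj₁ _) (inj₂ (_ , ()))
        between (j , suc zero) _ (inj₁ p<j) = above (ys′-above (ℕ.≤-<-trans r≤p p<j))
        between (j , suc zero) _ (inj₂ (_ , ()))
        before-r : ∀ y → (p , zero) ≺ y → entry (t xs[r]≢hi) y ≢ hi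
        before-r (j , zero) (inj₁ j<p) = <⇒≢ (ℕ.<-trans (subst (lookup xs j <_) p≡lo (increasing-xs j<p)) Y.lo<hi)
        before-r (j , zero) (inj₂ (_ , ()))
        before-r (j , suc zero) _ = Y.hi∉xs′ j

     -- If the left column contains i + 1 but not i, its i + 1 is lowered; in all other cases the
     -- entry of the right column is. This choice produces exactly the types of columns required by
     -- `CrystalStep`.
     precedes : ∃ λ S′ → Precedes S′ S
     precedes with Fin.any? (λ s → lookup xs s Fin.≟ hi)
     ... | no ¬hi = precedes-without-hi (λ s e → ¬hi (s , e))
     ... | yes (s , s≡hi) with Fin.any? (λ p → lookup xs p Fin.≟ lo)
     ...   | yes (p , p≡lo) = precedes-with-lo s p s≡hi p≡lo
     ...   | no ¬lo = left-precedes s s≡hi (λ p e → ¬lo (p , e))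

    highest⊎precedes : filling S ≡ highestFilling k≤n ⊎ ∃ λ S′ → Precedes S′ S
    highest⊎precedes with Fin.all? (λ r → toℕ (lookup ys r) ℕ.≟ toℕ r)
    ... | yes ys≡ = inj₁ (cong₂ (λ u v → u ∷ v ∷ []) (lookup-ext λ r → first xs r (xs≡ r)) (lookup-ext λ r → first ys r (ys≡ r)))
      where
      -- Row r of an increasing column is at least r, so the right column of the highest tableau
      -- forces the left one.
      xs≡ : ∀ r → toℕ (lookup xs r) ≡ toℕ r
      xs≡ r = ℕ.≤-antisym (subst (toℕ (lookup xs r) ℕ.≤_) (ys≡ r) (xs≤ys r)) (increasing-≥ xs increasing-xs r)
      first : ∀ (zs : Vec (Fin n) k) r → toℕ (lookup zs r) ≡ toℕ r → lookup zs r ≡ lookup (tabulate (λ r → inject≤ r k≤n)) r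
      first zs r e = trans (Fin.toℕ-injective (trans e (sym (Fin.toℕ-inject≤ r k≤n)))) (sym (Vec.lookup∘tabulate _ r))
    ... | no ¬ys≡ with Fin.¬∀⟶∃¬-smallest k (λ r → toℕ (lookup ys r) ≡ toℕ r) (λ r → toℕ (lookup ys r) ℕ.≟ toℕ r) ¬ys≡
    ...   | r , ys[r]≢r , smaller-agree = inj₂ (precedes r minimal i (sym hi≡) (subst (toℕ r ℕ.<_) (cong toℕ (sym hi≡)) r<ys[r]))
      where
      minimal : ∀ s → s < r → toℕ (lookup ys s) ≡ toℕ s
      minimal s s<r = subst (λ s → toℕ (lookup ys s) ≡ toℕ s)
        (Fin.toℕ-injective (trans (Fin.toℕ-inject (fromℕ< s<r)) (Fin.toℕ-fromℕ< s<r))) (smaller-agree (fromℕ< s<r))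
      r<ys[r] : toℕ r ℕ.< toℕ (lookup ys r)
      r<ys[r] = ℕ.≤∧≢⇒< (increasing-≥ ys increasing-ys r) (ys[r]≢r ∘ sym)
      below = node-below (lookup ys r) (ℕ.≤-<-trans ℕ.z≤n r<ys[r])
      i = proj₁ below
      hi≡ = proj₂ below

open Tableaux public

-- Sets of equal size have differences of equal size, and the distance is the sum of the sizes of
-- the two differences.
distance-even : ∀ {n} (I J : Subset n) → ∣ I ∣ ≡ ∣ J ∣ → ∃ λ m → m ℕ.+ m ≡ distance I J
distance-even I J ∣I∣≡∣J∣ = let x , y , d , e = count I J in
  x , ≡.trans (≡.cong (x ℕ.+_) (ℕ.+-cancelˡ-≡ ∣ I ∣ x y (≡.trans (≡.cong (ℕ._+ x) ∣I∣≡∣J∣) (≡.sym e)))) (≡.sym d)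
  where
  count : ∀ {n} (I J : Subset n) → ∃₂ λ x y → distance I J ≡ x ℕ.+ y × ∣ I ∣ ℕ.+ y ≡ ∣ J ∣ ℕ.+ x
  count []          []          = 0 , 0 , ≡.refl , ≡.refl
  count (true ∷ I)  (true ∷ J)  = let x , y , d , e = count I J in x , y , d , ≡.cong suc e
  count (false ∷ I) (false ∷ J) = count I J
  count (true ∷ I)  (false ∷ J) = let x , y , d , e = count I J in
    suc x , y , ≡.cong suc d , ≡.trans (≡.cong suc e) (≡.sym (ℕ.+-suc ∣ J ∣ x))
  count (false ∷ I) (true ∷ J)  = let x , y , d , e = count I J in
    x , suc y , ≡.trans (≡.cong suc d) (≡.sym (ℕ.+-suc x y)) , ≡.trans (ℕ.+-suc ∣ I ∣ y) (≡.cong suc e)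

word-unique : ∀ {h N} {w w′ : Word h N} → left w ≡ left w′ → right w ≡ right w′ → w ≡ w′
word-unique {w = []}     {[]}      l r = ≡.refl
word-unique {w = none w} {none w′} l r = ≡.cong none (word-unique (≡.cong Vec.tail l) (≡.cong Vec.tail r))
word-unique {w = both w} {both w′} l r = ≡.cong both (word-unique (≡.cong Vec.tail l) (≡.cong Vec.tail r))
word-unique {w = up w}   {up w′}   l r = ≡.cong up (word-unique (≡.cong Vec.tail l) (≡.cong Vec.tail r))
word-unique {w = down w} {down w′} l r = ≡.cong down (word-unique (≡.cong Vec.tail l) (≡.cong Vec.tail r))

initial-enumerates : ∀ {k n} (k≤n : k ℕ.≤ n) → Enumerates (initial n k) (tabulate λ r → inject≤ r k≤n)
initial-enumerates {k} {n} k≤n = record { sorted = sorted ; sound = sound ; complete = complete }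
  where
  xs = tabulate λ r → inject≤ r k≤n
  toℕ-xs : ∀ r → toℕ (lookup xs r) ≡ toℕ r
  toℕ-xs r = ≡.trans (≡.cong toℕ (Vec.lookup∘tabulate (λ r → inject≤ r k≤n) r)) (Fin.toℕ-inject≤ r k≤n)
  sorted : ∀ {r s} → r Fin.< s → lookup xs r Fin.< lookup xs s
  sorted {r} {s} r<s = ≡.subst₂ ℕ._<_ (≡.sym (toℕ-xs r)) (≡.sym (toℕ-xs s)) r<s
  sound : ∀ r → lookup xs r ∈ initial n k
  sound r = Semistandardness.∈-tab⁺ (λ i → toℕ i ℕ.<? k) (≡.subst (ℕ._< k) (≡.sym (toℕ-xs r)) (Fin.toℕ<n r))
  complete : ∀ {i} → i ∈ initial n k → ∃ λ r → lookup xs r ≡ i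
  complete {i} i∈ = fromℕ< i<k , Fin.toℕ-injective (≡.trans (toℕ-xs (fromℕ< i<k)) (Fin.toℕ-fromℕ< i<k))
    where i<k = Semistandardness.∈-tab⁻ (λ i → toℕ i ℕ.<? k) i∈

-- Rational functions of q: regularity at 0 and bar invariance.

module QuantumSide {c ℓ} (F : CommutativeRing c ℓ) (q : CommutativeRing.Carrier F)
                   (isℚ⟨q⟩ : IsRationalFunctionField F q) (k n : ℕ) (k≤n : k ℕ.≤ n) where
  open CommutativeRing F hiding (zero)
  open import Algebra.Definitions.RawMonoid +-rawMonoid using (sum)
  open import Algebra.Properties.Ring ring using (-1*x≈-x; +-cancelˡ)
  open import Algebra.Properties.Semiring.Exp semiring using (_^_; ^-homo-*)
  open import Relation.Binary.Reasoning.Setoid setoid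
  open IsRationalFunctionField isℚ⟨q⟩
  open Quantum F q isℚ⟨q⟩ k n k≤n renaming (e to ê)
  open IntegerCoefficients F
  open RingSolver using (solve; _:=_; _:+_; _:*_; _:-_; :-_; con)
  open Evaluation F
  open Tensors F using (Tensor)
  open Tensors F n using (_≋_; 𝟎; _•_; _⊗_; basis; v₊; incl; add; scale; resp)

  Invertible : Carrier → Set _
  Invertible x = ∃ λ y → x * y ≈ 1#

  cancelˡ : ∀ {x y z} → Invertible x → x * y ≈ x * z → y ≈ z
  cancelˡ {x} {y} {z} (x⁻¹ , xx⁻¹≈1) xy≈xz = begin
    y               ≈⟨ unit y ⟨
    x⁻¹ * (x * y)   ≈⟨ *-congˡ xy≈xz ⟩
    x⁻¹ * (x * z)   ≈⟨ unit z ⟩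
    z               ∎
    where
    unit : ∀ w → x⁻¹ * (x * w) ≈ w
    unit w = trans (sym (*-assoc _ _ _)) (trans (*-congʳ (trans (*-comm _ _) xx⁻¹≈1)) (*-identityˡ w))

  cancel-zero : ∀ {x y} → Invertible x → x * y ≈ 0# → y ≈ 0#
  cancel-zero {x} x-inv xy≈0 = cancelˡ x-inv (trans xy≈0 (sym (zeroʳ x)))

  invertible-* : ∀ {x y} → Invertible x → Invertible y → Invertible (x * y)
  invertible-* {x} {y} (x′ , p) (y′ , r) = x′ * y′ , trans
    (solve 4 (λ x y x′ y′ → x :* y :* (x′ :* y′) := (x :* x′) :* (y :* y′)) refl x y x′ y′)
    (trans (*-cong p r) (*-identityˡ 1#))

  invertible-factor : ∀ {x y z} → x * y ≈ z → Invertible z → Invertible y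
  invertible-factor {x} {y} {z} xy≈z (z′ , p) = x * z′ , trans
    (solve 3 (λ x y z′ → y :* (x :* z′) := x :* y :* z′) refl x y z′) (trans (*-congʳ xy≈z) p)

  invertible-1 : Invertible 1#
  invertible-1 = 1# , *-identityˡ 1#

  invertible-^ : ∀ {x} → Invertible x → ∀ m → Invertible (x ^ m)
  invertible-^ x-inv zero    = invertible-1
  invertible-^ x-inv (suc m) = invertible-* x-inv (invertible-^ x-inv m)

  private
    eval-q : ∀ x → ⟦_⟧ x (0ℤ ∷ 1ℤ ∷ []) ≈ x
    eval-q x = trans (eval-X x 1) (*-identityʳ x)

  q*q⁻¹≈1 : q * q⁻¹ ≈ 1#
  q*q⁻¹≈1 = trans (*-congʳ (sym (eval-q q))) (proj₂ (invert (0ℤ ∷ 1ℤ ∷ []) (there (here λ ()))))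

  q-invertible : Invertible q
  q-invertible = q⁻¹ , q*q⁻¹≈1

  q^-invertible : ∀ m → Invertible (q ^ m)
  q^-invertible = invertible-^ q-invertible

  -- A nonzero polynomial has an inverse in F, so its vanishing would make F trivial.
  isZero : ∀ p → ⟦_⟧ q p ≈ 0# → IsZeroPoly p
  isZero p p≈0 with isZero⊎nonZero p
  ... | inj₁ p≡0 = p≡0
  ... | inj₂ p≢0 = let y , py≈1 = invert p p≢0 in
    ⊥-elim (nontrivial (trans (sym py≈1) (trans (*-congʳ p≈0) (zeroˡ y))))

  nonZero : ∀ {p} → Invertible (⟦_⟧ q p) → NonZeroPoly p
  nonZero {p} (y , py≈1) with isZero⊎nonZero p
  ... | inj₂ p≢0 = p≢0
  ... | inj₁ p≡0 = ⊥-elim (nontrivial (trans (sym py≈1) (trans (*-congʳ (eval-zero q p≡0)) (zeroˡ y))))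

  nonZero-* : ∀ {p r} → NonZeroPoly p → NonZeroPoly r → NonZeroPoly (p *ᵖ r)
  nonZero-* {p} {r} p≢0 r≢0 =
    let y , e = invertible-* (invert p p≢0) (invert r r≢0) in nonZero (y , trans (*-congʳ (eval-* q p r)) e)

  difference-zero : ∀ p r → ⟦_⟧ q p ≈ ⟦_⟧ q r → IsZeroPoly (p +ᵖ -ᵖ r)
  difference-zero p r p≈r = isZero (p +ᵖ -ᵖ r)
    (trans (eval-+ q p (-ᵖ r)) (trans (+-cong p≈r (eval-neg q r)) (-‿inverseʳ _)))

  -- ℤ[q] embeds in F, so an identity at q is one between coefficients and holds at every x. It is
  -- applied with q⁻¹ and with 0.
  substitute : ∀ p r → ⟦_⟧ q p ≈ ⟦_⟧ q r → ∀ x → ⟦_⟧ x p ≈ ⟦_⟧ x r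
  substitute p r p≈r x = eval-equal x p r (difference-zero p r p≈r)

  -- For p of length L, the reversed polynomial takes the value q^(L-1) p(q⁻¹) at q. The additional
  -- factor q on both sides accommodates L = 0.
  eval-reverse : ∀ p → q ^ List.length p * ⟦_⟧ q⁻¹ p ≈ q * ⟦_⟧ q (List.reverse p)
  eval-reverse [] = trans (zeroʳ _) (sym (zeroʳ q))
  eval-reverse (a ∷ p) = begin
    q * q ^ L * (fromℤ F a + q⁻¹ * ⟦_⟧ q⁻¹ p)
      ≈⟨ solve 5 (λ q q′ x a p → q :* x :* (a :+ q′ :* p) := q :* (x :* a) :+ q :* q′ :* (x :* p)) refl q q⁻¹ _ _ _ ⟩
    q * (q ^ L * fromℤ F a) + q * q⁻¹ * (q ^ L * ⟦_⟧ q⁻¹ p)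
      ≈⟨ +-congˡ (trans (*-congʳ q*q⁻¹≈1) (trans (*-identityˡ _) (eval-reverse p))) ⟩
    q * (q ^ L * fromℤ F a) + q * ⟦_⟧ q (List.reverse p)
      ≈⟨ solve 4 (λ q x a p → q :* (x :* a) :+ q :* p := q :* (p :+ x :* (a :+ q :* con 0ℤ))) refl _ _ _ _ ⟩
    q * (⟦_⟧ q (List.reverse p) + q ^ L * ⟦_⟧ q (a ∷ []))
      ≡⟨ ≡.cong (λ m → q * (⟦_⟧ q (List.reverse p) + q ^ m * ⟦_⟧ q (a ∷ []))) (≡.sym (List.length-reverse p)) ⟩
    q * (⟦_⟧ q (List.reverse p) + q ^ List.length (List.reverse p) * ⟦_⟧ q (a ∷ []))
      ≈⟨ *-congˡ (eval-++ q (List.reverse p) (a ∷ [])) ⟨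
    q * ⟦_⟧ q (List.reverse p List.++ a ∷ [])
      ≡⟨ ≡.cong (λ r → q * ⟦_⟧ q r) (≡.sym (List.unfold-reverse a p)) ⟩
    q * ⟦_⟧ q (List.reverse (a ∷ p)) ∎
    where L = List.length p

  eval-q⁻¹-invertible : ∀ {p} → NonZeroPoly p → Invertible (⟦_⟧ q⁻¹ p)
  eval-q⁻¹-invertible {p} p≢0 = invertible-factor (eval-reverse p)
    (invertible-* q-invertible (invert (List.reverse p) (Any.reverse⁺ p≢0)))

  -- Cross-multiplying two presentations of x gives a polynomial identity at q, which is carried
  -- over to q⁻¹. The denominators stay invertible there, because reversal turns them into nonzero
  -- polynomials at q.
  BarScalar-functional : ∀ {x y y′} → BarScalar x y → BarScalar x y′ → y ≈ y′
  BarScalar-functional {x} {y} {y′} (a , b , b≢0 , bx≈a , by≈a) (a′ , b′ , b′≢0 , b′x≈a′ , b′y′≈a′) =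
    cancelˡ (invertible-* (eval-q⁻¹-invertible b≢0) (eval-q⁻¹-invertible b′≢0)) (begin
      ⟦_⟧ q⁻¹ b * ⟦_⟧ q⁻¹ b′ * y     ≈⟨ solve 3 (λ b b′ y → b :* b′ :* y := b′ :* (b :* y)) refl _ _ _ ⟩
      ⟦_⟧ q⁻¹ b′ * (⟦_⟧ q⁻¹ b * y)   ≈⟨ *-congˡ by≈a ⟩
      ⟦_⟧ q⁻¹ b′ * ⟦_⟧ q⁻¹ a         ≈⟨ eval-* q⁻¹ b′ a ⟨
      ⟦_⟧ q⁻¹ (b′ *ᵖ a)              ≈⟨ substitute (b′ *ᵖ a) (b *ᵖ a′) at-q q⁻¹ ⟩
      ⟦_⟧ q⁻¹ (b *ᵖ a′)              ≈⟨ eval-* q⁻¹ b a′ ⟩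
      ⟦_⟧ q⁻¹ b * ⟦_⟧ q⁻¹ a′         ≈⟨ *-congˡ b′y′≈a′ ⟨
      ⟦_⟧ q⁻¹ b * (⟦_⟧ q⁻¹ b′ * y′)  ≈⟨ *-assoc _ _ _ ⟨
      ⟦_⟧ q⁻¹ b * ⟦_⟧ q⁻¹ b′ * y′    ∎)
    where
    at-q : ⟦_⟧ q (b′ *ᵖ a) ≈ ⟦_⟧ q (b *ᵖ a′)
    at-q = begin
      ⟦_⟧ q (b′ *ᵖ a)            ≈⟨ eval-* q b′ a ⟩
      ⟦_⟧ q b′ * ⟦_⟧ q a         ≈⟨ *-congˡ bx≈a ⟨
      ⟦_⟧ q b′ * (⟦_⟧ q b * x)   ≈⟨ solve 3 (λ b b′ y → b′ :* (b :* y) := b :* (b′ :* y)) refl _ _ _ ⟩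
      ⟦_⟧ q b * (⟦_⟧ q b′ * x)   ≈⟨ *-congˡ b′x≈a′ ⟩
      ⟦_⟧ q b * ⟦_⟧ q a′         ≈⟨ eval-* q b a′ ⟨
      ⟦_⟧ q (b *ᵖ a′)            ∎

  BarScalar-cong : ∀ {x x′ y y′} → x ≈ x′ → y ≈ y′ → BarScalar x y → BarScalar x′ y′
  BarScalar-cong x≈x′ y≈y′ (a , b , b≢0 , e , e′) =
    a , b , b≢0 , trans (*-congˡ (sym x≈x′)) e , trans (*-congˡ (sym y≈y′)) e′

  1≢0 : 1ℤ ≢ 0ℤ
  1≢0 ()

  private
    eval-1 : ∀ x → ⟦_⟧ x (1ℤ ∷ []) ≈ 1#
    eval-1 x = eval-X x 0

  BarScalar-poly : ∀ p → BarScalar (⟦_⟧ q p) (⟦_⟧ q⁻¹ p)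
  BarScalar-poly p = p , 1ℤ ∷ [] , here 1≢0 , one q , one q⁻¹
    where
    one : ∀ x → ⟦_⟧ x (1ℤ ∷ []) * ⟦_⟧ x p ≈ ⟦_⟧ x p
    one x = trans (*-congʳ (eval-1 x)) (*-identityˡ _)

  BarScalar-0 : BarScalar 0# 0#
  BarScalar-0 = BarScalar-poly []

  BarScalar-1 : BarScalar 1# 1#
  BarScalar-1 = BarScalar-cong (eval-1 q) (eval-1 q⁻¹) (BarScalar-poly (1ℤ ∷ []))

  BarScalar-q : BarScalar q q⁻¹
  BarScalar-q = BarScalar-cong (eval-q q) (eval-q q⁻¹) (BarScalar-poly (0ℤ ∷ 1ℤ ∷ []))

  BarScalar-sum : ∀ {x y x′ y′} → BarScalar x y → BarScalar x′ y′ → BarScalar (x + x′) (y + y′)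
  BarScalar-sum (a , b , b≢0 , e , ē) (a′ , b′ , b′≢0 , e′ , ē′) =
    a *ᵖ b′ +ᵖ a′ *ᵖ b , b *ᵖ b′ , nonZero-* b≢0 b′≢0 , combine q e e′ , combine q⁻¹ ē ē′
    where
    combine : ∀ t {x x′} → ⟦_⟧ t b * x ≈ ⟦_⟧ t a → ⟦_⟧ t b′ * x′ ≈ ⟦_⟧ t a′ →
              ⟦_⟧ t (b *ᵖ b′) * (x + x′) ≈ ⟦_⟧ t (a *ᵖ b′ +ᵖ a′ *ᵖ b)
    combine t {x} {x′} e e′ = begin
      ⟦_⟧ t (b *ᵖ b′) * (x + x′)                    ≈⟨ *-congʳ (eval-* t b b′) ⟩
      ⟦_⟧ t b * ⟦_⟧ t b′ * (x + x′)                 ≈⟨ solve 4 (λ b b′ x x′ → b :* b′ :* (x :+ x′)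
          := (b :* x) :* b′ :+ (b′ :* x′) :* b) refl _ _ _ _ ⟩
      ⟦_⟧ t b * x * ⟦_⟧ t b′ + ⟦_⟧ t b′ * x′ * ⟦_⟧ t b ≈⟨ +-cong (*-congʳ e) (*-congʳ e′) ⟩
      ⟦_⟧ t a * ⟦_⟧ t b′ + ⟦_⟧ t a′ * ⟦_⟧ t b       ≈⟨ +-cong (eval-* t a b′) (eval-* t a′ b) ⟨
      ⟦_⟧ t (a *ᵖ b′) + ⟦_⟧ t (a′ *ᵖ b)             ≈⟨ eval-+ t (a *ᵖ b′) (a′ *ᵖ b) ⟨
      ⟦_⟧ t (a *ᵖ b′ +ᵖ a′ *ᵖ b)                    ∎

  BarScalar-product : ∀ {x y x′ y′} → BarScalar x y → BarScalar x′ y′ → BarScalar (x * x′) (y * y′)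
  BarScalar-product (a , b , b≢0 , e , ē) (a′ , b′ , b′≢0 , e′ , ē′) =
    a *ᵖ a′ , b *ᵖ b′ , nonZero-* b≢0 b′≢0 , combine q e e′ , combine q⁻¹ ē ē′
    where
    combine : ∀ t {x x′} → ⟦_⟧ t b * x ≈ ⟦_⟧ t a → ⟦_⟧ t b′ * x′ ≈ ⟦_⟧ t a′ →
              ⟦_⟧ t (b *ᵖ b′) * (x * x′) ≈ ⟦_⟧ t (a *ᵖ a′)
    combine t {x} {x′} e e′ = begin
      ⟦_⟧ t (b *ᵖ b′) * (x * x′)        ≈⟨ *-congʳ (eval-* t b b′) ⟩
      ⟦_⟧ t b * ⟦_⟧ t b′ * (x * x′)     ≈⟨ solve 4 (λ b b′ x x′ → b :* b′ :* (x :* x′) := (b :* x) :* (b′ :* x′)) refl _ _ _ _ ⟩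
      ⟦_⟧ t b * x * (⟦_⟧ t b′ * x′)     ≈⟨ *-cong e e′ ⟩
      ⟦_⟧ t a * ⟦_⟧ t a′                ≈⟨ eval-* t a a′ ⟨
      ⟦_⟧ t (a *ᵖ a′)                   ∎

  BarScalar-q⁻¹ : BarScalar q⁻¹ q
  BarScalar-q⁻¹ = 1ℤ ∷ [] , 0ℤ ∷ 1ℤ ∷ [] , there (here 1≢0) ,
    trans (*-congʳ (eval-q q)) (trans q*q⁻¹≈1 (sym (eval-1 q))) ,
    trans (*-congʳ (eval-q q⁻¹)) (trans (*-comm _ _) (trans q*q⁻¹≈1 (sym (eval-1 q⁻¹))))

  Polynomial : Carrier → Set ℓ
  Polynomial x = ∃ λ p → x ≈ ⟦_⟧ q p

  constantTerm : Poly → ℤ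
  constantTerm []      = 0ℤ
  constantTerm (a ∷ _) = a

  constantTerm-* : ∀ p r → constantTerm (p *ᵖ r) ≡ constantTerm p ℤ.* constantTerm r
  constantTerm-* []      r       = ≡.refl
  constantTerm-* (a ∷ p) []      = ≡.sym (ℤ.*-zeroʳ a)
  constantTerm-* (a ∷ p) (b ∷ r) = ℤ.+-identityʳ _

  regular : ∀ {x} p r → constantTerm r ≢ 0ℤ → ⟦_⟧ q r * x ≈ ⟦_⟧ q p → Regular x
  regular p []       r₀≢0 e = ⊥-elim (r₀≢0 ≡.refl)
  regular p (r₀ ∷ r) r₀≢0 e = p , r , r₀ , r₀≢0 , e

  private
    nonZero-factor : ∀ {a b} → a ≢ 0ℤ → a ℤ.* b ≡ 0ℤ → b ≡ 0ℤ
    nonZero-factor {a} a≢0 ab≡0 with ℤ.i*j≡0⇒i≡0∨j≡0 a ab≡0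
    ... | inj₁ a≡0 = ⊥-elim (a≢0 a≡0)
    ... | inj₂ b≡0 = b≡0

    constantTerm-≢0 : ∀ p r → constantTerm p ≢ 0ℤ → constantTerm r ≢ 0ℤ → constantTerm (p *ᵖ r) ≢ 0ℤ
    constantTerm-≢0 p r p₀ r₀ e = r₀ (nonZero-factor p₀ (≡.trans (≡.sym (constantTerm-* p r)) e))

  Regular-resp : ∀ {x y} → x ≈ y → Regular x → Regular y
  Regular-resp x≈y (a , b , b₀ , b₀≢0 , e) = a , b , b₀ , b₀≢0 , trans (*-congˡ (sym x≈y)) e

  polynomial⇒regular : ∀ {x} → Polynomial x → Regular x
  polynomial⇒regular (p , x≈p) = p , [] , 1ℤ , 1≢0 , trans (*-congʳ (eval-1 q)) (trans (*-identityˡ _) x≈p)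

  Regular-+ : ∀ {x y} → Regular x → Regular y → Regular (x + y)
  Regular-+ {x} {y} (a , b , b₀ , b₀≢0 , e) (a′ , b′ , b₀′ , b₀′≢0 , e′) =
    regular (a *ᵖ B′ +ᵖ a′ *ᵖ B) (B *ᵖ B′) (constantTerm-≢0 B B′ b₀≢0 b₀′≢0) (begin
      ⟦_⟧ q (B *ᵖ B′) * (x + y)                     ≈⟨ *-congʳ (eval-* q B B′) ⟩
      ⟦_⟧ q B * ⟦_⟧ q B′ * (x + y)                  ≈⟨ solve 4 (λ b b′ x x′ → b :* b′ :* (x :+ x′)
          := (b :* x) :* b′ :+ (b′ :* x′) :* b) refl _ _ _ _ ⟩
      ⟦_⟧ q B * x * ⟦_⟧ q B′ + ⟦_⟧ q B′ * y * ⟦_⟧ q B ≈⟨ +-cong (*-congʳ e) (*-congʳ e′) ⟩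
      ⟦_⟧ q a * ⟦_⟧ q B′ + ⟦_⟧ q a′ * ⟦_⟧ q B       ≈⟨ +-cong (eval-* q a B′) (eval-* q a′ B) ⟨
      ⟦_⟧ q (a *ᵖ B′) + ⟦_⟧ q (a′ *ᵖ B)             ≈⟨ eval-+ q (a *ᵖ B′) (a′ *ᵖ B) ⟨
      ⟦_⟧ q (a *ᵖ B′ +ᵖ a′ *ᵖ B)                    ∎)
    where
    B = b₀ ∷ b
    B′ = b₀′ ∷ b′

  Regular-* : ∀ {x y} → Regular x → Regular y → Regular (x * y)
  Regular-* {x} {y} (a , b , b₀ , b₀≢0 , e) (a′ , b′ , b₀′ , b₀′≢0 , e′) =
    regular (a *ᵖ a′) (B *ᵖ B′) (constantTerm-≢0 B B′ b₀≢0 b₀′≢0) (begin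
      ⟦_⟧ q (B *ᵖ B′) * (x * y)          ≈⟨ *-congʳ (eval-* q B B′) ⟩
      ⟦_⟧ q B * ⟦_⟧ q B′ * (x * y)       ≈⟨ solve 4 (λ b b′ x x′ → b :* b′ :* (x :* x′) := (b :* x) :* (b′ :* x′)) refl _ _ _ _ ⟩
      ⟦_⟧ q B * x * (⟦_⟧ q B′ * y)       ≈⟨ *-cong e e′ ⟩
      ⟦_⟧ q a * ⟦_⟧ q a′                 ≈⟨ eval-* q a a′ ⟨
      ⟦_⟧ q (a *ᵖ a′)                    ∎)
    where
    B = b₀ ∷ b
    B′ = b₀′ ∷ b′

  Regular-neg : ∀ {x} → Regular x → Regular (- x)
  Regular-neg {x} (a , b , b₀ , b₀≢0 , e) = -ᵖ a , b , b₀ , b₀≢0 , (begin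
    ⟦_⟧ q (b₀ ∷ b) * - x    ≈⟨ solve 2 (λ b x → b :* :- x := :- (b :* x)) refl _ x ⟩
    - (⟦_⟧ q (b₀ ∷ b) * x)  ≈⟨ -‿cong e ⟩
    - ⟦_⟧ q a               ≈⟨ eval-neg q a ⟨
    ⟦_⟧ q (-ᵖ a)            ∎)

  Regular-divide : ∀ {x y} p → constantTerm p ≢ 0ℤ → ⟦_⟧ q p * x ≈ y → Regular y → Regular x
  Regular-divide {x} {y} p p₀≢0 px≈y (a , b , b₀ , b₀≢0 , e) =
    regular a (B *ᵖ p) (constantTerm-≢0 B p b₀≢0 p₀≢0) (begin
      ⟦_⟧ q (B *ᵖ p) * x        ≈⟨ *-congʳ (eval-* q B p) ⟩
      ⟦_⟧ q B * ⟦_⟧ q p * x     ≈⟨ *-assoc _ _ _ ⟩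
      ⟦_⟧ q B * (⟦_⟧ q p * x)   ≈⟨ *-congˡ px≈y ⟩
      ⟦_⟧ q B * y               ≈⟨ e ⟩
      ⟦_⟧ q a                   ∎)
    where B = b₀ ∷ b

  Regular-q : Regular q
  Regular-q = polynomial⇒regular (0ℤ ∷ 1ℤ ∷ [] , sym (eval-q q))

  Polynomial-0 : Polynomial 0#
  Polynomial-0 = [] , refl

  Polynomial-1 : Polynomial 1#
  Polynomial-1 = 1ℤ ∷ [] , sym (eval-1 q)

  Polynomial-q : Polynomial q
  Polynomial-q = 0ℤ ∷ 1ℤ ∷ [] , sym (eval-q q)

  Polynomial-+ : ∀ {x y} → Polynomial x → Polynomial y → Polynomial (x + y)
  Polynomial-+ (p , e) (r , e′) = p +ᵖ r , trans (+-cong e e′) (sym (eval-+ q p r))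

  Polynomial-* : ∀ {x y} → Polynomial x → Polynomial y → Polynomial (x * y)
  Polynomial-* (p , e) (r , e′) = p *ᵖ r , trans (*-cong e e′) (sym (eval-* q p r))

  Polynomial-neg : ∀ {x} → Polynomial x → Polynomial (- x)
  Polynomial-neg (p , e) = -ᵖ p , trans (-‿cong e) (sym (eval-neg q p))

  Laurent-resp : ∀ {x y} → x ≈ y → Laurent x → Laurent y
  Laurent-resp x≈y (a , m , e) = a , m , trans (*-congˡ (sym x≈y)) e

  polynomial⇒laurent : ∀ {x} → Polynomial x → Laurent x
  polynomial⇒laurent (p , e) = p , 0 , trans (*-identityˡ _) e

  Laurent-q⁻¹ : Laurent q⁻¹
  Laurent-q⁻¹ = 1ℤ ∷ [] , 1 , trans (*-congʳ (*-identityʳ q)) (trans q*q⁻¹≈1 (sym (eval-1 q)))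

  Laurent-+ : ∀ {x y} → Laurent x → Laurent y → Laurent (x + y)
  Laurent-+ {x} {y} (a , m , e) (b , l , e′) = a *ᵖ Xᵖ l +ᵖ b *ᵖ Xᵖ m , m ℕ.+ l , (begin
    q ^ (m ℕ.+ l) * (x + y)                 ≈⟨ *-congʳ (^-homo-* q m l) ⟩
    q ^ m * q ^ l * (x + y)                 ≈⟨ solve 4 (λ b b′ x x′ → b :* b′ :* (x :+ x′)
        := (b :* x) :* b′ :+ (b′ :* x′) :* b) refl _ _ _ _ ⟩
    q ^ m * x * q ^ l + q ^ l * y * q ^ m   ≈⟨ +-cong (*-cong e (sym (eval-X q l))) (*-cong e′ (sym (eval-X q m))) ⟩
    ⟦_⟧ q a * ⟦_⟧ q (Xᵖ l) + ⟦_⟧ q b * ⟦_⟧ q (Xᵖ m) ≈⟨ +-cong (eval-* q a (Xᵖ l)) (eval-* q b (Xᵖ m)) ⟨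
    ⟦_⟧ q (a *ᵖ Xᵖ l) + ⟦_⟧ q (b *ᵖ Xᵖ m)   ≈⟨ eval-+ q (a *ᵖ Xᵖ l) _ ⟨
    ⟦_⟧ q (a *ᵖ Xᵖ l +ᵖ b *ᵖ Xᵖ m)          ∎)

  Laurent-* : ∀ {x y} → Laurent x → Laurent y → Laurent (x * y)
  Laurent-* {x} {y} (a , m , e) (b , l , e′) = a *ᵖ b , m ℕ.+ l , (begin
    q ^ (m ℕ.+ l) * (x * y)       ≈⟨ *-congʳ (^-homo-* q m l) ⟩
    q ^ m * q ^ l * (x * y)       ≈⟨ solve 4 (λ b b′ x x′ → b :* b′ :* (x :* x′) := (b :* x) :* (b′ :* x′)) refl _ _ _ _ ⟩
    q ^ m * x * (q ^ l * y)       ≈⟨ *-cong e e′ ⟩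
    ⟦_⟧ q a * ⟦_⟧ q b             ≈⟨ eval-* q a b ⟨
    ⟦_⟧ q (a *ᵖ b)                ∎)

  -- Substituting 0 for q shows that `b₀` times the constant term of p is 0. As `b₀` is not 0, p has
  -- no constant term, and one factor q can be cancelled in each step.
  divide-X : ∀ b₀ b → b₀ ≢ 0ℤ → ∀ j p d → ⟦_⟧ q (b₀ ∷ b) * ⟦_⟧ q p ≈ q ^ j * ⟦_⟧ q d →
             ∃ λ r → ⟦_⟧ q p ≈ q ^ j * ⟦_⟧ q r
  divide-X b₀ b b₀≢0 zero p d e = p , sym (*-identityˡ _)
  divide-X b₀ b b₀≢0 (suc j) [] d e = [] , sym (zeroʳ _)
  divide-X b₀ b b₀≢0 (suc j) (p₀ ∷ p) d e =
    let r , p≈r = divide-X b₀ b b₀≢0 j p d (cancelˡ q-invertible e′) in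
    r , trans p≈q*p (trans (*-congˡ p≈r) (sym (*-assoc _ _ _)))
    where
    B = b₀ ∷ b
    at-q : ⟦_⟧ q (B *ᵖ (p₀ ∷ p)) ≈ ⟦_⟧ q (Xᵖ suc j *ᵖ d)
    at-q = trans (eval-* q B (p₀ ∷ p)) (trans e (trans (*-congʳ (sym (eval-X q (suc j)))) (sym (eval-* q (Xᵖ suc j) d))))
    eval-at-0 : ∀ p → ⟦_⟧ 0# p ≈ fromℤ F (constantTerm p)
    eval-at-0 []      = refl
    eval-at-0 (a ∷ p) = trans (+-congˡ (zeroˡ _)) (+-identityʳ _)
    at-0 : ⟦_⟧ q (b₀ ℤ.* p₀ ∷ []) ≈ 0#
    at-0 = begin
      fromℤ F (b₀ ℤ.* p₀) + q * 0#              ≈⟨ trans (+-congˡ (zeroʳ q)) (+-identityʳ _) ⟩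
      fromℤ F (b₀ ℤ.* p₀)                       ≡⟨ ≡.cong (fromℤ F) (≡.sym (constantTerm-* B (p₀ ∷ p))) ⟩
      fromℤ F (constantTerm (B *ᵖ (p₀ ∷ p)))    ≈⟨ eval-at-0 (B *ᵖ (p₀ ∷ p)) ⟨
      ⟦_⟧ 0# (B *ᵖ (p₀ ∷ p))                    ≈⟨ substitute (B *ᵖ (p₀ ∷ p)) (Xᵖ suc j *ᵖ d) at-q 0# ⟩
      ⟦_⟧ 0# (Xᵖ suc j *ᵖ d)                    ≈⟨ eval-at-0 (Xᵖ suc j *ᵖ d) ⟩
      fromℤ F (constantTerm (Xᵖ suc j *ᵖ d))    ≡⟨ ≡.cong (fromℤ F) (constantTerm-* (Xᵖ suc j) d) ⟩
      0#                                        ∎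
    p₀≡0 : p₀ ≡ 0ℤ
    p₀≡0 = nonZero-factor b₀≢0 (All.head (isZero (b₀ ℤ.* p₀ ∷ []) at-0))
    p≈q*p : ⟦_⟧ q (p₀ ∷ p) ≈ q * ⟦_⟧ q p
    p≈q*p = trans (+-congʳ (reflexive (≡.cong (fromℤ F) p₀≡0))) (+-identityˡ _)
    e′ : q * (⟦_⟧ q B * ⟦_⟧ q p) ≈ q * (q ^ j * ⟦_⟧ q d)
    e′ = begin
      q * (⟦_⟧ q B * ⟦_⟧ q p)       ≈⟨ solve 3 (λ q b p → q :* (b :* p) := b :* (q :* p)) refl _ _ _ ⟩
      ⟦_⟧ q B * (q * ⟦_⟧ q p)       ≈⟨ *-congˡ p≈q*p ⟨
      ⟦_⟧ q B * ⟦_⟧ q (p₀ ∷ p)      ≈⟨ e ⟩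
      q ^ suc j * ⟦_⟧ q d           ≈⟨ *-assoc _ _ _ ⟩
      q * (q ^ j * ⟦_⟧ q d)         ∎

  -- With x = a / q^m, regularity at 0 forces q^m to divide a, by `divide-X`.
  laurent∧regular⇒polynomial : ∀ {x} → Laurent x → Regular x → Polynomial x
  laurent∧regular⇒polynomial {x} (a , m , q^mx≈a) (d , b , b₀ , b₀≢0 , bx≈d) =
    let r , a≈q^mr = divide-X b₀ b b₀≢0 m a d (begin
          ⟦_⟧ q (b₀ ∷ b) * ⟦_⟧ q a        ≈⟨ *-congˡ q^mx≈a ⟨
          ⟦_⟧ q (b₀ ∷ b) * (q ^ m * x)    ≈⟨ solve 3 (λ b y x → b :* (y :* x) := y :* (b :* x)) refl _ _ _ ⟩
          q ^ m * (⟦_⟧ q (b₀ ∷ b) * x)    ≈⟨ *-congˡ bx≈d ⟩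
          q ^ m * ⟦_⟧ q d                 ∎)
    in r , cancelˡ (q^-invertible m) (trans q^mx≈a a≈q^mr)

  -- Invariance gives q p(q) = q⁻¹ p(q⁻¹). With L the length of p and r its reversal, this says r =
  -- X^(L+1) p. But r has degree below L, so the two sides share no coefficient and all coefficients
  -- vanish.
  barInvariant⇒zero : ∀ {x} p → x ≈ q * ⟦_⟧ q p → BarScalar x x → x ≈ 0#
  barInvariant⇒zero {x} p x≈qp x-bar =
    trans x≈qp (trans (*-congˡ (eval-zero q (≡.subst IsZeroPoly (List.reverse-involutive p) (All-reverse r≡0)))) (zeroʳ q))
    where
    r = List.reverse p
    L = List.length p
    x≈q⁻¹p̄ : x ≈ q⁻¹ * ⟦_⟧ q⁻¹ p
    x≈q⁻¹p̄ = BarScalar-functional x-bar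
      (BarScalar-cong (sym x≈qp) refl (BarScalar-product BarScalar-q (BarScalar-poly p)))
    p̄≈qqp : ⟦_⟧ q⁻¹ p ≈ q * (q * ⟦_⟧ q p)
    p̄≈qqp = begin
      ⟦_⟧ q⁻¹ p               ≈⟨ trans (*-congʳ q*q⁻¹≈1) (*-identityˡ _) ⟨
      q * q⁻¹ * ⟦_⟧ q⁻¹ p     ≈⟨ *-assoc _ _ _ ⟩
      q * (q⁻¹ * ⟦_⟧ q⁻¹ p)   ≈⟨ *-congˡ (trans (sym x≈q⁻¹p̄) x≈qp) ⟩
      q * (q * ⟦_⟧ q p)       ∎
    r≈ : ⟦_⟧ q r ≈ q ^ L * (q * ⟦_⟧ q p)
    r≈ = cancelˡ q-invertible (begin
      q * ⟦_⟧ q r                       ≈⟨ eval-reverse p ⟨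
      q ^ L * ⟦_⟧ q⁻¹ p                 ≈⟨ *-congˡ p̄≈qqp ⟩
      q ^ L * (q * (q * ⟦_⟧ q p))       ≈⟨ solve 3 (λ y q p → y :* (q :* (q :* p)) := q :* (y :* (q :* p))) refl _ _ _ ⟩
      q * (q ^ L * (q * ⟦_⟧ q p))       ∎)
    -- Concatenation with one separating zero represents r - X^(L+1) p, since r occupies exactly L
    -- places.
    r-X^[L+1]p≈0 : ⟦_⟧ q (r List.++ 0ℤ ∷ -ᵖ p) ≈ 0#
    r-X^[L+1]p≈0 = begin
      ⟦_⟧ q (r List.++ 0ℤ ∷ -ᵖ p)                                ≈⟨ eval-++ q r (0ℤ ∷ -ᵖ p) ⟩
      ⟦_⟧ q r + q ^ List.length r * (0# + q * ⟦_⟧ q (-ᵖ p))      ≡⟨ ≡.cong (λ m → ⟦_⟧ q r + q ^ m * (0# + q * ⟦_⟧ q (-ᵖ p))) (List.length-reverse p) ⟩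
      ⟦_⟧ q r + q ^ L * (0# + q * ⟦_⟧ q (-ᵖ p))                  ≈⟨ +-cong r≈ (*-congˡ (+-congˡ (*-congˡ (eval-neg q p)))) ⟩
      q ^ L * (q * ⟦_⟧ q p) + q ^ L * (0# + q * - ⟦_⟧ q p)       ≈⟨ solve 3 (λ y q p → y :* (q :* p) :+ y :* (con 0ℤ :+ q :* :- p)
          := con 0ℤ) refl _ _ _ ⟩
      0#                                                         ∎
    r≡0 : IsZeroPoly r
    r≡0 = All.++⁻ˡ r (isZero (r List.++ 0ℤ ∷ -ᵖ p) r-X^[L+1]p≈0)

  polynomial-bar : ∀ {x} → Polynomial x → ∃ (BarScalar x)
  polynomial-bar (p , x≈p) = ⟦_⟧ q⁻¹ p , BarScalar-cong (sym x≈p) refl (BarScalar-poly p)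

  -- x ≡ y modulo q A₀, where A₀ is the local ring of rational functions regular at 0.
  infix 4 _≡ᵣ_
  _≡ᵣ_ : Carrier → Carrier → Set _
  x ≡ᵣ y = ∃ λ r → Regular r × x ≈ y + q * r

  -- The difference x - y is a bar invariant polynomial of the form q r. Being a polynomial divided
  -- by q, r is Laurent; being also regular, it is a polynomial, and `barInvariant⇒zero` applies.
  barInvariant-residue : ∀ {x y} → Polynomial x → Polynomial y → BarScalar x x → BarScalar y y →
                         x ≡ᵣ y → x ≈ y
  barInvariant-residue {x} {y} x-poly y-poly x-bar y-bar (r , r-reg , x≈y+qr) = begin
    x             ≈⟨ solve 2 (λ x y → x := y :+ (x :- y)) refl x y ⟩
    y + (x - y)   ≈⟨ +-congˡ (barInvariant⇒zero p (trans x-y≈qr (*-congˡ r≈p)) x-y-bar) ⟩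
    y + 0#        ≈⟨ +-identityʳ y ⟩
    y             ∎
    where
    x-y≈qr = trans (+-congʳ x≈y+qr) (solve 2 (λ y z → y :+ z :- y := z) refl y (q * r))
    difference = Polynomial-+ x-poly (Polynomial-neg y-poly)
    r-poly : Polynomial r
    r-poly = laurent∧regular⇒polynomial
      (proj₁ difference , 1 , trans (*-congʳ (*-identityʳ q)) (trans (sym x-y≈qr) (proj₂ difference))) r-reg
    p = proj₁ r-poly
    r≈p = proj₂ r-poly
    -1-bar : BarScalar (- 1#) (- 1#)
    -1-bar = BarScalar-cong (minus q) (minus q⁻¹) (BarScalar-poly (-[1+ 0 ] ∷ []))
      where
      minus : ∀ x → ⟦_⟧ x (-[1+ 0 ] ∷ []) ≈ - 1#
      minus x = trans (eval-neg x (1ℤ ∷ [])) (-‿cong (eval-1 x))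
    x-y-bar : BarScalar (x - y) (x - y)
    x-y-bar = BarScalar-cong eq eq (BarScalar-sum x-bar (BarScalar-product -1-bar y-bar))
      where
      eq : x + - 1# * y ≈ x - y
      eq = +-congˡ (-1*x≈-x y)

  -- For identities modulo q q⁻¹ = 1, which the ring solver does not know.
  by-unit : ∀ z {x y} → x ≈ y + (q * q⁻¹ * z - z) → x ≈ y
  by-unit z {x} {y} x≈ = trans x≈ (trans (+-congˡ (trans (+-congʳ
      (trans (*-congʳ q*q⁻¹≈1) (*-identityˡ z))) (-‿inverseʳ z))) (+-identityʳ y))

  -- The commuting raising operator and the lowering operators in coordinates.

  restrict : Tensor (suc N) → Bool → Bool → Tensor N
  restrict u a b I J = u (a ∷ I) (b ∷ J)

  restrict² : Tensor (suc (suc N)) → Bool → Bool → Bool → Bool → Tensor N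
  restrict² u a b c d I J = u (a ∷ b ∷ I) (c ∷ d ∷ J)

  -- The raising operator of the U_q(𝔰𝔩₂) commuting with U_q(𝔰𝔩ₙ) on Λ ⊗ Λ (skew
  -- Howe duality): it moves an element of J to I.  V_q(2ω_k) lies in its kernel.
  E : Tensor N → Tensor N
  E u []          []          = 0#
  E u (true ∷ I)  (false ∷ J) = u (false ∷ I) (true ∷ J) + - q * E (restrict u true false) I J
  E u (false ∷ I) (true ∷ J)  = - q⁻¹ * E (restrict u false true) I J
  E u (true ∷ I)  (true ∷ J)  = E (restrict u true true) I J
  E u (false ∷ I) (false ∷ J) = E (restrict u false false) I J

  E-cong : ∀ {u w : Tensor N} → (∀ I J → u I J ≈ w I J) → ∀ I J → E u I J ≈ E w I J
  E-cong u≈w []          []          = refl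
  E-cong u≈w (true ∷ I)  (false ∷ J) = +-cong (u≈w _ _) (*-congˡ (E-cong (λ I J → u≈w _ _) I J))
  E-cong u≈w (false ∷ I) (true ∷ J)  = *-congˡ (E-cong (λ I J → u≈w _ _) I J)
  E-cong u≈w (true ∷ I)  (true ∷ J)  = E-cong (λ I J → u≈w _ _) I J
  E-cong u≈w (false ∷ I) (false ∷ J) = E-cong (λ I J → u≈w _ _) I J

  E-linear : ∀ a (u w : Tensor N) I J → E (λ I J → u I J + a * w I J) I J ≈ E u I J + a * E w I J
  E-linear a u w [] [] = sym (trans (+-identityˡ _) (zeroʳ a))
  E-linear a u w (true ∷ I) (false ∷ J) = trans
    (+-congˡ (*-congˡ (E-linear a (restrict u true false) (restrict w true false) I J)))
    (solve 6 (λ a q u w u′ w′ → (u :+ a :* w) :+ q :* (u′ :+ a :* w′) := (u :+ q :* u′) :+ a :* (w :+ q :* w′))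
      refl a (- q) _ _ _ _)
  E-linear a u w (false ∷ I) (true ∷ J) = trans
    (*-congˡ (E-linear a (restrict u false true) (restrict w false true) I J))
    (solve 4 (λ a q u w → q :* (u :+ a :* w) := q :* u :+ a :* (q :* w)) refl a (- q⁻¹) _ _)
  E-linear a u w (true ∷ I)  (true ∷ J)  = E-linear a (restrict u true true) (restrict w true true) I J
  E-linear a u w (false ∷ I) (false ∷ J) = E-linear a (restrict u false false) (restrict w false false) I J

  E-zero : ∀ {u : Tensor N} → (∀ I J → u I J ≈ 0#) → ∀ I J → E u I J ≈ 0#
  E-zero u≈0 []          []          = refl
  E-zero u≈0 (true ∷ I)  (false ∷ J) =
    trans (+-cong (u≈0 _ _) (trans (*-congˡ (E-zero (λ I J → u≈0 _ _) I J)) (zeroʳ _))) (+-identityʳ 0#)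
  E-zero u≈0 (false ∷ I) (true ∷ J)  = trans (*-congˡ (E-zero (λ I J → u≈0 _ _) I J)) (zeroʳ _)
  E-zero u≈0 (true ∷ I)  (true ∷ J)  = E-zero (λ I J → u≈0 _ _) I J
  E-zero u≈0 (false ∷ I) (false ∷ J) = E-zero (λ I J → u≈0 _ _) I J

  E-+ : ∀ (u w : Tensor N) I J → E (λ I J → u I J + w I J) I J ≈ E u I J + E w I J
  E-+ u w I J = trans (E-cong (λ I J → +-congˡ (sym (*-identityˡ _))) I J)
    (trans (E-linear 1# u w I J) (+-congˡ (*-identityˡ _)))

  E-* : ∀ a (u : Tensor N) I J → E (λ I J → a * u I J) I J ≈ a * E u I J
  E-* a u I J = trans (E-cong (λ I J → sym (+-identityˡ _)) I J)
    (trans (E-linear a (λ _ _ → 0#) u I J) (trans (+-congʳ (E-zero (λ _ _ → refl) I J)) (+-identityˡ _)))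

  -- A coordinate of `E u` reads u only at pairs obtained by moving an element from I to J, and
  -- these are never diagonal. Hence v₊ lies in the kernel.
  E-diagonal : ∀ {u : Tensor N} → (∀ I J → I ≢ J → u I J ≈ 0#) → ∀ I J → E u I J ≈ 0#
  E-diagonal u≈0 []          []          = refl
  E-diagonal u≈0 (true ∷ I)  (false ∷ J) =
    trans (+-cong (u≈0 _ _ λ ()) (trans (*-congˡ (E-zero (λ I J → u≈0 _ _ λ ()) I J)) (zeroʳ _))) (+-identityʳ 0#)
  E-diagonal u≈0 (false ∷ I) (true ∷ J)  = trans (*-congˡ (E-zero (λ I J → u≈0 _ _ λ ()) I J)) (zeroʳ _)
  E-diagonal u≈0 (true ∷ I)  (true ∷ J)  = E-diagonal (λ I J I≢J → u≈0 _ _ (I≢J ∘ ≡.cong Vec.tail)) I J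
  E-diagonal u≈0 (false ∷ I) (false ∷ J) = E-diagonal (λ I J I≢J → u≈0 _ _ (I≢J ∘ ≡.cong Vec.tail)) I J

  -- t_i acts by q^{⟨h_i, wt J⟩}; the arguments say whether i, i + 1 ∈ J.
  act : Bool → Bool → Carrier → Carrier
  act true  false x = q * x
  act false true  x = q⁻¹ * x
  act true  true  x = x
  act false false x = x

  -- f_i for two positions among any number of letters, so that induction on the letters is
  -- possible; `f-lower` identifies it with `f`.
  lower : Fin N → Fin N → Tensor N → Tensor N
  lower lo hi u I J =
    (if not (lookup I lo) ∧ lookup I hi then act (lookup J lo) (lookup J hi) (u (I [ lo ]≔ true [ hi ]≔ false) J) else 0#)
    + (if not (lookup J lo) ∧ lookup J hi then u I (J [ lo ]≔ true [ hi ]≔ false) else 0#)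

  act-cong : ∀ a b {x y} → x ≈ y → act a b x ≈ act a b y
  act-cong true  false = *-congˡ
  act-cong false true  = *-congˡ
  act-cong true  true  = λ e → e
  act-cong false false = λ e → e

  act-zero : ∀ a b {x} → x ≈ 0# → act a b x ≈ 0#
  act-zero true  false x≈0 = trans (*-congˡ x≈0) (zeroʳ q)
  act-zero false true  x≈0 = trans (*-congˡ x≈0) (zeroʳ q⁻¹)
  act-zero true  true  x≈0 = x≈0
  act-zero false false x≈0 = x≈0

  act-linear : ∀ a b z x y → act a b (x + z * y) ≈ act a b x + z * act a b y
  act-linear true  false z x y = solve 4 (λ q z x y → q :* (x :+ z :* y) := q :* x :+ z :* (q :* y)) refl q z x y
  act-linear false true  z x y = solve 4 (λ q z x y → q :* (x :+ z :* y) := q :* x :+ z :* (q :* y)) refl q⁻¹ z x y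
  act-linear true  true  z x y = refl
  act-linear false false z x y = refl

  private
    if-cong : ∀ b {x y} → x ≈ y → (if b then x else 0#) ≈ (if b then y else 0#)
    if-cong true  e = e
    if-cong false e = refl

    if-zero : ∀ b {x} → (b ≡ true → x ≈ 0#) → (if b then x else 0#) ≈ 0#
    if-zero true  x≈0 = x≈0 ≡.refl
    if-zero false x≈0 = refl

    if-linear : ∀ b {x y z a} → x ≈ y + a * z →
                (if b then x else 0#) ≈ (if b then y else 0#) + a * (if b then z else 0#)
    if-linear true  e = e
    if-linear false {a = a} e = sym (trans (+-congˡ (zeroʳ a)) (+-identityʳ 0#))

  lower-cong : ∀ (lo hi : Fin N) {u w} → (∀ I J → u I J ≈ w I J) → ∀ I J → lower lo hi u I J ≈ lower lo hi w I J
  lower-cong lo hi u≈w I J =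
    +-cong (if-cong (not (lookup I lo) ∧ lookup I hi) (act-cong (lookup J lo) (lookup J hi) (u≈w _ _)))
           (if-cong (not (lookup J lo) ∧ lookup J hi) (u≈w _ _))

  lower-linear : ∀ (lo hi : Fin N) a u w I J →
    lower lo hi (λ I J → u I J + a * w I J) I J ≈ lower lo hi u I J + a * lower lo hi w I J
  lower-linear lo hi a u w I J = trans
    (+-cong (if-linear (not (lookup I lo) ∧ lookup I hi) (act-linear (lookup J lo) (lookup J hi) a _ _))
            (if-linear (not (lookup J lo) ∧ lookup J hi) refl))
    (solve 5 (λ a x y x′ y′ → (x :+ a :* y) :+ (x′ :+ a :* y′) := (x :+ x′) :+ a :* (y :+ y′)) refl a _ _ _ _)

  lower-zero : ∀ (lo hi : Fin N) {u} → (∀ I J → u I J ≈ 0#) → ∀ I J → lower lo hi u I J ≈ 0#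
  lower-zero lo hi u≈0 I J = trans
    (+-cong (if-zero (not (lookup I lo) ∧ lookup I hi) λ _ → act-zero (lookup J lo) (lookup J hi) (u≈0 _ _))
            (if-zero (not (lookup J lo) ∧ lookup J hi) λ _ → u≈0 _ _)) (+-identityʳ 0#)

  lower-* : ∀ (lo hi : Fin N) a u I J → lower lo hi (λ I J → a * u I J) I J ≈ a * lower lo hi u I J
  lower-* lo hi a u I J = trans (lower-cong lo hi {w = λ I J → 0# + a * u I J} (λ I J → sym (+-identityˡ _)) I J)
    (trans (lower-linear lo hi a (λ _ _ → 0#) u I J)
      (trans (+-congʳ (lower-zero lo hi {λ _ _ → 0#} (λ _ _ → refl) I J)) (+-identityˡ _)))

  private
    E-0+0 : ∀ (I J : Subset N) → E (λ _ _ → 0# + 0#) I J ≈ 0# + 0#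
    E-0+0 I J = trans (E-zero (λ _ _ → +-identityʳ 0#) I J) (sym (+-identityʳ 0#))

    E-0+ : ∀ {u : Tensor N} I J → E (λ I J → 0# + u I J) I J ≈ 0# + E u I J
    E-0+ I J = trans (E-cong (λ _ _ → +-identityˡ _) I J) (sym (+-identityˡ _))

    E-+0 : ∀ {u : Tensor N} I J → E (λ I J → u I J + 0#) I J ≈ E u I J + 0#
    E-+0 I J = trans (E-cong (λ _ _ → +-identityʳ _) I J) (sym (+-identityʳ _))

    E-*+0 : ∀ {a} {u : Tensor N} I J → E (λ I J → a * u I J + 0#) I J ≈ a * E u I J + 0#
    E-*+0 {a = a} {u} I J = trans (E-+0 I J) (+-congʳ (E-* a u I J))

    E-*++ : ∀ {a} {u w : Tensor N} I J → E (λ I J → a * u I J + w I J) I J ≈ a * E u I J + E w I J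
    E-*++ {a = a} {u} {w} I J = trans (E-+ (λ I J → a * u I J) w I J) (+-congʳ (E-* a u I J))

  private
   -- Sixteen cases for the bits at i and i + 1. The values of E on the remaining letters are
   -- unknowns common to both sides, so each case is a ring identity, in some of them modulo q q⁻¹ =
   -- 1.
   commute-base : ∀ (u : Tensor (suc (suc N))) I J →
    E (lower zero (suc zero) u) I J ≈ lower zero (suc zero) (E u) I J
   commute-base u (false ∷ false ∷ I) (false ∷ false ∷ J) = E-0+0 I J
   commute-base u (false ∷ false ∷ I) (false ∷ true ∷ J) =
     trans (*-congˡ (E-0+ I J)) (solve 3 (λ q q′ x₀ → ((:- q′) :* (con 0ℤ :+ x₀)) := (con 0ℤ :+ ((:- q′) :* x₀))) refl q q⁻¹ _)
   commute-base u (false ∷ false ∷ I) (true ∷ false ∷ J) =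
     trans (*-congˡ (E-0+0 I J)) (solve 2 (λ q q′ → ((:- q′) :* (con 0ℤ :+ con 0ℤ)) := (con 0ℤ :+ con 0ℤ)) refl q q⁻¹)
   commute-base u (false ∷ false ∷ I) (true ∷ true ∷ J) =
     trans (*-congˡ (*-congˡ (E-0+0 I J))) (solve 2 (λ q q′ → ((:- q′) :* ((:- q′) :* (con 0ℤ :+ con 0ℤ)))
         := (con 0ℤ :+ con 0ℤ)) refl q q⁻¹)
   commute-base u (false ∷ true ∷ I) (false ∷ false ∷ J) =
     trans (+-congˡ (*-congˡ (E-+0 I J))) (solve 4 (λ q q′ x₀ x₁ → ((con 0ℤ :+ x₁) :+ (:- q) :* (x₀ :+ con 0ℤ))
         := ((x₁ :+ (:- q) :* x₀) :+ con 0ℤ)) refl q q⁻¹ _ _)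
   commute-base u (false ∷ true ∷ I) (false ∷ true ∷ J) =
     trans (E-*++ I J) (by-unit (- (q⁻¹ * E (restrict² u true false false true) I J + E (restrict² u false true true false) I J))
         (solve 5 (λ q q′ x₀ x₁ x₂ → (q′ :* x₀ :+ x₁)
             := (q′ :* (x₂ :+ (:- q) :* ((:- q′) :* x₀)) :+ ((:- q′) :* (x₂ :+ (:- q) :* x₁))) :+ (q :* q′ :* :- (q′ :* x₀ :+ x₁) :- :- (q′ :* x₀ :+ x₁))) refl q q⁻¹ _ _ _))
   commute-base u (false ∷ true ∷ I) (true ∷ false ∷ J) =
     trans (*-congˡ (+-congˡ (*-congˡ (E-*+0 I J)))) (by-unit (q * E (restrict² u true false true false) I J)
         (solve 3 (λ q q′ x₀ → ((:- q′) :* ((con 0ℤ :+ con 0ℤ) :+ (:- q) :* (q :* x₀ :+ con 0ℤ)))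
             := (q :* x₀ :+ con 0ℤ) :+ (q :* q′ :* (q :* x₀) :- (q :* x₀))) refl q q⁻¹ _))
   commute-base u (false ∷ true ∷ I) (true ∷ true ∷ J) =
     trans (*-congˡ (E-+0 I J)) (solve 3 (λ q q′ x₀ → ((:- q′) :* (x₀ :+ con 0ℤ)) := (((:- q′) :* x₀) :+ con 0ℤ)) refl q q⁻¹ _)
   commute-base u (true ∷ false ∷ I) (false ∷ false ∷ J) =
     trans (+-congˡ (*-congˡ (E-0+0 I J))) (solve 2 (λ q q′ → ((con 0ℤ :+ con 0ℤ) :+ (:- q) :* (con 0ℤ :+ con 0ℤ))
         := (con 0ℤ :+ con 0ℤ)) refl q q⁻¹)
   commute-base u (true ∷ false ∷ I) (false ∷ true ∷ J) =
     trans (+-congˡ (*-congˡ (*-congˡ (E-0+ I J)))) (by-unit (E (restrict² u true false true false) I J)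
         (solve 3 (λ q q′ x₀ → ((con 0ℤ :+ con 0ℤ) :+ (:- q) :* ((:- q′) :* (con 0ℤ :+ x₀)))
             := (con 0ℤ :+ x₀) :+ (q :* q′ :* x₀ :- x₀)) refl q q⁻¹ _))
   commute-base u (true ∷ false ∷ I) (true ∷ false ∷ J) = E-0+0 I J
   commute-base u (true ∷ false ∷ I) (true ∷ true ∷ J) =
     trans (*-congˡ (E-0+0 I J)) (solve 2 (λ q q′ → ((:- q′) :* (con 0ℤ :+ con 0ℤ)) := (con 0ℤ :+ con 0ℤ)) refl q q⁻¹)
   commute-base u (true ∷ true ∷ I) (false ∷ false ∷ J) =
     trans (+-congˡ (*-congˡ (+-congˡ (*-congˡ (E-0+0 I J)))))
         (solve 3 (λ q q′ x₀ → ((q :* x₀ :+ con 0ℤ) :+ (:- q) :* ((con 0ℤ :+ x₀) :+ (:- q) :* (con 0ℤ :+ con 0ℤ)))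
             := (con 0ℤ :+ con 0ℤ)) refl q q⁻¹ _)
   commute-base u (true ∷ true ∷ I) (false ∷ true ∷ J) =
     trans (+-congˡ (*-congˡ (E-0+ I J))) (solve 4 (λ q q′ x₀ x₁ → ((x₁ :+ con 0ℤ) :+ (:- q) :* (con 0ℤ :+ x₀))
         := (con 0ℤ :+ (x₁ :+ (:- q) :* x₀))) refl q q⁻¹ _ _)
   commute-base u (true ∷ true ∷ I) (true ∷ false ∷ J) =
     trans (+-congˡ (*-congˡ (E-0+0 I J))) (solve 2 (λ q q′ → ((con 0ℤ :+ con 0ℤ) :+ (:- q) :* (con 0ℤ :+ con 0ℤ))
         := (con 0ℤ :+ con 0ℤ)) refl q q⁻¹)
   commute-base u (true ∷ true ∷ I) (true ∷ true ∷ J) = E-0+0 I J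

  E-lower : ∀ {lo hi : Fin N} → Adjacent lo hi → ∀ u I J → E (lower lo hi u) I J ≈ lower lo hi (E u) I J
  E-lower base = commute-base
  E-lower (step {lo = lo} {hi} adj) u (true ∷ I) (false ∷ J) =
    trans (+-congˡ (*-congˡ (E-lower adj (restrict u true false) I J)))
      (sym (lower-linear lo hi (- q) (restrict u false true) (E (restrict u true false)) I J))
  E-lower (step {lo = lo} {hi} adj) u (false ∷ I) (true ∷ J) =
    trans (*-congˡ (E-lower adj (restrict u false true) I J))
      (sym (lower-* lo hi (- q⁻¹) (E (restrict u false true)) I J))
  E-lower (step adj) u (true ∷ I)  (true ∷ J)  = E-lower adj (restrict u true true) I J
  E-lower (step adj) u (false ∷ I) (false ∷ J) = E-lower adj (restrict u false false) I J

  -- The tensors C_w as a basis of the kernel.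

  -- The combination Σ_w c(w) C_w of the tensors C_w attached to the words w.  At
  -- e_I ⊗ e_J, C_w is the product over the matched pairs of w of 1 if the opener
  -- lies in I and the closer in J, q if it is the other way around.  The stack
  -- records which of the openers before the word lie in I.
  final : (Word h 0 → Carrier) → Vec Bool h → Carrier
  final c []      = c []
  final c (_ ∷ _) = 0#

  comb : (Word h N → Carrier) → Vec Bool h → Tensor N
  closing : Bool → (Word h (suc N) → Carrier) → Vec Bool h → Tensor N
  comb         c st       []          []          = final c st
  comb         c st       (false ∷ I) (false ∷ J) = comb (c ∘ none) st I J
  comb         c st       (true ∷ I)  (true ∷ J)  = comb (c ∘ both) st I J
  comb         c st       (true ∷ I)  (false ∷ J) = comb (c ∘ up) (true ∷ st) I J + closing true c st I J
  comb         c st       (false ∷ I) (true ∷ J)  = comb (c ∘ up) (false ∷ st) I J + closing false c st I J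
  closing a     c []           I J = 0#
  closing true  c (false ∷ st) I J = q * comb (c ∘ down) st I J
  closing false c (true ∷ st)  I J = comb (c ∘ down) st I J
  closing true  c (true ∷ st)  I J = 0#
  closing false c (false ∷ st) I J = 0#

  comb-cong : ∀ {c d : Word h N → Carrier} → (∀ w → c w ≈ d w) → ∀ st I J → comb c st I J ≈ comb d st I J
  closing-cong : ∀ a {c d : Word h (suc N) → Carrier} → (∀ w → c w ≈ d w) → ∀ st I J → closing a c st I J ≈ closing a d st I J
  comb-cong c≈d []               []          []          = c≈d []
  comb-cong c≈d (_ ∷ _)          []          []          = refl
  comb-cong         c≈d st       (false ∷ I) (false ∷ J) = comb-cong (c≈d ∘ none) st I J
  comb-cong         c≈d st       (true ∷ I)  (true ∷ J)  = comb-cong (c≈d ∘ both) st I J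
  comb-cong         c≈d st       (true ∷ I)  (false ∷ J) = +-cong (comb-cong (c≈d ∘ up) _ I J) (closing-cong true c≈d st I J)
  comb-cong         c≈d st       (false ∷ I) (true ∷ J)  = +-cong (comb-cong (c≈d ∘ up) _ I J) (closing-cong false c≈d st I J)
  closing-cong a     c≈d []           I J = refl
  closing-cong true  c≈d (false ∷ st) I J = *-congˡ (comb-cong (c≈d ∘ down) st I J)
  closing-cong false c≈d (true ∷ st)  I J = comb-cong (c≈d ∘ down) st I J
  closing-cong true  c≈d (true ∷ st)  I J = refl
  closing-cong false c≈d (false ∷ st) I J = refl

  comb-zero : ∀ {c : Word h N → Carrier} → (∀ w → c w ≈ 0#) → ∀ st I J → comb c st I J ≈ 0#
  closing-zero : ∀ a {c : Word h (suc N) → Carrier} → (∀ w → c w ≈ 0#) → ∀ st I J → closing a c st I J ≈ 0#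
  comb-zero c≈0 []               []          []          = c≈0 []
  comb-zero c≈0 (_ ∷ _)          []          []          = refl
  comb-zero         c≈0 st       (false ∷ I) (false ∷ J) = comb-zero (c≈0 ∘ none) st I J
  comb-zero         c≈0 st       (true ∷ I)  (true ∷ J)  = comb-zero (c≈0 ∘ both) st I J
  comb-zero         c≈0 st       (true ∷ I)  (false ∷ J) =
    trans (+-cong (comb-zero (c≈0 ∘ up) _ I J) (closing-zero true c≈0 st I J)) (+-identityʳ 0#)
  comb-zero         c≈0 st       (false ∷ I) (true ∷ J)  =
    trans (+-cong (comb-zero (c≈0 ∘ up) _ I J) (closing-zero false c≈0 st I J)) (+-identityʳ 0#)
  closing-zero a     c≈0 []           I J = refl
  closing-zero true  c≈0 (false ∷ st) I J = trans (*-congˡ (comb-zero (c≈0 ∘ down) st I J)) (zeroʳ q)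
  closing-zero false c≈0 (true ∷ st)  I J = comb-zero (c≈0 ∘ down) st I J
  closing-zero true  c≈0 (true ∷ st)  I J = refl
  closing-zero false c≈0 (false ∷ st) I J = refl

  -- The group-like factor in the coproduct of E: what E collects on its way past the pending
  -- openers, - q for one in I and - q⁻¹ for one in J.
  κ : Vec Bool h → Carrier
  κ []           = 1#
  κ (true ∷ st)  = - q * κ st
  κ (false ∷ st) = - q⁻¹ * κ st

  κ-invertible : ∀ (st : Vec Bool h) → Invertible (κ st)
  κ-invertible []           = invertible-1
  κ-invertible (true ∷ st)  = invertible-* (- q⁻¹ , trans (solve 2 (λ x y → :- x :* :- y := x :* y) refl q q⁻¹) q*q⁻¹≈1) (κ-invertible st)
  κ-invertible (false ∷ st) = invertible-* (- q , trans (solve 2 (λ x y → :- y :* :- x := x :* y) refl q q⁻¹) q*q⁻¹≈1) (κ-invertible st)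

  -- E acting on the stack as on a tensor: an entry `true` is reached from `false`, with the factor
  -- `κ` of the entries below it, which stand for earlier openers.
  raise : (Vec Bool h → Carrier) → Vec Bool h → Carrier
  raise g []           = 0#
  raise g (true ∷ st)  = raise (g ∘ (true ∷_)) st + κ st * g (false ∷ st)
  raise g (false ∷ st) = raise (g ∘ (false ∷_)) st

  raise-linear : ∀ a (f g : Vec Bool h → Carrier) st → raise (λ st → f st + a * g st) st ≈ raise f st + a * raise g st
  raise-linear a f g []           = sym (trans (+-identityˡ _) (zeroʳ a))
  raise-linear a f g (true ∷ st)  = trans (+-congʳ (raise-linear a (f ∘ (true ∷_)) (g ∘ (true ∷_)) st))
    (solve 6 (λ a k x y x′ y′ → (x :+ a :* y) :+ k :* (x′ :+ a :* y′) := (x :+ k :* x′) :+ a :* (y :+ k :* y′)) refl a (κ st) _ _ _ _)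
  raise-linear a f g (false ∷ st) = raise-linear a (f ∘ (false ∷_)) (g ∘ (false ∷_)) st

  raise-cong : ∀ {f g : Vec Bool h → Carrier} → (∀ st → f st ≈ g st) → ∀ st → raise f st ≈ raise g st
  raise-cong f≈g []           = refl
  raise-cong f≈g (true ∷ st)  = +-cong (raise-cong (f≈g ∘ (true ∷_)) st) (*-congˡ (f≈g _))
  raise-cong f≈g (false ∷ st) = raise-cong (f≈g ∘ (false ∷_)) st

  trues : Vec Bool h → ℕ
  trues []           = 0
  trues (true ∷ st)  = suc (trues st)
  trues (false ∷ st) = trues st

  raise-zero : ∀ {g : Vec Bool h → Carrier} st → (∀ st′ → suc (trues st′) ≡ trues st → g st′ ≈ 0#) → raise g st ≈ 0#
  raise-zero []           g≈0 = refl
  raise-zero (true ∷ st)  g≈0 = trans (+-cong (raise-zero st λ st′ e → g≈0 (true ∷ st′) (≡.cong suc e))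
                                              (trans (*-congˡ (g≈0 (false ∷ st) ≡.refl)) (zeroʳ _))) (+-identityʳ 0#)
  raise-zero (false ∷ st) g≈0 = raise-zero st λ st′ e → g≈0 (false ∷ st′) e

  raise-0 : ∀ {g : Vec Bool h → Carrier} → (∀ st → g st ≈ 0#) → ∀ st → raise g st ≈ 0#
  raise-0 g≈0 st = raise-zero st λ st′ _ → g≈0 st′

  raise-+ : ∀ (f g : Vec Bool h → Carrier) st → raise (λ st → f st + g st) st ≈ raise f st + raise g st
  raise-+ f g st = trans (raise-cong (λ _ → +-congˡ (sym (*-identityˡ _))) st)
    (trans (raise-linear 1# f g st) (+-congˡ (*-identityˡ _)))

  raise-* : ∀ a (g : Vec Bool h → Carrier) st → raise (λ st → a * g st) st ≈ a * raise g st
  raise-* a g st = trans (raise-cong (λ _ → sym (+-identityˡ _)) st)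
    (trans (raise-linear a (λ _ → 0#) g st) (trans (+-congʳ (raise-0 (λ _ → refl) st)) (+-identityˡ _)))

  -- This is E applied to the pending openers and the suffix together: by the coproduct it acts on
  -- the stack through `raise`, or on the suffix with the factor `κ st`. An opening letter merely
  -- moves to the stack. A closing letter completes a pair, and pairs are invariants of the
  -- commuting U_q(𝔰𝔩₂), as computed in the two `closing` lemmas.
  comb-kernel : ∀ (c : Word h N → Carrier) st I J → raise (λ st → comb c st I J) st + κ st * E (comb c st) I J ≈ 0#
  closing-true-kernel : ∀ (c : Word h (suc N) → Carrier) st I J →
    raise (λ st → closing true c st I J) st + κ st * (closing false c st I J + - q * E (closing true c st) I J) ≈ 0#
  closing-false-kernel : ∀ (c : Word h (suc N) → Carrier) st I J →
    raise (λ st → closing false c st I J) st + κ st * (- q⁻¹ * E (closing false c st) I J) ≈ 0#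

  comb-kernel c [] [] [] = trans (+-identityˡ _) (zeroʳ _)
  comb-kernel c st@(_ ∷ _) [] [] = trans (+-cong (raise-zero st λ { (_ ∷ _) _ → refl }) (zeroʳ _)) (+-identityʳ 0#)
  comb-kernel c st (false ∷ I) (false ∷ J) = comb-kernel (c ∘ none) st I J
  comb-kernel c st (true ∷ I)  (true ∷ J)  = comb-kernel (c ∘ both) st I J
  comb-kernel c st (true ∷ I)  (false ∷ J) = begin
    raise (λ st → comb (c ∘ up) (true ∷ st) I J + closing true c st I J) st
      + κ st * ((comb (c ∘ up) (false ∷ st) I J + closing false c st I J)
                + - q * E (λ I J → comb (c ∘ up) (true ∷ st) I J + closing true c st I J) I J)
      ≈⟨ +-cong (raise-+ (λ st → comb (c ∘ up) (true ∷ st) I J) (λ st → closing true c st I J) st)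
                (*-congˡ (+-congˡ (*-congˡ (E-+ (comb (c ∘ up) (true ∷ st)) (closing true c st) I J)))) ⟩
    (raise (λ st → comb (c ∘ up) (true ∷ st) I J) st + raise (λ st → closing true c st I J) st)
      + κ st * ((comb (c ∘ up) (false ∷ st) I J + closing false c st I J)
                + - q * (E (comb (c ∘ up) (true ∷ st)) I J + E (closing true c st) I J))
      ≈⟨ solve 8 (λ r r′ k x x′ q e e′ → (r :+ r′) :+ k :* ((x :+ x′) :+ :- q :* (e :+ e′))
                 := ((r :+ k :* x) :+ :- q :* k :* e) :+ (r′ :+ k :* (x′ :+ :- q :* e′)))
           refl _ _ (κ st) _ _ q _ _ ⟩
    (raise (λ st → comb (c ∘ up) st I J) (true ∷ st) + κ (true ∷ st) * E (comb (c ∘ up) (true ∷ st)) I J)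
      + (raise (λ st → closing true c st I J) st + κ st * (closing false c st I J + - q * E (closing true c st) I J))
      ≈⟨ +-cong (comb-kernel (c ∘ up) (true ∷ st) I J) (closing-true-kernel c st I J) ⟩
    0# + 0#  ≈⟨ +-identityʳ 0# ⟩
    0#       ∎
  comb-kernel c st (false ∷ I) (true ∷ J) = begin
    raise (λ st → comb (c ∘ up) (false ∷ st) I J + closing false c st I J) st
      + κ st * (- q⁻¹ * E (λ I J → comb (c ∘ up) (false ∷ st) I J + closing false c st I J) I J)
      ≈⟨ +-cong (raise-+ (λ st → comb (c ∘ up) (false ∷ st) I J) (λ st → closing false c st I J) st)
                (*-congˡ (*-congˡ (E-+ (comb (c ∘ up) (false ∷ st)) (closing false c st) I J))) ⟩
    (raise (λ st → comb (c ∘ up) (false ∷ st) I J) st + raise (λ st → closing false c st I J) st)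
      + κ st * (- q⁻¹ * (E (comb (c ∘ up) (false ∷ st)) I J + E (closing false c st) I J))
      ≈⟨ solve 6 (λ r r′ k q e e′ → (r :+ r′) :+ k :* (:- q :* (e :+ e′))
                 := (r :+ :- q :* k :* e) :+ (r′ :+ k :* (:- q :* e′)))
           refl _ _ (κ st) q⁻¹ _ _ ⟩
    (raise (λ st → comb (c ∘ up) st I J) (false ∷ st) + κ (false ∷ st) * E (comb (c ∘ up) (false ∷ st)) I J)
      + (raise (λ st → closing false c st I J) st + κ st * (- q⁻¹ * E (closing false c st) I J))
      ≈⟨ +-cong (comb-kernel (c ∘ up) (false ∷ st) I J) (closing-false-kernel c st I J) ⟩
    0# + 0#  ≈⟨ +-identityʳ 0# ⟩
    0#       ∎

  closing-true-kernel c [] I J = trans (+-identityˡ _)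
    (trans (*-congˡ (trans (+-identityˡ _) (trans (*-congˡ (E-zero (λ _ _ → refl) I J)) (zeroʳ _)))) (zeroʳ _))
  -- Here the invariance of a pair enters: raising the opener contributes q times κ y, and raising
  -- the closer contributes - q times κ y.
  closing-true-kernel c (true ∷ st) I J = begin
    (raise (λ _ → 0#) st + κ st * (q * y)) + - q * κ st * (y + - q * E (λ _ _ → 0#) I J)
      ≈⟨ +-cong (+-congʳ (raise-0 (λ _ → refl) st)) (*-congˡ (+-congˡ (*-congˡ (E-zero (λ _ _ → refl) I J)))) ⟩
    (0# + κ st * (q * y)) + - q * κ st * (y + - q * 0#)
      ≈⟨ solve 3 (λ k q y → (con 0ℤ :+ k :* (q :* y)) :+ :- q :* k :* (y :+ :- q :* con 0ℤ) := con 0ℤ) refl (κ st) q y ⟩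
    0# ∎
    where y = comb (c ∘ down) st I J
  closing-true-kernel c (false ∷ st) I J = begin
    raise (λ st → q * comb (c ∘ down) st I J) st + - q⁻¹ * κ st * (0# + - q * E (λ I J → q * comb (c ∘ down) st I J) I J)
      ≈⟨ +-cong (raise-* q (λ st → comb (c ∘ down) st I J) st) (*-congˡ (+-congˡ (*-congˡ (E-* q (comb (c ∘ down) st) I J)))) ⟩
    q * r + - q⁻¹ * κ st * (0# + - q * (q * e))
      ≈⟨ by-unit (q * (κ st * e)) (solve 5 (λ q q′ r k e → q :* r :+ :- q′ :* k :* (con 0ℤ :+ :- q :* (q :* e))
            := q :* (r :+ k :* e) :+ (q :* q′ :* (q :* (k :* e)) :- q :* (k :* e))) refl q q⁻¹ r (κ st) e) ⟩
    q * (r + κ st * e)  ≈⟨ *-congˡ (comb-kernel (c ∘ down) st I J) ⟩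
    q * 0#              ≈⟨ zeroʳ q ⟩
    0#                  ∎
    where
    r = raise (λ st → comb (c ∘ down) st I J) st
    e = E (comb (c ∘ down) st) I J

  closing-false-kernel c [] I J = trans (+-identityˡ _)
    (trans (*-congˡ (trans (*-congˡ (E-zero (λ _ _ → refl) I J)) (zeroʳ _))) (zeroʳ _))
  closing-false-kernel c (true ∷ st) I J = begin
    (r + κ st * 0#) + - q * κ st * (- q⁻¹ * e)
      ≈⟨ by-unit (κ st * e) (solve 5 (λ q q′ r k e → (r :+ k :* con 0ℤ) :+ :- q :* k :* (:- q′ :* e)
            := (r :+ k :* e) :+ (q :* q′ :* (k :* e) :- k :* e)) refl q q⁻¹ r (κ st) e) ⟩
    r + κ st * e ≈⟨ comb-kernel (c ∘ down) st I J ⟩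
    0#           ∎
    where
    r = raise (λ st → comb (c ∘ down) st I J) st
    e = E (comb (c ∘ down) st) I J
  closing-false-kernel c (false ∷ st) I J = trans
    (+-cong (raise-0 (λ _ → refl) st) (*-congˡ (trans (*-congˡ (E-zero (λ _ _ → refl) I J)) (zeroʳ _))))
    (trans (+-identityˡ _) (zeroʳ _))

  E^ : ℕ → Tensor N → Tensor N
  E^ zero    u = u
  E^ (suc r) u = E (E^ r u)

  E^-cong : ∀ r {u w : Tensor N} → (∀ I J → u I J ≈ w I J) → ∀ I J → E^ r u I J ≈ E^ r w I J
  E^-cong zero    u≈w = u≈w
  E^-cong (suc r) u≈w = E-cong (E^-cong r u≈w)

  E^-linear : ∀ r a (u w : Tensor N) I J → E^ r (λ I J → u I J + a * w I J) I J ≈ E^ r u I J + a * E^ r w I J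
  E^-linear zero    a u w I J = refl
  E^-linear (suc r) a u w I J = trans (E-cong (E^-linear r a u w) I J) (E-linear a (E^ r u) (E^ r w) I J)

  E^-zero : ∀ r {u : Tensor N} → (∀ I J → u I J ≈ 0#) → ∀ I J → E^ r u I J ≈ 0#
  E^-zero zero    u≈0 = u≈0
  E^-zero (suc r) u≈0 = E-zero (E^-zero r u≈0)

  E^-suc : ∀ r (u : Tensor N) I J → E^ (suc r) u I J ≈ E^ r (E u) I J
  E^-suc zero    u I J = refl
  E^-suc (suc r) u I J = E-cong (E^-suc r u) I J

  E^-* : ∀ r a (u : Tensor N) I J → E^ r (λ I J → a * u I J) I J ≈ a * E^ r u I J
  E^-* zero    a u I J = refl
  E^-* (suc r) a u I J = trans (E-cong (E^-* r a u) I J) (E-* a (E^ r u) I J)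

  raise-E^ : ∀ r (u : Vec Bool h → Tensor N) st I J →
    E^ r (λ I J → raise (λ st → u st I J) st) I J ≈ raise (λ st → E^ r (u st) I J) st
  raise-E^ r u []           I J = E^-zero r (λ _ _ → refl) I J
  raise-E^ r u (true ∷ st)  I J = trans
    (E^-linear r (κ st) (λ I J → raise (λ st → u (true ∷ st) I J) st) (u (false ∷ st)) I J)
    (+-congʳ (raise-E^ r (u ∘ (true ∷_)) st I J))
  raise-E^ r u (false ∷ st) I J = raise-E^ r (u ∘ (false ∷_)) st I J

  -- `comb-kernel` trades one E on the suffix for one `raise` on the stack, which reads only stacks
  -- with one `true` less. After r steps no `true` is left to be changed.
  comb-E^ : ∀ (c : Word h N → Carrier) r st → trues st ≡ r → ∀ I J → E^ (suc r) (comb c st) I J ≈ 0#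
  comb-E^ c r st ≡r I J = trans (E^-suc r (comb c st) I J) (cancel-zero (κ-invertible st) (begin
    κ st * E^ r (E (comb c st)) I J                                   ≈⟨ E^-* r (κ st) (E (comb c st)) I J ⟨
    E^ r (λ I J → κ st * E (comb c st) I J) I J                       ≈⟨ E^-cong r {w = λ I J → - 1# * raise (λ st → comb c st I J) st} (λ I J → negate (comb-kernel c st I J)) I J ⟩
    E^ r (λ I J → - 1# * raise (λ st → comb c st I J) st) I J         ≈⟨ E^-* r (- 1#) (λ I J → raise (λ st → comb c st I J) st) I J ⟩
    - 1# * E^ r (λ I J → raise (λ st → comb c st I J) st) I J         ≈⟨ *-congˡ (raise-E^ r (comb c) st I J) ⟩
    - 1# * raise (λ st → E^ r (comb c st) I J) st                     ≈⟨ *-congˡ (raise-zero st (below r ≡r)) ⟩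
    - 1# * 0#                                                         ≈⟨ zeroʳ _ ⟩
    0#                                                                ∎))
    where
    negate : ∀ {x y} → x + y ≈ 0# → y ≈ - 1# * x
    negate {x} {y} x+y≈0 = begin
      y             ≈⟨ solve 2 (λ x y → y := (x :+ y) :+ :- x) refl x y ⟩
      (x + y) - x   ≈⟨ trans (+-congʳ x+y≈0) (+-identityˡ _) ⟩
      - x           ≈⟨ -1*x≈-x x ⟨
      - 1# * x      ∎
    below : ∀ r → trues st ≡ r → ∀ st′ → suc (trues st′) ≡ trues st → E^ r (comb c st′) I J ≈ 0#
    below zero    e st′ e′ with () ← ≡.trans e′ e
    below (suc r) e st′ e′ = comb-E^ c r st′ (ℕ.suc-injective (≡.trans e′ e)) I J

  -- γ r = (-1)^r [r + 1]
  γ : ℕ → Carrier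
  γ zero    = 1#
  γ (suc r) = (- q⁻¹) ^ suc r + - q * γ r

  -- Multiplied by (- q)^r, it becomes the nonzero polynomial 1 + q² + ... + q^(2r).
  γ-invertible : ∀ r → Invertible (γ r)
  γ-invertible r = invertible-factor (γ≈evens r) (invert (evens r) (evens-nonZero r))
    where
    unit : ∀ r → (- q) ^ r * (- q⁻¹) ^ r ≈ 1#
    unit zero    = *-identityˡ 1#
    unit (suc r) = trans (solve 4 (λ q q′ x y → :- q :* x :* (:- q′ :* y) := q :* q′ :* (x :* y)) refl q q⁻¹ _ _)
      (trans (*-cong q*q⁻¹≈1 (unit r)) (*-identityˡ 1#))
    γ≈evens : ∀ r → (- q) ^ r * γ r ≈ ⟦_⟧ q (evens r)
    γ≈evens zero    = trans (*-identityˡ 1#) (sym (eval-X q 0))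
    γ≈evens (suc r) = begin
      (- q) ^ suc r * ((- q⁻¹) ^ suc r + - q * γ r)
        ≈⟨ solve 4 (λ q x y g → :- q :* x :* (y :+ :- q :* g) := :- q :* x :* y :+ q :* (q :* (x :* g))) refl q _ _ _ ⟩
      (- q) ^ suc r * (- q⁻¹) ^ suc r + q * (q * ((- q) ^ r * γ r))
        ≈⟨ +-cong (trans (unit (suc r)) (sym (+-identityʳ 1#))) (*-congˡ (trans (*-congˡ (γ≈evens r)) (sym (+-identityˡ _)))) ⟩
      ⟦_⟧ q (evens (suc r)) ∎

  E^-true-true : ∀ r (u : Tensor (suc N)) I J → E^ r u (true ∷ I) (true ∷ J) ≈ E^ r (restrict u true true) I J
  E^-true-true zero    u I J = refl
  E^-true-true (suc r) u I J = E-cong (E^-true-true r u) I J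

  E^-false-false : ∀ r (u : Tensor (suc N)) I J → E^ r u (false ∷ I) (false ∷ J) ≈ E^ r (restrict u false false) I J
  E^-false-false zero    u I J = refl
  E^-false-false (suc r) u I J = E-cong (E^-false-false r u) I J

  E^-false-true : ∀ r (u : Tensor (suc N)) I J →
    E^ r u (false ∷ I) (true ∷ J) ≈ (- q⁻¹) ^ r * E^ r (restrict u false true) I J
  E^-false-true zero    u I J = sym (*-identityˡ _)
  E^-false-true (suc r) u I J = begin
    - q⁻¹ * E (restrict (E^ r u) false true) I J                                ≈⟨ *-congˡ (E-cong (E^-false-true r u) I J) ⟩
    - q⁻¹ * E (λ I J → (- q⁻¹) ^ r * E^ r (restrict u false true) I J) I J      ≈⟨ *-congˡ (E-* _ (E^ r (restrict u false true)) I J) ⟩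
    - q⁻¹ * ((- q⁻¹) ^ r * E^ (suc r) (restrict u false true) I J)              ≈⟨ *-assoc _ _ _ ⟨
    (- q⁻¹) ^ suc r * E^ (suc r) (restrict u false true) I J                    ∎

  -- The q-binomial expansion of a power of the coproduct of E. The first letter spans a
  -- two-dimensional representation and is raised at most once, so two terms survive; the number of
  -- moments at which it can be raised becomes the quantum integer γ r.
  E^-true-false : ∀ r (u : Tensor (suc N)) I J →
    E^ (suc r) u (true ∷ I) (false ∷ J)
      ≈ γ r * E^ r (restrict u false true) I J + (- q) ^ suc r * E^ (suc r) (restrict u true false) I J
  E^-true-false zero    u I J = +-cong (sym (*-identityˡ _)) (*-congʳ (sym (*-identityʳ _)))
  E^-true-false (suc r) u I J = begin
    E^ (suc r) u (false ∷ I) (true ∷ J) + - q * E (restrict (E^ (suc r) u) true false) I J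
      ≈⟨ +-cong (E^-false-true (suc r) u I J) (*-congˡ (E-cong {w = λ I J → g * x I J + p * y I J} (E^-true-false r u) I J)) ⟩
    (- q⁻¹) ^ suc r * E x I J + - q * E (λ I J → g * x I J + p * y I J) I J
      ≈⟨ +-congˡ (*-congˡ (trans (E-linear p (λ I J → g * x I J) y I J) (+-congʳ (E-* g x I J)))) ⟩
    (- q⁻¹) ^ suc r * E x I J + - q * (g * E x I J + p * E y I J)
      ≈⟨ solve 6 (λ z q g p x y → z :* x :+ :- q :* (g :* x :+ p :* y) := (z :+ :- q :* g) :* x :+ :- q :* p :* y) refl _ q g p _ _ ⟩
    γ (suc r) * E x I J + (- q) ^ suc (suc r) * E y I J ∎
    where
    g = γ r
    p = (- q) ^ suc r
    x = E^ r (restrict u false true)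
    y = E^ (suc r) (restrict u true false)

  -- The stack at which expansions are taken, with all pending openers in I. Modulo q, C_w is
  -- concentrated there at the pair of columns of w.
  ones : ∀ h → Vec Bool h
  ones h = replicate h true

  trues-ones : ∀ h → trues (ones h) ≡ h
  trues-ones zero    = ≡.refl
  trues-ones (suc h) = ≡.cong suc (trues-ones h)

  closing-true-ones : ∀ h (c : Word h (suc N) → Carrier) I J → closing true c (ones h) I J ≈ 0#
  closing-true-ones zero    c I J = refl
  closing-true-ones (suc h) c I J = refl

  HasWeight : ℕ → Tensor N → Set ℓ
  HasWeight h y = ∀ I J → ∣ J ∣ ≢ h ℕ.+ ∣ I ∣ → y I J ≈ 0#

  falses : Vec Bool h → ℕ
  falses []           = 0
  falses (true ∷ st)  = falses st
  falses (false ∷ st) = suc (falses st)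

  falses-ones : ∀ h → falses (ones h) ≡ 0
  falses-ones zero    = ≡.refl
  falses-ones (suc h) = falses-ones h

  -- A complete word puts as many elements into I as into J; a pending opener counts for I if its
  -- entry is `true` and for J if it is `false`.
  comb-weight : ∀ (c : Word h N → Carrier) st I J →
    ∣ J ∣ ℕ.+ falses st ≢ ∣ I ∣ ℕ.+ trues st → comb c st I J ≈ 0#
  closing-weight : ∀ a (c : Word h (suc N) → Carrier) st I J →
    ∣ not a ∷ J ∣ ℕ.+ falses st ≢ ∣ a ∷ I ∣ ℕ.+ trues st → closing a c st I J ≈ 0#
  comb-weight c []      [] [] ne = ⊥-elim (ne ≡.refl)
  comb-weight c (_ ∷ _) [] [] ne = refl
  comb-weight c st (false ∷ I) (false ∷ J) ne = comb-weight (c ∘ none) st I J ne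
  comb-weight c st (true ∷ I)  (true ∷ J)  ne = comb-weight (c ∘ both) st I J (ne ∘ ≡.cong suc)
  comb-weight c st (true ∷ I)  (false ∷ J) ne = trans
    (+-cong (comb-weight (c ∘ up) (true ∷ st) I J λ e → ne (≡.trans e (ℕ.+-suc ∣ I ∣ _))) (closing-weight true c st I J ne))
    (+-identityʳ 0#)
  comb-weight c st (false ∷ I) (true ∷ J)  ne = trans
    (+-cong (comb-weight (c ∘ up) (false ∷ st) I J λ e → ne (≡.trans (≡.sym (ℕ.+-suc ∣ J ∣ _)) e)) (closing-weight false c st I J ne))
    (+-identityʳ 0#)
  closing-weight a     c []           I J ne = refl
  closing-weight true  c (false ∷ st) I J ne =
    trans (*-congˡ (comb-weight (c ∘ down) st I J λ e → ne (≡.trans (ℕ.+-suc ∣ J ∣ _) (≡.cong suc e)))) (zeroʳ q)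
  closing-weight false c (true ∷ st)  I J ne =
    comb-weight (c ∘ down) st I J λ e → ne (≡.trans (≡.cong suc e) (≡.sym (ℕ.+-suc ∣ I ∣ _)))
  closing-weight true  c (true ∷ st)  I J ne = refl
  closing-weight false c (false ∷ st) I J ne = refl

  comb-polynomial : ∀ {c : Word h N → Carrier} → (∀ w → Polynomial (c w)) → ∀ st I J → Polynomial (comb c st I J)
  closing-polynomial : ∀ a {c : Word h (suc N) → Carrier} → (∀ w → Polynomial (c w)) → ∀ st I J → Polynomial (closing a c st I J)
  comb-polynomial p []      []          []          = p []
  comb-polynomial p (_ ∷ _) []          []          = Polynomial-0
  comb-polynomial p st      (false ∷ I) (false ∷ J) = comb-polynomial (p ∘ none) st I J
  comb-polynomial p st      (true ∷ I)  (true ∷ J)  = comb-polynomial (p ∘ both) st I J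
  comb-polynomial p st      (true ∷ I)  (false ∷ J) = Polynomial-+ (comb-polynomial (p ∘ up) _ I J) (closing-polynomial true p st I J)
  comb-polynomial p st      (false ∷ I) (true ∷ J)  = Polynomial-+ (comb-polynomial (p ∘ up) _ I J) (closing-polynomial false p st I J)
  closing-polynomial a     p []           I J = Polynomial-0
  closing-polynomial true  p (false ∷ st) I J = Polynomial-* Polynomial-q (comb-polynomial (p ∘ down) st I J)
  closing-polynomial false p (true ∷ st)  I J = comb-polynomial (p ∘ down) st I J
  closing-polynomial true  p (true ∷ st)  I J = Polynomial-0
  closing-polynomial false p (false ∷ st) I J = Polynomial-0

  upOnly : (Word (suc h) N → Carrier) → Word h (suc N) → Carrier
  upOnly c (none w) = 0#
  upOnly c (both w) = 0#
  upOnly c (up w)   = c w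
  upOnly c (down w) = 0#

  closing-false-upOnly : ∀ h (c : Word (suc h) N → Carrier) I J → closing false (upOnly c) (ones h) I J ≈ 0#
  closing-false-upOnly zero    c I J = refl
  closing-false-upOnly (suc h) c I J = comb-zero (λ _ → refl) (ones h) I J

  private
    x-x≈0 : ∀ {x y} → x ≈ y → x + - 1# * y ≈ 0#
    x-x≈0 {x} {y} x≈y = trans (+-cong x≈y (-1*x≈-x y)) (-‿inverseʳ y)

    x≈y+[x-y] : ∀ x y → x ≈ y + (x + - 1# * y)
    x≈y+[x-y] x y = trans (solve 2 (λ x y → x := y :+ (x :- y)) refl x y) (+-congˡ (+-congˡ (sym (-1*x≈-x y))))

  Expansion : ∀ h → Tensor N → Set _
  Expansion {N} h y = ∃ λ (c : Word h N → Carrier) → (∀ w → Polynomial (c w)) × (∀ I J → y I J ≈ comb c (ones h) I J)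

  -- What the words beginning with `down` have to account for, given the
  -- coefficients of the words beginning with `up`.
  remainder : Tensor (suc N) → (Word (suc h) N → Carrier) → Tensor N
  remainder {h = h} y c I J = y (false ∷ I) (true ∷ J) + - 1# * comb c (false ∷ ones h) I J

  -- Once the words beginning with `up` are subtracted, the restriction to (true, false) vanishes.
  -- Of the two terms of `E^-true-false` only γ h times E^h of the restriction to (false, true)
  -- remains, and γ h is invertible.
  remainder-kernel : ∀ h (y : Tensor (suc N)) → (∀ I J → E^ (suc h) y I J ≈ 0#) →
    (x : Expansion (suc h) (restrict y true false)) → ∀ I J → E^ h (remainder y (proj₁ x)) I J ≈ 0#
  remainder-kernel {N} h y ker (c₊ , _ , e₊) I J = trans
    (E^-cong h {w = restrict y′ false true}
      (λ I J → +-congˡ (*-congˡ (sym (trans (+-congˡ (closing-false-upOnly h c₊ I J)) (+-identityʳ _))))) I J)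
    (cancel-zero (γ-invertible h) (begin
      γ h * E^ h (restrict y′ false true) I J
        ≈⟨ trans (+-congˡ (trans (*-congˡ (E^-zero (suc h) y′-true-false I J)) (zeroʳ _))) (+-identityʳ _) ⟨
      γ h * E^ h (restrict y′ false true) I J + (- q) ^ suc h * E^ (suc h) (restrict y′ true false) I J
        ≈⟨ E^-true-false h y′ I J ⟨
      E^ (suc h) y′ (true ∷ I) (false ∷ J)
        ≈⟨ y′-kernel (true ∷ I) (false ∷ J) ⟩
      0# ∎))
    where
    y′ : Tensor (suc N)
    y′ I J = y I J + - 1# * comb (upOnly c₊) (ones h) I J
    y′-kernel : ∀ I J → E^ (suc h) y′ I J ≈ 0#
    y′-kernel I J = trans (E^-linear (suc h) (- 1#) y (comb (upOnly c₊) (ones h)) I J)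
      (trans (+-cong (ker I J) (*-congˡ (comb-E^ (upOnly c₊) h (ones h) (trues-ones h) I J)))
        (trans (+-identityˡ _) (zeroʳ _)))
    y′-true-false : ∀ I J → y′ (true ∷ I) (false ∷ J) ≈ 0#
    y′-true-false I J = x-x≈0 (trans (e₊ I J)
      (sym (trans (+-congˡ (closing-true-ones h (upOnly c₊) I J)) (+-identityʳ _))))

  remainder-weight : ∀ h (y : Tensor (suc N)) → HasWeight (suc h) y → (c : Word (suc (suc h)) N → Carrier) →
    HasWeight h (remainder y c)
  remainder-weight h y wt c I J ne = trans
    (+-cong (wt _ _ (ne ∘ ℕ.suc-injective)) (*-congˡ (comb-weight c (false ∷ ones (suc h)) I J (ne ∘ weight))))
    (trans (+-identityˡ _) (zeroʳ _))
    where
    weight : ∣ J ∣ ℕ.+ suc (falses (ones h)) ≡ ∣ I ∣ ℕ.+ suc (trues (ones h)) → ∣ J ∣ ≡ h ℕ.+ ∣ I ∣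
    weight e rewrite falses-ones h | trues-ones h | ℕ.+-suc ∣ J ∣ 0 | ℕ.+-suc ∣ I ∣ h | ℕ.+-identityʳ ∣ J ∣ =
      ≡.trans (ℕ.suc-injective e) (ℕ.+-comm ∣ I ∣ h)

  downOnly : (Word h (suc N) → Carrier) → Word h (suc N) → Carrier
  downOnly d (none w) = 0#
  downOnly d (both w) = 0#
  downOnly d (up w)   = 0#
  downOnly d (down w) = d (down w)

  closing-downOnly : ∀ {c d : Word h (suc N) → Carrier} → (∀ w → downOnly c w ≈ downOnly d w) →
    ∀ st I J → closing false c st I J ≈ closing false d st I J
  closing-downOnly c≈d []           I J = refl
  closing-downOnly c≈d (true ∷ st)  I J = comb-cong (c≈d ∘ down) st I J
  closing-downOnly c≈d (false ∷ st) I J = refl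

  -- Only the coefficients of words beginning with `down` matter. Indexing by all words keeps the
  -- form meaningful for h = 0, where there are no such words and the condition says that z
  -- vanishes.
  RemainderExpansion : ∀ h → Tensor N → Set _
  RemainderExpansion {N} h z = ∃ λ (d : Word h (suc N) → Carrier) →
    (∀ w → Polynomial (d w)) × (∀ I J → z I J ≈ closing false d (ones h) I J)

  assemble : ∀ h (y : Tensor (suc N)) → Expansion h (restrict y false false) → Expansion h (restrict y true true) →
    (x₊ : Expansion (suc h) (restrict y true false)) → RemainderExpansion h (remainder y (proj₁ x₊)) → Expansion h y
  assemble {N} h y (c₀ , p₀ , e₀) (c₂ , p₂ , e₂) (c₊ , p₊ , e₊) (d , p₋ , e₋) = coefficient , poly , expand
    where
    coefficient : Word h (suc N) → Carrier
    coefficient (none w)   = c₀ w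
    coefficient (both w)   = c₂ w
    coefficient (up w)     = c₊ w
    coefficient (down w)   = d (down w)
    poly : ∀ w → Polynomial (coefficient w)
    poly (none w) = p₀ w
    poly (both w) = p₂ w
    poly (up w)   = p₊ w
    poly (down w) = p₋ (down w)
    agree : ∀ w → downOnly d w ≈ downOnly coefficient w
    agree (none w) = refl
    agree (both w) = refl
    agree (up w)   = refl
    agree (down w) = refl
    expand : ∀ I J → y I J ≈ comb coefficient (ones h) I J
    expand (false ∷ I) (false ∷ J) = e₀ I J
    expand (true ∷ I)  (true ∷ J)  = e₂ I J
    expand (true ∷ I)  (false ∷ J) = trans (e₊ I J) (sym (trans (+-congˡ (closing-true-ones h coefficient I J)) (+-identityʳ _)))
    expand (false ∷ I) (true ∷ J)  =
      trans (x≈y+[x-y] _ _) (+-congˡ (trans (e₋ I J) (closing-downOnly agree (ones h) I J)))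

  -- Induction on the letters, by the bits of the first one. Equal bits keep h. The restriction to
  -- (true, false) satisfies the hypotheses for h + 1 and yields the coefficients of `up`; the
  -- remainder at (false, true) satisfies them for h - 1 and yields those of `down`.
  span : ∀ N h (y : Tensor N) → HasWeight h y → (∀ I J → E^ (suc h) y I J ≈ 0#) → (∀ I J → Polynomial (y I J)) →
         Expansion h y
  span zero zero    y wt ker poly = (λ _ → y [] []) , (λ _ → poly [] []) , λ { [] [] → refl }
  -- No word of positive height is empty, and the weight condition forces y to be 0.
  span zero (suc h) y wt ker poly = (λ ()) , (λ ()) , λ { [] [] → wt [] [] λ () }
  span (suc N) h y wt ker poly = assemble h y
    (span N h (restrict y false false) (λ I J ne → wt _ _ ne)
      (λ I J → trans (sym (E^-false-false (suc h) y I J)) (ker (false ∷ I) (false ∷ J))) (λ _ _ → poly _ _))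
    (span N h (restrict y true true)
      (λ I J ne → wt _ _ λ e → ne (ℕ.suc-injective (≡.trans e (ℕ.+-suc h _))))
      (λ I J → trans (sym (E^-true-true (suc h) y I J)) (ker (true ∷ I) (true ∷ J))) (λ _ _ → poly _ _))
    x₊ (rest h wt x₊ (remainder-kernel h y ker x₊))
    where
    kernel-false-true : ∀ I J → E^ (suc h) (restrict y false true) I J ≈ 0#
    kernel-false-true I J = cancel-zero
      (invertible-^ (- q , trans (solve 2 (λ x y → :- y :* :- x := x :* y) refl q q⁻¹) q*q⁻¹≈1) (suc h))
      (trans (sym (E^-false-true (suc h) y I J)) (ker (false ∷ I) (true ∷ J)))
    kernel-true-false : ∀ I J → E^ (suc (suc h)) (restrict y true false) I J ≈ 0#
    kernel-true-false I J = cancel-zero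
      (invertible-^ (- q⁻¹ , trans (solve 2 (λ x y → :- x :* :- y := x :* y) refl q q⁻¹) q*q⁻¹≈1) (suc (suc h))) (begin
        (- q) ^ suc (suc h) * E^ (suc (suc h)) (restrict y true false) I J
          ≈⟨ +-identityˡ _ ⟨
        0# + (- q) ^ suc (suc h) * E^ (suc (suc h)) (restrict y true false) I J
          ≈⟨ +-congʳ (trans (*-congˡ (kernel-false-true I J)) (zeroʳ _)) ⟨
        γ (suc h) * E^ (suc h) (restrict y false true) I J + (- q) ^ suc (suc h) * E^ (suc (suc h)) (restrict y true false) I J
          ≈⟨ E^-true-false (suc h) y I J ⟨
        E^ (suc (suc h)) y (true ∷ I) (false ∷ J)
          ≈⟨ E-zero ker (true ∷ I) (false ∷ J) ⟩
        0# ∎)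
    x₊ : Expansion (suc h) (restrict y true false)
    x₊ = span N (suc h) (restrict y true false)
      (λ I J ne → wt _ _ λ e → ne (≡.trans e (ℕ.+-suc h _))) kernel-true-false (λ _ _ → poly _ _)
    rest : ∀ h → HasWeight h y → (x₊ : Expansion (suc h) (restrict y true false)) →
      (∀ I J → E^ h (remainder y (proj₁ x₊)) I J ≈ 0#) → RemainderExpansion h (remainder y (proj₁ x₊))
    rest zero    wt x₊ z≈0 = (λ _ → 0#) , (λ _ → Polynomial-0) , z≈0
    rest (suc h) wt x₊ z-ker =
      let c , p , e = span N h (remainder y (proj₁ x₊)) (remainder-weight h y wt (proj₁ x₊)) z-ker λ I J →
            Polynomial-+ (poly _ _) (Polynomial-* (Polynomial-neg Polynomial-1)
              (comb-polynomial (proj₁ (proj₂ x₊)) (false ∷ ones (suc h)) I J))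
      in extend c , extend-polynomial p , e
      where
      extend : (Word h N → Carrier) → Word (suc h) (suc N) → Carrier
      extend c (none w) = 0#
      extend c (both w) = 0#
      extend c (up w)   = 0#
      extend c (down w) = c w
      extend-polynomial : ∀ {c} → (∀ w → Polynomial (c w)) → ∀ w → Polynomial (extend c w)
      extend-polynomial p (none w) = Polynomial-0
      extend-polynomial p (both w) = Polynomial-0
      extend-polynomial p (up w)   = Polynomial-0
      extend-polynomial p (down w) = p w

  -- A pending opener in J is closed by an element of I, and this closing carries a factor q.
  comb-divisible : ∀ {c : Word h N → Carrier} → (∀ w → Polynomial (c w)) → ∀ {st} → VecAny.Any (_≡ false) st → ∀ I J →
    ∃ λ x → Polynomial x × comb c st I J ≈ q * x
  closing-divisible : ∀ a {c : Word h (suc N) → Carrier} → (∀ w → Polynomial (c w)) → ∀ {st} → VecAny.Any (_≡ false) st → ∀ I J →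
    ∃ λ x → Polynomial x × closing a c st I J ≈ q * x
  comb-divisible p {_ ∷ _} st∋false [] [] = 0# , Polynomial-0 , sym (zeroʳ q)
  comb-divisible p st∋false (false ∷ I) (false ∷ J) = comb-divisible (p ∘ none) st∋false I J
  comb-divisible p st∋false (true ∷ I)  (true ∷ J)  = comb-divisible (p ∘ both) st∋false I J
  comb-divisible p st∋false (true ∷ I)  (false ∷ J) =
    let x , px , ex = comb-divisible (p ∘ up) (there {x = true} st∋false) I J
        y , py , ey = closing-divisible true p st∋false I J
    in x + y , Polynomial-+ px py , trans (+-cong ex ey) (sym (distribˡ q x y))
  comb-divisible p st∋false (false ∷ I) (true ∷ J)  =
    let x , px , ex = comb-divisible (p ∘ up) (there {x = false} st∋false) I J
        y , py , ey = closing-divisible false p st∋false I J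
    in x + y , Polynomial-+ px py , trans (+-cong ex ey) (sym (distribˡ q x y))
  closing-divisible true  p {false ∷ st} _                I J = _ , comb-polynomial (p ∘ down) st I J , refl
  closing-divisible false p {true ∷ st}  (there st∋false) I J = comb-divisible (p ∘ down) st∋false I J
  closing-divisible true  p {true ∷ st}  _                I J = 0# , Polynomial-0 , sym (zeroʳ q)
  closing-divisible false p {false ∷ st} _                I J = 0# , Polynomial-0 , sym (zeroʳ q)

  -- Unitriangularity modulo q: along the columns of w, a word that opens where w closes puts an
  -- element of J on the stack, so its contribution is divisible by q.
  comb-leading : ∀ {c : Word h N → Carrier} → (∀ w → Polynomial (c w)) → ∀ w →
    ∃ λ x → Polynomial x × comb c (ones h) (left w) (right w) ≈ c w + q * x
  comb-leading p []       = 0# , Polynomial-0 , sym (trans (+-congˡ (zeroʳ q)) (+-identityʳ _))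
  comb-leading p (none w) = comb-leading (p ∘ none) w
  comb-leading p (both w) = comb-leading (p ∘ both) w
  comb-leading {h} {c = c} p (up w) =
    let x , px , ex = comb-leading (p ∘ up) w in
    x , px , trans (+-congˡ (closing-true-ones h c _ _)) (trans (+-identityʳ _) ex)
  comb-leading {suc h} {c = c} p (down w) =
    let x , px , ex = comb-leading (p ∘ down) w
        y , py , ey = comb-divisible (p ∘ up) (here {xs = ones (suc h)} ≡.refl) (left w) (right w)
    in y + x , Polynomial-+ py px , trans (+-cong ey ex)
         (solve 4 (λ q c x y → q :* y :+ (c :+ q :* x) := c :+ q :* (y :+ x)) refl q _ x y)

  up-agree : ∀ {c d : Word h (suc N) → Carrier} →
    (∀ I J → ∣ J ∣ ≡ h ℕ.+ ∣ I ∣ → comb c (ones h) I J ≈ comb d (ones h) I J) →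
    ∀ I J → ∣ J ∣ ≡ suc h ℕ.+ ∣ I ∣ → comb (c ∘ up) (ones (suc h)) I J ≈ comb (d ∘ up) (ones (suc h)) I J
  up-agree {h} {c = c} {d} c≈d I J e = begin
    comb (c ∘ up) (ones (suc h)) I J                                ≈⟨ trans (+-congˡ (closing-true-ones h c I J)) (+-identityʳ _) ⟨
    comb (c ∘ up) (ones (suc h)) I J + closing true c (ones h) I J  ≈⟨ c≈d (true ∷ I) (false ∷ J) (≡.trans e (≡.sym (ℕ.+-suc h _))) ⟩
    comb (d ∘ up) (ones (suc h)) I J + closing true d (ones h) I J  ≈⟨ trans (+-congˡ (closing-true-ones h d I J)) (+-identityʳ _) ⟩
    comb (d ∘ up) (ones (suc h)) I J                                ∎

  -- Linear independence, triangular in the first letter: coordinates beginning with (true, false)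
  -- see only the words beginning with `up`, and once these coefficients agree, those beginning with
  -- (false, true) isolate the words beginning with `down`.
  comb-injective : ∀ {c d : Word h N → Carrier} →
    (∀ I J → ∣ J ∣ ≡ h ℕ.+ ∣ I ∣ → comb c (ones h) I J ≈ comb d (ones h) I J) → ∀ w → c w ≈ d w
  comb-injective c≈d []       = c≈d [] [] ≡.refl
  comb-injective c≈d (none w) = comb-injective (λ I J e → c≈d (false ∷ I) (false ∷ J) e) w
  comb-injective {h} c≈d (both w) = comb-injective (λ I J e → c≈d (true ∷ I) (true ∷ J)
    (≡.trans (≡.cong suc e) (≡.sym (ℕ.+-suc h _)))) w
  comb-injective c≈d (up w)   = comb-injective (up-agree c≈d) w
  comb-injective {suc h} {c = c} {d} c≈d (down w) = comb-injective (λ I J e → +-cancelˡ _ _ _ (begin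
    comb (c ∘ up) (false ∷ ones (suc h)) I J + comb (c ∘ down) (ones h) I J  ≈⟨ c≈d (false ∷ I) (true ∷ J) (≡.cong suc e) ⟩
    comb (d ∘ up) (false ∷ ones (suc h)) I J + comb (d ∘ down) (ones h) I J  ≈⟨ +-congʳ (comb-cong (comb-injective (up-agree c≈d)) (false ∷ ones (suc h)) I J) ⟨
    comb (c ∘ up) (false ∷ ones (suc h)) I J + comb (d ∘ down) (ones h) I J  ∎)) w

  private
    -- A closing letter removes one pending opener and one place where I and J differ, so the
    -- exponent m drops by one.
    halve : ∀ {m a} b → m ℕ.+ m ≡ suc a ℕ.+ suc b → ∃ λ m′ → m ≡ suc m′ × m′ ℕ.+ m′ ≡ a ℕ.+ b
    halve {suc m} {a} b e = m , ≡.refl ,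
      ℕ.suc-injective (ℕ.suc-injective (≡.trans (≡.cong suc (≡.sym (ℕ.+-suc m m))) (≡.trans e (≡.cong suc (ℕ.+-suc a b)))))

  -- Applying q ↦ q⁻¹ and exchanging I and J multiplies C_w by a power of q, which
  -- does not depend on w.
  comb-bar : ∀ {c c̄ : Word h N → Carrier} → (∀ w → BarScalar (c w) (c̄ w)) → ∀ st I J m →
    m ℕ.+ m ≡ distance I J ℕ.+ h → ∃ λ y → BarScalar (comb c st I J) y × q ^ m * y ≈ comb c̄ (Vec.map not st) J I
  closing-bar : ∀ a {c c̄ : Word h (suc N) → Carrier} → (∀ w → BarScalar (c w) (c̄ w)) → ∀ st I J m →
    m ℕ.+ m ≡ suc (distance I J) ℕ.+ h →
    ∃ λ y → BarScalar (closing a c st I J) y × q ^ m * y ≈ closing (not a) c̄ (Vec.map not st) J I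
  comb-bar b []      []          []          zero e = _ , b [] , *-identityˡ _
  comb-bar b (_ ∷ _) []          []          m    e = 0# , BarScalar-0 , zeroʳ _
  comb-bar b st      (false ∷ I) (false ∷ J) m    e = comb-bar (b ∘ none) st I J m e
  comb-bar b st      (true ∷ I)  (true ∷ J)  m    e = comb-bar (b ∘ both) st I J m e
  comb-bar b st      (true ∷ I)  (false ∷ J) m    e =
    let x , bx , ex = comb-bar (b ∘ up) (true ∷ st) I J m (≡.trans e (≡.sym (ℕ.+-suc (distance I J) _)))
        y , by , ey = closing-bar true b st I J m e
    in x + y , BarScalar-sum bx by , trans (distribˡ _ x y) (+-cong ex ey)
  comb-bar b st      (false ∷ I) (true ∷ J)  m    e =
    let x , bx , ex = comb-bar (b ∘ up) (false ∷ st) I J m (≡.trans e (≡.sym (ℕ.+-suc (distance I J) _)))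
        y , by , ey = closing-bar false b st I J m e
    in x + y , BarScalar-sum bx by , trans (distribˡ _ x y) (+-cong ex ey)
  closing-bar true  b []           I J m e = 0# , BarScalar-0 , zeroʳ _
  closing-bar false b []           I J m e = 0# , BarScalar-0 , zeroʳ _
  closing-bar true  b (true ∷ st)  I J m e = 0# , BarScalar-0 , zeroʳ _
  closing-bar false b (false ∷ st) I J m e = 0# , BarScalar-0 , zeroʳ _
  closing-bar {suc h} true b (false ∷ st) I J m e with halve {m} h e
  ... | m′ , ≡.refl , e′ =
    let x , bx , ex = comb-bar (b ∘ down) st I J m′ e′ in
    q⁻¹ * x , BarScalar-product BarScalar-q bx , trans (by-unit (q ^ m′ * x)
      (solve 4 (λ q q′ z x → q :* z :* (q′ :* x) := z :* x :+ (q :* q′ :* (z :* x) :- z :* x)) refl q q⁻¹ (q ^ m′) x)) ex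
  closing-bar {suc h} false b (true ∷ st) I J m e with halve {m} h e
  ... | m′ , ≡.refl , e′ =
    let x , bx , ex = comb-bar (b ∘ down) st I J m′ e′ in
    x , bx , trans (*-assoc q _ x) (*-congˡ ex)

  q^? : Maybe ℕ → Carrier
  q^? nothing  = 0#
  q^? (just m) = q ^ m

  private
    q^?-suc : ∀ m → q * q^? m ≈ q^? (Maybe.map suc m)
    q^?-suc nothing  = zeroʳ q
    q^?-suc (just m) = refl

  IsIndicator : Word h N → (Word h N → Carrier) → Set ℓ
  IsIndicator w c = c w ≈ 1# × (∀ w′ → w′ ≢ w → c w′ ≈ 0#)

  comb-indicator : ∀ w {c : Word h N → Carrier} → IsIndicator w c → ∀ st I J → comb c st I J ≈ q^? (exponent w st I J)
  comb-indicator {h} {N} w₀ {c} ind = go w₀ ind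
    where
    zero+ : ∀ {x y z} → x ≈ 0# → y ≈ z → x + y ≈ z
    zero+ x≈0 y≈z = trans (+-cong x≈0 y≈z) (+-identityˡ _)
    +zero : ∀ {x y z} → x ≈ z → y ≈ 0# → x + y ≈ z
    +zero x≈z y≈0 = trans (+-cong x≈z y≈0) (+-identityʳ _)
    closing-vanishes : ∀ {h N} a {c : Word h (suc N) → Carrier} → (∀ w → downOnly c w ≈ 0#) → ∀ st I J → closing a c st I J ≈ 0#
    closing-vanishes a     c≈0 []           I J = refl
    closing-vanishes true  c≈0 (false ∷ st) I J = trans (*-congˡ (comb-zero (c≈0 ∘ down) st I J)) (zeroʳ q)
    closing-vanishes false c≈0 (true ∷ st)  I J = comb-zero (c≈0 ∘ down) st I J
    closing-vanishes true  c≈0 (true ∷ st)  I J = refl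
    closing-vanishes false c≈0 (false ∷ st) I J = refl
    -- `down w′` has positive height, so comparing it with `w` requires transport along an equation
    -- between heights.
    no-down : ∀ {h N} {w : Word h (suc N)} {c} → IsIndicator w c →
      (∀ {h′} (e : h ≡ suc h′) w′ → ≡.subst (λ h → Word h (suc N)) e w ≢ down w′) → ∀ w → downOnly c w ≈ 0#
    no-down ind w≢down (none w) = refl
    no-down ind w≢down (both w) = refl
    no-down ind w≢down (up w)   = refl
    no-down ind w≢down (down w) = proj₂ ind _ λ e → w≢down ≡.refl w (≡.sym e)
    go : ∀ {h N} w {c : Word h N → Carrier} → IsIndicator w c → ∀ st I J → comb c st I J ≈ q^? (exponent w st I J)
    go [] ind [] [] [] = proj₁ ind
    go (none w) ind st (false ∷ I) (false ∷ J) = go w (proj₁ ind , λ w′ ne → proj₂ ind _ (ne ∘ none-injective)) st I J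
    go (none w) ind st (true ∷ I)  (true ∷ J)  = comb-zero (λ w′ → proj₂ ind _ λ ()) st I J
    go (none w) ind st (true ∷ I)  (false ∷ J) = zero+ (comb-zero (λ w′ → proj₂ ind _ λ ()) (true ∷ st) I J)
      (closing-vanishes true (no-down ind λ { ≡.refl w′ () }) st I J)
    go (none w) ind st (false ∷ I) (true ∷ J)  = zero+ (comb-zero (λ w′ → proj₂ ind _ λ ()) (false ∷ st) I J)
      (closing-vanishes false (no-down ind λ { ≡.refl w′ () }) st I J)
    go (both w) ind st (true ∷ I)  (true ∷ J)  = go w (proj₁ ind , λ w′ ne → proj₂ ind _ (ne ∘ both-injective)) st I J
    go (both w) ind st (false ∷ I) (false ∷ J) = comb-zero (λ w′ → proj₂ ind _ λ ()) st I J
    go (both w) ind st (true ∷ I)  (false ∷ J) = zero+ (comb-zero (λ w′ → proj₂ ind _ λ ()) (true ∷ st) I J)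
      (closing-vanishes true (no-down ind λ { ≡.refl w′ () }) st I J)
    go (both w) ind st (false ∷ I) (true ∷ J)  = zero+ (comb-zero (λ w′ → proj₂ ind _ λ ()) (false ∷ st) I J)
      (closing-vanishes false (no-down ind λ { ≡.refl w′ () }) st I J)
    go (up w) ind st (true ∷ I)  (false ∷ J) =
      +zero (go w (proj₁ ind , λ w′ ne → proj₂ ind _ (ne ∘ up-injective)) (true ∷ st) I J)
            (closing-vanishes true (no-down ind λ { ≡.refl w′ () }) st I J)
    go (up w) ind st (false ∷ I) (true ∷ J)  =
      +zero (go w (proj₁ ind , λ w′ ne → proj₂ ind _ (ne ∘ up-injective)) (false ∷ st) I J)
            (closing-vanishes false (no-down ind λ { ≡.refl w′ () }) st I J)
    go (up w) ind st (true ∷ I)  (true ∷ J)  = comb-zero (λ w′ → proj₂ ind _ λ ()) st I J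
    go (up w) ind st (false ∷ I) (false ∷ J) = comb-zero (λ w′ → proj₂ ind _ λ ()) st I J
    go (down w) ind (true ∷ st) (false ∷ I) (true ∷ J) = zero+ (comb-zero (λ w′ → proj₂ ind _ λ ()) (false ∷ true ∷ st) I J)
      (go w (proj₁ ind , λ w′ ne → proj₂ ind _ (ne ∘ down-injective)) st I J)
    go (down w) ind (false ∷ st) (false ∷ I) (true ∷ J) =
      zero+ (comb-zero (λ w′ → proj₂ ind _ λ ()) (false ∷ false ∷ st) I J) refl
    go (down w) ind (false ∷ st) (true ∷ I) (false ∷ J) = zero+ (comb-zero (λ w′ → proj₂ ind _ λ ()) (true ∷ false ∷ st) I J)
      (trans (*-congˡ (go w (proj₁ ind , λ w′ ne → proj₂ ind _ (ne ∘ down-injective)) st I J)) (q^?-suc (exponent w st I J)))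
    go (down w) ind (true ∷ st) (true ∷ I) (false ∷ J) =
      zero+ (comb-zero (λ w′ → proj₂ ind _ λ ()) (true ∷ true ∷ st) I J) refl
    go (down w) ind (true ∷ st)  (true ∷ I)  (true ∷ J)  = comb-zero (λ w′ → proj₂ ind _ λ ()) (true ∷ st) I J
    go (down w) ind (false ∷ st) (true ∷ I)  (true ∷ J)  = comb-zero (λ w′ → proj₂ ind _ λ ()) (false ∷ st) I J
    go (down w) ind (true ∷ st)  (false ∷ I) (false ∷ J) = comb-zero (λ w′ → proj₂ ind _ λ ()) (true ∷ st) I J
    go (down w) ind (false ∷ st) (false ∷ I) (false ∷ J) = comb-zero (λ w′ → proj₂ ind _ λ ()) (false ∷ st) I J

  -- Divided powers of f_i and the integral form.

  double : Fin N → Fin N → Tensor N → Tensor N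
  double lo hi u I J =
    if (not (lookup I lo) ∧ lookup I hi) ∧ (not (lookup J lo) ∧ lookup J hi)
    then u (I ↓[ lo , hi ]) (J ↓[ lo , hi ]) else 0#

  -- e_i in the same style as `lower`; exchanging `hi` and `lo` in the arguments of `act` turns t_i
  -- into t_i⁻¹.
  lift : Fin N → Fin N → Tensor N → Tensor N
  lift lo hi u I J =
    (if lookup I lo ∧ not (lookup I hi) then u (I [ lo ]≔ false [ hi ]≔ true) J else 0#)
    + (if lookup J lo ∧ not (lookup J hi)
       then act (lookup I hi) (lookup I lo) (u I (J [ lo ]≔ false [ hi ]≔ true)) else 0#)

  module _ (i : Node n) where
    open Node i

    adj : Adjacent lo hi
    adj = adjacent⁺ adjacent

    private
      t-act : ∀ J x → t i J * x ≈ act (lookup J lo) (lookup J hi) x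
      t-act J x with lookup J lo | lookup J hi
      ... | true  | true  = *-identityˡ x
      ... | true  | false = refl
      ... | false | true  = refl
      ... | false | false = *-identityˡ x

      t⁻¹-act : ∀ J x → t⁻¹ i J * x ≈ act (lookup J hi) (lookup J lo) x
      t⁻¹-act J x with lookup J lo | lookup J hi
      ... | true  | true  = *-identityˡ x
      ... | true  | false = refl
      ... | false | true  = refl
      ... | false | false = *-identityˡ x

      *-if : ∀ b {x y z} → x * y ≈ z → x * (if b then y else 0#) ≈ (if b then z else 0#)
      *-if true  e = e
      *-if false e = zeroʳ _

    f-lower : ∀ u → f i u ≋ lower lo hi u
    f-lower u I J = +-congʳ (*-if (not (lookup I lo) ∧ lookup I hi) (t-act J _))

    e-lift : ∀ u → ê i u ≋ lift lo hi u
    e-lift u I J = +-congˡ (*-if (lookup J lo ∧ not (lookup J hi)) (t⁻¹-act I _))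

  private
   absorbed : ∀ {x} → 0# + 0# ≈ x * 0#
   absorbed {x} = trans (+-identityʳ 0#) (sym (zeroʳ x))

   lower-lower-base : ∀ (u : Tensor (suc (suc N))) I J →
     lower zero (suc zero) (lower zero (suc zero) u) I J ≈ (q + q⁻¹) * double zero (suc zero) u I J
   lower-lower-base u (false ∷ false ∷ I) (false ∷ false ∷ J) = absorbed
   lower-lower-base u (false ∷ false ∷ I) (false ∷ true ∷ J) =
     solve 2 (λ q q′ → (con 0ℤ :+ (con 0ℤ :+ con 0ℤ)) := (q :+ q′) :* con 0ℤ) refl q q⁻¹
   lower-lower-base u (false ∷ false ∷ I) (true ∷ false ∷ J) = absorbed
   lower-lower-base u (false ∷ false ∷ I) (true ∷ true ∷ J) = absorbed
   lower-lower-base u (false ∷ true ∷ I) (false ∷ false ∷ J) =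
     solve 2 (λ q q′ → ((con 0ℤ :+ con 0ℤ) :+ con 0ℤ) := (q :+ q′) :* con 0ℤ) refl q q⁻¹
   lower-lower-base u (false ∷ true ∷ I) (false ∷ true ∷ J) =
     solve 3 (λ q q′ x₀ → (q′ :* (con 0ℤ :+ x₀) :+ (q :* x₀ :+ con 0ℤ)) := (q :+ q′) :* x₀) refl q q⁻¹ _
   lower-lower-base u (false ∷ true ∷ I) (true ∷ false ∷ J) =
     solve 2 (λ q q′ → (q :* (con 0ℤ :+ con 0ℤ) :+ con 0ℤ) := (q :+ q′) :* con 0ℤ) refl q q⁻¹
   lower-lower-base u (false ∷ true ∷ I) (true ∷ true ∷ J) =
     solve 2 (λ q q′ → ((con 0ℤ :+ con 0ℤ) :+ con 0ℤ) := (q :+ q′) :* con 0ℤ) refl q q⁻¹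
   lower-lower-base u (true ∷ false ∷ I) (false ∷ false ∷ J) = absorbed
   lower-lower-base u (true ∷ false ∷ I) (false ∷ true ∷ J) =
     solve 2 (λ q q′ → (con 0ℤ :+ (con 0ℤ :+ con 0ℤ)) := (q :+ q′) :* con 0ℤ) refl q q⁻¹
   lower-lower-base u (true ∷ false ∷ I) (true ∷ false ∷ J) = absorbed
   lower-lower-base u (true ∷ false ∷ I) (true ∷ true ∷ J) = absorbed
   lower-lower-base u (true ∷ true ∷ I) (false ∷ false ∷ J) = absorbed
   lower-lower-base u (true ∷ true ∷ I) (false ∷ true ∷ J) =
     solve 2 (λ q q′ → (con 0ℤ :+ (con 0ℤ :+ con 0ℤ)) := (q :+ q′) :* con 0ℤ) refl q q⁻¹
   lower-lower-base u (true ∷ true ∷ I) (true ∷ false ∷ J) = absorbed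
   lower-lower-base u (true ∷ true ∷ I) (true ∷ true ∷ J) = absorbed

  -- f_i lowers each factor at most once, so its square lowers both, in two orders with coefficients
  -- q and q⁻¹. Their sum is the quantum integer [2], and `double` is the divided power f_i^(2).
  lower-lower : ∀ {lo hi : Fin N} → Adjacent lo hi → ∀ u I J →
    lower lo hi (lower lo hi u) I J ≈ (q + q⁻¹) * double lo hi u I J
  lower-lower base       u I       J       = lower-lower-base u I J
  lower-lower (step adj) u (a ∷ I) (b ∷ J) = lower-lower adj (restrict u a b) I J

  double-zeroˡ : ∀ (lo hi : Fin N) u I J → lookup I lo ≡ true → double lo hi u I J ≈ 0#
  double-zeroˡ lo hi u I J e rewrite e = refl

  double-zeroʳ : ∀ (lo hi : Fin N) u I J → lookup J lo ≡ true → double lo hi u I J ≈ 0#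
  double-zeroʳ lo hi u I J e rewrite e | Bool.∧-zeroʳ (not (lookup I lo) ∧ lookup I hi) = refl

  lower-double : ∀ {lo hi : Fin N} → Adjacent lo hi → ∀ u I J → lower lo hi (double lo hi u) I J ≈ 0#
  lower-double {lo = lo} {hi} adj u I J = trans (+-cong
    (if-zero (not (lookup I lo) ∧ lookup I hi) λ _ → act-zero (lookup J lo) (lookup J hi) (double-zeroˡ lo hi u _ J (↓-lo adj I)))
    (if-zero (not (lookup J lo) ∧ lookup J hi) λ _ → double-zeroʳ lo hi u I _ (↓-lo adj J))) (+-identityʳ 0#)

  1/[1]≈1 : 1/[1+ 0 ] ≈ 1#
  1/[1]≈1 = trans (*-identityˡ _) (trans (sym (*-identityˡ _))
    (trans (*-congʳ (sym (eval-X q 0))) (proj₂ (invert (evens 0) (evens-nonZero 0)))))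

  1/[2] : 1/[1+ 1 ] * (q + q⁻¹) ≈ 1#
  1/[2] = begin
    q * 1# * y * (q + q⁻¹)
      ≈⟨ *-congʳ (*-congʳ (*-identityʳ q)) ⟩
    q * y * (q + q⁻¹)
      ≈⟨ solve 3 (λ q q′ y → q :* y :* (q :+ q′) := (q :* q′ :+ q :* q) :* y) refl q q⁻¹ y ⟩
    (q * q⁻¹ + q * q) * y
      ≈⟨ *-congʳ (+-congʳ (trans q*q⁻¹≈1 (sym (+-identityʳ 1#)))) ⟩
    ((1# + 0#) + q * q) * y
      ≈⟨ *-congʳ (+-congˡ (*-congˡ (trans (sym (trans (*-congˡ (eval-X q 0)) (*-identityʳ q))) (sym (+-identityˡ _))))) ⟩
    ⟦_⟧ q (evens 1) * y
      ≈⟨ proj₂ (invert (evens 1) (evens-nonZero 1)) ⟩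
    1# ∎
    where y = proj₁ (invert (evens 1) (evens-nonZero 1))

  module _ (i : Node n) where
    open Node i

    f⁽1⁾ : ∀ u → f⁽_⁾ i 1 u ≋ lower lo hi u
    f⁽1⁾ u I J = trans (*-cong 1/[1]≈1 (f-lower i u I J)) (*-identityˡ _)

    f⁽2⁾ : ∀ u → f⁽_⁾ i 2 u ≋ double lo hi u
    f⁽2⁾ u I J = begin
      1/[1+ 1 ] * f i (f⁽_⁾ i 1 u) I J
        ≈⟨ *-congˡ (trans (f-lower i (f⁽_⁾ i 1 u) I J) (lower-cong lo hi (f⁽1⁾ u) I J)) ⟩
      1/[1+ 1 ] * lower lo hi (lower lo hi u) I J
        ≈⟨ *-congˡ (lower-lower (adj i) u I J) ⟩
      1/[1+ 1 ] * ((q + q⁻¹) * double lo hi u I J)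
        ≈⟨ trans (sym (*-assoc _ _ _)) (trans (*-congʳ 1/[2]) (*-identityˡ _)) ⟩
      double lo hi u I J ∎

    f⁽3+_⁾ : ∀ r u → f⁽_⁾ i (suc (suc (suc r))) u ≋ 𝟎
    f⁽3+ r ⁾ u I J = trans (*-congˡ (trans (f-lower i (f⁽_⁾ i (suc (suc r)) u) I J) (vanish r))) (zeroʳ _)
      where
      vanish : ∀ r → lower lo hi (f⁽_⁾ i (suc (suc r)) u) I J ≈ 0#
      vanish zero    = trans (lower-cong lo hi (f⁽2⁾ u) I J) (lower-double (adj i) u I J)
      vanish (suc r) = lower-zero lo hi {f⁽_⁾ i (suc (suc (suc r))) u} (f⁽3+ r ⁾ u) I J

  SupportedOn : ℕ → Tensor N → Set ℓ
  SupportedOn k u = ∀ I J → ∣ I ∣ ≢ k ⊎ ∣ J ∣ ≢ k → u I J ≈ 0#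

  lower-supported : ∀ {lo hi : Fin N} → Adjacent lo hi → ∀ {u} → SupportedOn k u → SupportedOn k (lower lo hi u)
  lower-supported {lo = lo} {hi} adj {u} supp I J ne = trans (+-cong first second) (+-identityʳ 0#)
    where
    first = if-zero (not (lookup I lo) ∧ lookup I hi) λ e → act-zero (lookup J lo) (lookup J hi)
      (supp _ _ (Sum.map₁ (λ ne′ e′ → ne′ (≡.trans (≡.sym (size-↓ adj I e)) e′)) ne))
    second = if-zero (not (lookup J lo) ∧ lookup J hi) λ e →
      supp _ _ (Sum.map₂ (λ ne′ e′ → ne′ (≡.trans (≡.sym (size-↓ adj J e)) e′)) ne)

  -- What the expansion in the C_w uses of the integral form: kernel and support place u in the
  -- span, and Laurent coordinates, together with regularity at 0, make the coefficients
  -- polynomials.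
  record Admissible (u : Tensor n) : Set (c ⊔ ℓ) where
    field
      kernel    : ∀ I J → E u I J ≈ 0#
      supported : SupportedOn k u
      laurent   : ∀ I J → Laurent (u I J)

  private
    supported-resp : ∀ {u w : Tensor n} → u ≋ w → SupportedOn k u → SupportedOn k w
    supported-resp u≋w supp I J ne = trans (sym (u≋w I J)) (supp I J ne)

    supported-scale : ∀ {a} {u : Tensor n} → SupportedOn k u → SupportedOn k (a • u)
    supported-scale supp I J ne = trans (*-congˡ (supp I J ne)) (zeroʳ _)

    act-laurent : ∀ a b {x} → Laurent x → Laurent (act a b x)
    act-laurent true  false p = Laurent-* (polynomial⇒laurent Polynomial-q) p
    act-laurent false true  p = Laurent-* Laurent-q⁻¹ p
    act-laurent true  true  p = p
    act-laurent false false p = p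

    if-laurent : ∀ b {x} → Laurent x → Laurent (if b then x else 0#)
    if-laurent true  p = p
    if-laurent false p = polynomial⇒laurent Polynomial-0

    lower-laurent : ∀ (lo hi : Fin n) {u} → (∀ I J → Laurent (u I J)) → ∀ I J → Laurent (lower lo hi u I J)
    lower-laurent lo hi p I J = Laurent-+
      (if-laurent (not (lookup I lo) ∧ lookup I hi) (act-laurent (lookup J lo) (lookup J hi) (p _ _)))
      (if-laurent (not (lookup J lo) ∧ lookup J hi) (p _ _))

  basis-≢ : ∀ {I J : Subset n} → I ≢ J → basis I J ≈ 0#
  basis-≢ {I} {J} I≢J with I ≟ₛ J
  ... | yes I≡J = ⊥-elim (I≢J I≡J)
  ... | no _    = refl

  basis-≡ : ∀ (I : Subset n) → basis I I ≈ 1#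
  basis-≡ I with I ≟ₛ I
  ... | yes _  = refl
  ... | no I≢I = ⊥-elim (I≢I ≡.refl)

  basis-polynomial : ∀ I J → Polynomial (basis I J)
  basis-polynomial I J with I ≟ₛ J
  ... | yes _ = Polynomial-1
  ... | no _  = Polynomial-0

  v₊-admissible : Admissible (v₊ k)
  v₊-admissible = record
    { kernel    = E-diagonal diagonal
    ; supported = supp
    ; laurent   = λ I J → Laurent-* (polynomial⇒laurent (basis-polynomial (initial n k) I)) (polynomial⇒laurent (basis-polynomial (initial n k) J))
    }
    where
    A = initial n k
    diagonal : ∀ I J → I ≢ J → v₊ k I J ≈ 0#
    diagonal I J I≢J with A ≟ₛ I
    ... | no _       = zeroˡ _
    ... | yes ≡.refl = trans (*-congˡ (basis-≢ I≢J)) (zeroʳ _)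
    supp : SupportedOn k (v₊ k)
    supp I J (inj₁ ne) = trans (*-congʳ (basis-≢ {A} {I} λ A≡I → ne (≡.trans (≡.cong ∣_∣ (≡.sym A≡I)) (∣initial∣ k≤n)))) (zeroˡ _)
    supp I J (inj₂ ne) = trans (*-congˡ (basis-≢ {A} {J} λ A≡J → ne (≡.trans (≡.cong ∣_∣ (≡.sym A≡J)) (∣initial∣ k≤n)))) (zeroʳ _)

  f⁽⁾-admissible : ∀ i r {u} → Admissible u → Admissible (f⁽_⁾ i r u)
  f⁽⁾-admissible i r {u} a = record { kernel = ker r ; supported = supp r ; laurent = laur r }
    where
    open Node i
    open Admissible a
    ker : ∀ r I J → E (f⁽_⁾ i r u) I J ≈ 0#
    ker zero    = kernel
    ker (suc r) I J = trans (E-* 1/[1+ r ] (f i (f⁽_⁾ i r u)) I J) (trans (*-congˡ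
      (trans (E-cong (f-lower i (f⁽_⁾ i r u)) I J)
        (trans (E-lower (adj i) (f⁽_⁾ i r u) I J) (lower-zero lo hi (ker r) I J)))) (zeroʳ _))
    supp : ∀ r → SupportedOn k (f⁽_⁾ i r u)
    supp zero    = supported
    supp (suc r) = supported-scale (supported-resp (λ I J → sym (f-lower i (f⁽_⁾ i r u) I J)) (lower-supported (adj i) (supp r)))
    -- Division by [r] does not preserve Laurent polynomials, so the divided powers are taken in
    -- closed form: 1, `lower`, `double` and 0.
    laur : ∀ r I J → Laurent (f⁽_⁾ i r u I J)
    laur 0 I J = laurent I J
    laur 1 I J = Laurent-resp (sym (f⁽1⁾ i u I J)) (lower-laurent lo hi laurent I J)
    laur 2 I J = Laurent-resp (sym (f⁽2⁾ i u I J))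
      (if-laurent ((not (lookup I lo) ∧ lookup I hi) ∧ (not (lookup J lo) ∧ lookup J hi)) (laurent _ _))
    laur (suc (suc (suc r))) I J = Laurent-resp (sym (f⁽3+_⁾ i r u I J)) (polynomial⇒laurent Polynomial-0)

  integralForm-admissible : ∀ {u} → IntegralForm u → Admissible u
  integralForm-admissible (incl m) = monomial m
    where
    monomial : ∀ {u} → DividedPowerMonomial u → Admissible u
    monomial start        = v₊-admissible
    monomial (step i r m) = f⁽⁾-admissible i r (monomial m)
  integralForm-admissible (add {u} {w} s s′) = record
    { kernel    = λ I J → trans (E-+ u w I J) (trans (+-cong (A.kernel I J) (B.kernel I J)) (+-identityʳ 0#))
    ; supported = λ I J ne → trans (+-cong (A.supported I J ne) (B.supported I J ne)) (+-identityʳ 0#)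
    ; laurent   = λ I J → Laurent-+ (A.laurent I J) (B.laurent I J)
    }
    where
    module A = Admissible (integralForm-admissible s)
    module B = Admissible (integralForm-admissible s′)
  integralForm-admissible (scale {a} {u} la s) = record
    { kernel    = λ I J → trans (E-* a u I J) (trans (*-congˡ (A.kernel I J)) (zeroʳ _))
    ; supported = supported-scale A.supported
    ; laurent   = λ I J → Laurent-* la (A.laurent I J)
    }
    where module A = Admissible (integralForm-admissible s)
  integralForm-admissible (resp u≋w s) = record
    { kernel    = λ I J → trans (E-cong (λ I J → sym (u≋w I J)) I J) (A.kernel I J)
    ; supported = supported-resp u≋w A.supported
    ; laurent   = λ I J → Laurent-resp (u≋w I J) (A.laurent I J)
    }
    where module A = Admissible (integralForm-admissible s)

  -- Kashiwara's operator and the crystal lattice in coordinates.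

  RelatedAt : Kind → (y′ y₁ y₂ : Carrier) → Set ℓ
  RelatedAt hh      y′ y₁ y₂ = y′ + q * (q * y′) ≈ y₁ + q * y₂
  RelatedAt lh      y′ y₁ y₂ = y′ ≈ y₂
  RelatedAt hl      y′ y₁ y₂ = y′ ≈ q * y₁
  RelatedAt h·      y′ y₁ y₂ = y′ ≈ y₁
  RelatedAt ·h      y′ y₁ y₂ = y′ ≈ y₂
  RelatedAt trivial y′ y₁ y₂ = y′ ≈ 0#

  -- The relations between the coordinates of f_i^(m) w and f_i^(m+1) w, for e_i w = 0, that do not
  -- depend on m. In the case `hh`, y₁ and y₂ mix the trivial and the three-dimensional
  -- representation; y₁ + q y₂ vanishes on the former and equals (1 + q²) y′ on the latter.
  Transition : Fin N → Fin N → Tensor N → Tensor N → Set ℓ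
  Transition lo hi u u′ = ∀ I J → RelatedAt (kind (lookup I lo) (lookup I hi) (lookup J lo) (lookup J hi))
    (u′ I J) (u (I ↓[ lo , hi ]) J) (u I (J ↓[ lo , hi ]))

  private
   transition-lower-base : ∀ (u : Tensor (suc (suc N))) → (∀ I J → lift zero (suc zero) u I J ≈ 0#) →
     Transition zero (suc zero) u (lower zero (suc zero) u)
   transition-lower-base u u-highest (false ∷ false ∷ I) (false ∷ false ∷ J) = +-identityʳ 0#
   transition-lower-base u u-highest (false ∷ false ∷ I) (false ∷ true ∷ J) = +-identityˡ _
   transition-lower-base u u-highest (false ∷ false ∷ I) (true ∷ false ∷ J) = +-identityʳ 0#
   transition-lower-base u u-highest (false ∷ false ∷ I) (true ∷ true ∷ J) = +-identityʳ 0#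
   transition-lower-base u u-highest (false ∷ true ∷ I) (false ∷ false ∷ J) = +-identityʳ _
   transition-lower-base u u-highest (false ∷ true ∷ I) (false ∷ true ∷ J) = trans
     (trans (+-cong sum≈0 (trans (*-congˡ (trans (*-congˡ sum≈0) (zeroʳ q))) (zeroʳ q))) (+-identityʳ 0#))
     (sym (trans (by-unit (- u (true ∷ false ∷ I) (false ∷ true ∷ J)) (solve 4 (λ q q′ x y → x :+ q :* y
         := q :* (q′ :* x :+ y) :+ (q :* q′ :* (:- x) :- (:- x))) refl q q⁻¹ (u (true ∷ false ∷ I) (false ∷ true ∷ J)) (u (false ∷ true ∷ I) (true ∷ false ∷ J)))) (trans (*-congˡ sum≈0) (zeroʳ q))))
     where sum≈0 = trans (+-comm _ _) (u-highest (true ∷ false ∷ I) (true ∷ false ∷ J))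
   transition-lower-base u u-highest (false ∷ true ∷ I) (true ∷ false ∷ J) = +-identityʳ _
   transition-lower-base u u-highest (false ∷ true ∷ I) (true ∷ true ∷ J) = +-identityʳ _
   transition-lower-base u u-highest (true ∷ false ∷ I) (false ∷ false ∷ J) = +-identityʳ 0#
   transition-lower-base u u-highest (true ∷ false ∷ I) (false ∷ true ∷ J) = +-identityˡ _
   transition-lower-base u u-highest (true ∷ false ∷ I) (true ∷ false ∷ J) = +-identityʳ 0#
   transition-lower-base u u-highest (true ∷ false ∷ I) (true ∷ true ∷ J) = +-identityʳ 0#
   transition-lower-base u u-highest (true ∷ true ∷ I) (false ∷ false ∷ J) = +-identityʳ 0#
   transition-lower-base u u-highest (true ∷ true ∷ I) (false ∷ true ∷ J) = +-identityˡ _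
   transition-lower-base u u-highest (true ∷ true ∷ I) (true ∷ false ∷ J) = +-identityʳ 0#
   transition-lower-base u u-highest (true ∷ true ∷ I) (true ∷ true ∷ J) = +-identityʳ 0#

   transition-double-base : ∀ (u : Tensor (suc (suc N))) →
     Transition zero (suc zero) (lower zero (suc zero) u) (double zero (suc zero) u)
   transition-double-base u (false ∷ false ∷ I) (false ∷ false ∷ J) = refl
   transition-double-base u (false ∷ false ∷ I) (false ∷ true ∷ J) = sym (+-identityʳ 0#)
   transition-double-base u (false ∷ false ∷ I) (true ∷ false ∷ J) = refl
   transition-double-base u (false ∷ false ∷ I) (true ∷ true ∷ J) = refl
   transition-double-base u (false ∷ true ∷ I) (false ∷ false ∷ J) = sym (+-identityʳ 0#)
   transition-double-base u (false ∷ true ∷ I) (false ∷ true ∷ J) =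
     solve 3 (λ q q′ x₀ → (x₀ :+ q :* (q :* x₀)) := ((con 0ℤ :+ x₀) :+ q :* (q :* x₀ :+ con 0ℤ))) refl q q⁻¹ _
   transition-double-base u (false ∷ true ∷ I) (true ∷ false ∷ J) =
     solve 2 (λ q q′ → con 0ℤ := q :* (con 0ℤ :+ con 0ℤ)) refl q q⁻¹
   transition-double-base u (false ∷ true ∷ I) (true ∷ true ∷ J) = sym (+-identityʳ 0#)
   transition-double-base u (true ∷ false ∷ I) (false ∷ false ∷ J) = refl
   transition-double-base u (true ∷ false ∷ I) (false ∷ true ∷ J) = sym (+-identityʳ 0#)
   transition-double-base u (true ∷ false ∷ I) (true ∷ false ∷ J) = refl
   transition-double-base u (true ∷ false ∷ I) (true ∷ true ∷ J) = refl
   transition-double-base u (true ∷ true ∷ I) (false ∷ false ∷ J) = refl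
   transition-double-base u (true ∷ true ∷ I) (false ∷ true ∷ J) = sym (+-identityʳ 0#)
   transition-double-base u (true ∷ true ∷ I) (true ∷ false ∷ J) = refl
   transition-double-base u (true ∷ true ∷ I) (true ∷ true ∷ J) = refl

  transition-lower : ∀ {lo hi : Fin N} → Adjacent lo hi → ∀ u → (∀ I J → lift lo hi u I J ≈ 0#) →
    Transition lo hi u (lower lo hi u)
  transition-lower base       u u-highest = transition-lower-base u u-highest
  transition-lower (step adj) u u-highest (a ∷ I) (b ∷ J) =
    transition-lower adj (restrict u a b) (λ I J → u-highest (a ∷ I) (b ∷ J)) I J

  transition-double : ∀ {lo hi : Fin N} → Adjacent lo hi → ∀ u → Transition lo hi (lower lo hi u) (double lo hi u)
  transition-double base       u = transition-double-base u
  transition-double (step adj) u (a ∷ I) (b ∷ J) = transition-double adj (restrict u a b) I J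

  relatedAt-cong : ∀ κ {y′ y₁ y₂ z′ z₁ z₂} → y′ ≈ z′ → y₁ ≈ z₁ → y₂ ≈ z₂ → RelatedAt κ y′ y₁ y₂ → RelatedAt κ z′ z₁ z₂
  relatedAt-cong hh      e′ e₁ e₂ r = trans (sym (+-cong e′ (*-congˡ (*-congˡ e′)))) (trans r (+-cong e₁ (*-congˡ e₂)))
  relatedAt-cong lh      e′ e₁ e₂ r = trans (sym e′) (trans r e₂)
  relatedAt-cong hl      e′ e₁ e₂ r = trans (sym e′) (trans r (*-congˡ e₁))
  relatedAt-cong h·      e′ e₁ e₂ r = trans (sym e′) (trans r e₁)
  relatedAt-cong ·h      e′ e₁ e₂ r = trans (sym e′) (trans r e₂)
  relatedAt-cong trivial e′ e₁ e₂ r = trans (sym e′) r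

  relatedAt-zero : ∀ κ → RelatedAt κ 0# 0# 0#
  relatedAt-zero hh      = +-congˡ (*-congˡ (zeroʳ q))
  relatedAt-zero lh      = refl
  relatedAt-zero hl      = sym (zeroʳ q)
  relatedAt-zero h·      = refl
  relatedAt-zero ·h      = refl
  relatedAt-zero trivial = refl

  transition-zero : ∀ {lo hi : Fin N} → Adjacent lo hi → ∀ u → Transition lo hi (double lo hi u) (λ _ _ → 0#)
  transition-zero {lo = lo} {hi} adj u I J = relatedAt-cong κᵢ refl
    (sym (double-zeroˡ lo hi u _ J (↓-lo adj I))) (sym (double-zeroʳ lo hi u I _ (↓-lo adj J))) (relatedAt-zero κᵢ)
    where κᵢ = kind (lookup I lo) (lookup I hi) (lookup J lo) (lookup J hi)

  relatedAt-+ : ∀ κ {y′ y₁ y₂ z′ z₁ z₂} → RelatedAt κ y′ y₁ y₂ → RelatedAt κ z′ z₁ z₂ →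
    RelatedAt κ (y′ + z′) (y₁ + z₁) (y₂ + z₂)
  relatedAt-+ hh {y′} {y₁} {y₂} {z′} {z₁} {z₂} r r′ = begin
    (y′ + z′) + q * (q * (y′ + z′))              ≈⟨ solve 3 (λ q y z → (y :+ z) :+ q :* (q :* (y :+ z))
        := (y :+ q :* (q :* y)) :+ (z :+ q :* (q :* z))) refl q y′ z′ ⟩
    (y′ + q * (q * y′)) + (z′ + q * (q * z′))    ≈⟨ +-cong r r′ ⟩
    (y₁ + q * y₂) + (z₁ + q * z₂)                ≈⟨ solve 5 (λ q y z y′ z′ → (y :+ q :* y′) :+ (z :+ q :* z′)
        := (y :+ z) :+ q :* (y′ :+ z′)) refl q y₁ z₁ y₂ z₂ ⟩
    (y₁ + z₁) + q * (y₂ + z₂)                    ∎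
  relatedAt-+ lh      r r′ = +-cong r r′
  relatedAt-+ hl      r r′ = trans (+-cong r r′) (sym (distribˡ q _ _))
  relatedAt-+ h·      r r′ = +-cong r r′
  relatedAt-+ ·h      r r′ = +-cong r r′
  relatedAt-+ trivial r r′ = trans (+-cong r r′) (+-identityʳ 0#)

  relatedAt-sum : ∀ κ {m} {y′ y₁ y₂ : Fin m → Carrier} → (∀ j → RelatedAt κ (y′ j) (y₁ j) (y₂ j)) →
    RelatedAt κ (sum y′) (sum y₁) (sum y₂)
  relatedAt-sum κ {zero}  r = relatedAt-zero κ
  relatedAt-sum κ {suc m} r = relatedAt-+ κ (r zero) (relatedAt-sum κ (r ∘ suc))

  -- `RelatedAt` is additive and the same for all m, so the unknown decomposition is treated summand
  -- by summand. As f_i^(3) = 0, the summands with m ≥ 3 contribute nothing.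
  kashiwara-transition : ∀ i {u u′} → Kashiwara-f̃ i u u′ → Transition (Node.lo i) (Node.hi i) u u′
  kashiwara-transition i {u} {u′} (M , w , w-highest , u≋ , u′≋) I J =
    relatedAt-cong κᵢ (sym (u′≋ _ _)) (sym (u≋ _ _)) (sym (u≋ _ _))
      (relatedAt-sum κᵢ {M} λ m → one (w m) (λ I J → trans (sym (e-lift i (w m) I J)) (w-highest m I J)) (toℕ m))
    where
    open Node i
    κᵢ = kind (lookup I lo) (lookup I hi) (lookup J lo) (lookup J hi)
    one : ∀ w → (∀ I J → lift lo hi w I J ≈ 0#) → ∀ m →
      RelatedAt κᵢ (f⁽_⁾ i (suc m) w I J) (f⁽_⁾ i m w (I ↓[ lo , hi ]) J) (f⁽_⁾ i m w I (J ↓[ lo , hi ]))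
    one w h 0 = relatedAt-cong κᵢ (sym (f⁽1⁾ i w I J)) refl refl (transition-lower (adj i) w h I J)
    one w h 1 = relatedAt-cong κᵢ (sym (f⁽2⁾ i w I J)) (sym (f⁽1⁾ i w _ _)) (sym (f⁽1⁾ i w _ _))
      (transition-double (adj i) w I J)
    one w h 2 = relatedAt-cong κᵢ (sym (f⁽3+_⁾ i 0 w I J)) (sym (f⁽2⁾ i w _ _)) (sym (f⁽2⁾ i w _ _))
      (transition-zero (adj i) w I J)
    one w h (suc (suc (suc m))) = relatedAt-cong κᵢ (sym (f⁽3+_⁾ i (suc m) w I J))
      (sym (f⁽3+_⁾ i m w _ _)) (sym (f⁽3+_⁾ i m w _ _)) (relatedAt-zero κᵢ)

  relatedAt-regular : ∀ κ {y′ y₁ y₂} → RelatedAt κ y′ y₁ y₂ → Regular y₁ → Regular y₂ → Regular y′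
  -- 1 + q² has constant term 1 and is a unit of the local ring at q = 0.
  relatedAt-regular hh {y′} r r₁ r₂ = Regular-divide (1ℤ ∷ 0ℤ ∷ 1ℤ ∷ []) (λ ())
    (trans (solve 2 (λ q y → (con 1ℤ :+ q :* (con 0ℤ :+ q :* (con 1ℤ :+ q :* con 0ℤ))) :* y := y :+ q :* (q :* y)) refl q y′) r)
    (Regular-+ r₁ (Regular-* Regular-q r₂))
  relatedAt-regular lh      r r₁ r₂ = Regular-resp (sym r) r₂
  relatedAt-regular hl      r r₁ r₂ = Regular-resp (sym r) (Regular-* Regular-q r₁)
  relatedAt-regular h·      r r₁ r₂ = Regular-resp (sym r) r₁
  relatedAt-regular ·h      r r₁ r₂ = Regular-resp (sym r) r₂
  relatedAt-regular trivial r r₁ r₂ = Regular-resp (sym r) (polynomial⇒regular Polynomial-0)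

  -- The coordinates of v₊ are polynomials, and the relations in `RelatedAt` show that every f̃_i
  -- preserves regularity.
  lattice-regular : ∀ {u} → Lattice u → ∀ I J → Regular (u I J)
  lattice-regular (incl m) = monomial m
    where
    monomial : ∀ {u} → Kashiwara-f̃Monomial u → ∀ I J → Regular (u I J)
    monomial start I J = Regular-* (polynomial⇒regular (basis-polynomial (initial n k) I)) (polynomial⇒regular (basis-polynomial (initial n k) J))
    monomial (step i f̃ m) I J =
      relatedAt-regular (kind (lookup I lo) (lookup I hi) (lookup J lo) (lookup J hi))
        (kashiwara-transition i f̃ I J) (monomial m _ _) (monomial m _ _)
      where open Node i
  lattice-regular (add s s′)   I J = Regular-+ (lattice-regular s I J) (lattice-regular s′ I J)
  lattice-regular (scale r s)  I J = Regular-* r (lattice-regular s I J)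
  lattice-regular (resp u≋w s) I J = Regular-resp (u≋w I J) (lattice-regular s I J)

  -- The bar involution in coordinates.

  BarRelated : ℕ → Tensor N → Tensor N → Set _
  BarRelated d u u′ = ∀ I J m → m ℕ.+ m ≡ d ℕ.+ distance I J → ∃ λ y → BarScalar (u I J) y × q ^ m * y ≈ u′ J I

  private
    decrease : ∀ {m x} d → m ℕ.+ m ≡ d ℕ.+ suc (suc x) → ∃ λ m′ → m ≡ suc m′ × m′ ℕ.+ m′ ≡ d ℕ.+ x
    decrease {zero} {x} d e with () ← ≡.trans e (ℕ.+-suc d (suc x))
    decrease {suc m} {x} d e = m , ≡.refl , ℕ.suc-injective (ℕ.suc-injective
      (≡.trans (≡.cong suc (≡.sym (ℕ.+-suc m m))) (≡.trans e (≡.trans (ℕ.+-suc d (suc x)) (≡.cong suc (ℕ.+-suc d x))))))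

    increase : ∀ {m x} d → m ℕ.+ m ≡ d ℕ.+ x → suc m ℕ.+ suc m ≡ d ℕ.+ suc (suc x)
    increase {m} {x} d e = ≡.trans (≡.cong suc (ℕ.+-suc m m))
      (≡.trans (≡.cong (λ z → suc (suc z)) e) (≡.sym (≡.trans (ℕ.+-suc d (suc x)) (≡.cong suc (ℕ.+-suc d x)))))

    Related : ℕ → Carrier → Carrier → Set _
    Related m x x′ = ∃ λ y → BarScalar x y × q ^ m * y ≈ x′

    related-zero : ∀ m → Related m (0# + 0#) (0# + 0#)
    related-zero m = 0# , BarScalar-cong (sym (+-identityʳ 0#)) refl BarScalar-0 , trans (zeroʳ _) (sym (+-identityʳ 0#))

    related-left : ∀ m {x x′} → Related m x x′ → Related m (x + 0#) (0# + x′)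
    related-left m (y , b , e) = y , BarScalar-cong (sym (+-identityʳ _)) refl b , trans e (sym (+-identityˡ _))

    related-right : ∀ m {x x′} → Related m x x′ → Related m (0# + x) (x′ + 0#)
    related-right m (y , b , e) = y , BarScalar-cong (sym (+-identityˡ _)) refl b , trans e (sym (+-identityʳ _))

    -- Bar turns f_i ⊗ t_i + 1 ⊗ f_i into f_i ⊗ t_i⁻¹ + 1 ⊗ f_i. After exchanging the factors, the
    -- change of the exponent m under lowering compensates for the different powers of q.
    lower-bar-base : ∀ {d} {u u′ : Tensor (suc (suc N))} → BarRelated d u u′ →
      BarRelated d (lower zero (suc zero) u) (lower zero (suc zero) u′)
    lower-bar-base r (false ∷ true ∷ I)  (false ∷ false ∷ J) m e = related-left m (r (true ∷ false ∷ I) (false ∷ false ∷ J) m e)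
    lower-bar-base r (false ∷ true ∷ I)  (true ∷ true ∷ J)   m e = related-left m (r (true ∷ false ∷ I) (true ∷ true ∷ J) m e)
    lower-bar-base r (false ∷ false ∷ I) (false ∷ true ∷ J)  m e = related-right m (r (false ∷ false ∷ I) (true ∷ false ∷ J) m e)
    lower-bar-base r (true ∷ true ∷ I)   (false ∷ true ∷ J)  m e = related-right m (r (true ∷ true ∷ I) (true ∷ false ∷ J) m e)
    lower-bar-base {d = d} r (false ∷ true ∷ I) (true ∷ false ∷ J) m e with decrease {m} d e
    ... | m′ , ≡.refl , e′ =
      let y , b , ey = r (true ∷ false ∷ I) (true ∷ false ∷ J) m′ e′ in
      related-left m (q⁻¹ * y , BarScalar-product BarScalar-q b , trans (by-unit (q ^ m′ * y)
        (solve 4 (λ q q′ z x → q :* z :* (q′ :* x) := z :* x :+ (q :* q′ :* (z :* x) :- z :* x)) refl q q⁻¹ (q ^ m′) y)) ey)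
    lower-bar-base {d = d} r (true ∷ false ∷ I) (false ∷ true ∷ J) m e with decrease {m} d e
    ... | m′ , ≡.refl , e′ =
      let y , b , ey = r (true ∷ false ∷ I) (true ∷ false ∷ J) m′ e′ in
      related-right m (y , b , trans (*-assoc q _ y) (*-congˡ ey))
    -- Lowering only one factor makes the two sets differ at both i and i + 1, so the hypothesis is
    -- used with exponent m + 1.
    lower-bar-base {d = d} {u′ = u′} r (false ∷ true ∷ I) (false ∷ true ∷ J) m e =
      let y₁ , b₁ , e₁ = r (true ∷ false ∷ I) (false ∷ true ∷ J) (suc m) (increase {m} d e)
          y₂ , b₂ , e₂ = r (false ∷ true ∷ I) (true ∷ false ∷ J) (suc m) (increase {m} d e)
      in q * y₁ + y₂ , BarScalar-sum (BarScalar-product BarScalar-q⁻¹ b₁) b₂ , (begin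
        q ^ m * (q * y₁ + y₂)
          ≈⟨ sym (by-unit (q ^ m * y₂) (solve 5 (λ q q′ z y₁ y₂ → q′ :* (q :* z :* y₂) :+ q :* z :* y₁
               := z :* (q :* y₁ :+ y₂) :+ (q :* q′ :* (z :* y₂) :- z :* y₂)) refl q q⁻¹ (q ^ m) y₁ y₂)) ⟩
        q⁻¹ * (q ^ suc m * y₂) + q ^ suc m * y₁
          ≈⟨ +-cong (*-congˡ e₂) e₁ ⟩
        q⁻¹ * u′ (true ∷ false ∷ J) (false ∷ true ∷ I) + u′ (false ∷ true ∷ J) (true ∷ false ∷ I) ∎)
    lower-bar-base r (false ∷ false ∷ I) (false ∷ false ∷ J) m e = related-zero m
    lower-bar-base r (false ∷ false ∷ I) (true ∷ false ∷ J)  m e = related-zero m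
    lower-bar-base r (false ∷ false ∷ I) (true ∷ true ∷ J)   m e = related-zero m
    lower-bar-base r (true ∷ false ∷ I)  (false ∷ false ∷ J) m e = related-zero m
    lower-bar-base r (true ∷ false ∷ I)  (true ∷ false ∷ J)  m e = related-zero m
    lower-bar-base r (true ∷ false ∷ I)  (true ∷ true ∷ J)   m e = related-zero m
    lower-bar-base r (true ∷ true ∷ I)   (false ∷ false ∷ J) m e = related-zero m
    lower-bar-base r (true ∷ true ∷ I)   (true ∷ false ∷ J)  m e = related-zero m
    lower-bar-base r (true ∷ true ∷ I)   (true ∷ true ∷ J)   m e = related-zero m

  -- A letter that is removed while I and J differ at it is remembered in d, so that m keeps
  -- referring to the distance of the complete sets.
  lower-bar : ∀ {d} {lo hi : Fin N} → Adjacent lo hi → ∀ {u u′} → BarRelated d u u′ → BarRelated d (lower lo hi u) (lower lo hi u′)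
  lower-bar base r = lower-bar-base r
  lower-bar (step adj) r (true ∷ I)  (true ∷ J)  m e = lower-bar adj (λ I J → r (true ∷ I) (true ∷ J)) I J m e
  lower-bar (step adj) r (false ∷ I) (false ∷ J) m e = lower-bar adj (λ I J → r (false ∷ I) (false ∷ J)) I J m e
  lower-bar {d = d} (step adj) r (true ∷ I) (false ∷ J) m e = lower-bar {d = suc d} adj
    (λ I J m e → r (true ∷ I) (false ∷ J) m (≡.trans e (≡.sym (ℕ.+-suc d _)))) I J m (≡.trans e (ℕ.+-suc d _))
  lower-bar {d = d} (step adj) r (false ∷ I) (true ∷ J) m e = lower-bar {d = suc d} adj
    (λ I J m e → r (false ∷ I) (true ∷ J) m (≡.trans e (≡.sym (ℕ.+-suc d _)))) I J m (≡.trans e (ℕ.+-suc d _))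

  -- In coordinates, the bar involution applies q ↦ q⁻¹, exchanges I and J, and
  -- multiplies by a power of q.
  bar-related : ∀ {u u′} → Bar u u′ → BarRelated 0 u u′
  bar-related bar-v₊ I J m e with initial n k ≟ₛ I | initial n k ≟ₛ J
  ... | no _ | _ = 0# , BarScalar-cong (sym (zeroˡ _)) refl BarScalar-0 , trans (zeroʳ _) (sym (zeroʳ _))
  ... | yes _ | no _ = 0# , BarScalar-cong (sym (zeroʳ _)) refl BarScalar-0 , trans (zeroʳ _) (sym (zeroˡ _))
  ... | yes ≡.refl | yes ≡.refl with m | ≡.trans e (distance-self (initial n k))
  ...   | zero | _ = 1# , BarScalar-cong (sym (*-identityˡ 1#)) refl BarScalar-1 , refl
  bar-related (bar-f i {u} {u′} b) I J m e =
    let y , by , ey = lower-bar {d = 0} (adj i) (bar-related b) I J m e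
    in y , BarScalar-cong (sym (f-lower i u I J)) refl by , trans ey (sym (f-lower i u′ J I))
  bar-related (bar-add b b′) I J m e =
    let y , by , ey = bar-related b I J m e
        z , bz , ez = bar-related b′ I J m e
    in y + z , BarScalar-sum by bz , trans (distribˡ _ y z) (+-cong ey ez)
  bar-related (bar-scale {a} {a′} ba b) I J m e =
    let y , by , ey = bar-related b I J m e
    in a′ * y , BarScalar-product ba by ,
       trans (solve 3 (λ z a y → z :* (a :* y) := a :* (z :* y)) refl _ a′ y) (*-congˡ ey)
  bar-related (bar-resp u≋w u′≋w′ b) I J m e =
    let y , by , ey = bar-related b I J m e
    in y , BarScalar-cong (u≋w I J) refl by , trans ey (u′≋w′ J I)

  -- Leading terms at q = 0 and the coordinates of the canonical basis.

  ≡ᵣ-trans : ∀ {x y z} → x ≡ᵣ y → y ≡ᵣ z → x ≡ᵣ z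
  ≡ᵣ-trans {x} {y} {z} (r , rr , e) (s , rs , e′) = s + r , Regular-+ rs rr ,
    trans e (trans (+-congʳ e′) (solve 4 (λ q z r s → z :+ q :* s :+ q :* r := z :+ q :* (s :+ r)) refl q z r s))

  ≡ᵣ-sym : ∀ {x y} → x ≡ᵣ y → y ≡ᵣ x
  ≡ᵣ-sym {x} {y} (r , rr , e) = - r , Regular-neg rr ,
    sym (trans (+-congʳ e) (solve 3 (λ q y r → y :+ q :* r :+ q :* :- r := y) refl q y r))

  ≈⇒≡ᵣ : ∀ {x y} → x ≈ y → x ≡ᵣ y
  ≈⇒≡ᵣ e = 0# , polynomial⇒regular Polynomial-0 , trans e (sym (trans (+-congˡ (zeroʳ q)) (+-identityʳ _)))

  -- The tensor product rule for crystals, obtained by reducing `RelatedAt` modulo q: it tells which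
  -- of the two lowered coordinates the new coordinate agrees with.
  selected : Kind → Carrier → Carrier → Carrier
  selected hh      y₁ y₂ = y₁
  selected lh      y₁ y₂ = y₂
  selected hl      y₁ y₂ = 0#
  selected h·      y₁ y₂ = y₁
  selected ·h      y₁ y₂ = y₂
  selected trivial y₁ y₂ = 0#

  relatedAt-residue : ∀ κ {y′ y₁ y₂} → RelatedAt κ y′ y₁ y₂ → Regular y′ → Regular y₁ → Regular y₂ → y′ ≡ᵣ selected κ y₁ y₂
  relatedAt-residue hh {y′} {y₁} {y₂} r r′ r₁ r₂ = y₂ - q * y′ , Regular-+ r₂ (Regular-neg (Regular-* Regular-q r′)) , (begin
    y′                                           ≈⟨ solve 2 (λ q y → y := (y :+ q :* (q :* y)) :- q :* (q :* y)) refl q y′ ⟩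
    (y′ + q * (q * y′)) - q * (q * y′)           ≈⟨ +-congʳ r ⟩
    (y₁ + q * y₂) - q * (q * y′)                 ≈⟨ solve 4 (λ q y₁ y₂ y → (y₁ :+ q :* y₂) :- q :* (q :* y)
        := y₁ :+ q :* (y₂ :- q :* y)) refl q y₁ y₂ y′ ⟩
    y₁ + q * (y₂ - q * y′)                       ∎)
  relatedAt-residue lh      r r′ r₁ r₂ = ≈⇒≡ᵣ r
  relatedAt-residue hl {y₁ = y₁} r r′ r₁ r₂ = y₁ , r₁ , trans r (sym (+-identityˡ _))
  relatedAt-residue h·      r r′ r₁ r₂ = ≈⇒≡ᵣ r
  relatedAt-residue ·h      r r′ r₁ r₂ = ≈⇒≡ᵣ r
  relatedAt-residue trivial r r′ r₁ r₂ = ≈⇒≡ᵣ r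

  -- u ≡ e_A ⊗ e_B modulo q.
  Leading : Subset n → Subset n → Tensor n → Set _
  Leading A B u = u A B ≡ᵣ 1# × (∀ I J → ¬ (I ≡ A × J ≡ B) → u I J ≡ᵣ 0#)

  leading-modL : ∀ {u w A B} → u ≡ w [mod-qL] → Leading A B u → Leading A B w
  leading-modL {u} {w} {A} {B} (x , x∈L , u≋) (one , zero′) =
    ≡ᵣ-trans (same A B) one , λ I J ne → ≡ᵣ-trans (same I J) (zero′ I J ne)
    where
    same : ∀ I J → w I J ≡ᵣ u I J
    same I J = ≡ᵣ-sym (x I J , lattice-regular x∈L I J , u≋ I J)

  leading-v₊ : Leading (initial n k) (initial n k) (v₊ k)
  leading-v₊ = ≈⇒≡ᵣ (trans (*-cong (basis-≡ A) (basis-≡ A)) (*-identityˡ 1#)) , other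
    where
    A = initial n k
    other : ∀ I J → ¬ (I ≡ A × J ≡ A) → v₊ k I J ≡ᵣ 0#
    other I J ne with A ≟ₛ I | A ≟ₛ J
    ... | no _       | _          = ≈⇒≡ᵣ (zeroˡ _)
    ... | yes _      | no _       = ≈⇒≡ᵣ (zeroʳ _)
    ... | yes ≡.refl | yes ≡.refl = ⊥-elim (ne (≡.refl , ≡.refl))

  leading-highest : ∀ {u} → u ≡ v₊ k [mod-qL] → Leading (initial n k) (initial n k) u
  leading-highest {u} (x , x∈L , u≋) =
    ≡ᵣ-trans (same _ _) (proj₁ leading-v₊) , λ I J ne → ≡ᵣ-trans (same I J) (proj₂ leading-v₊ I J ne)
    where
    same : ∀ I J → u I J ≡ᵣ v₊ k I J
    same I J = x I J , lattice-regular x∈L I J , u≋ I J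

  private
    -- The selected lowered pair together with the membership facts by which lowering can be
    -- reversed and the wrong type of `CrystalStep` excluded.
    data Selection : (a b a′ b′ : Bool) → Kind → Set c where
      first    : ∀ {a b a′ b′ κ} → (∀ {y₁ y₂} → selected κ y₁ y₂ ≡ y₁) → a ≡ false → b ≡ true → ¬ (a′ ≡ true × b′ ≡ false) →
          Selection a b a′ b′ κ
      second   : ∀ {a b a′ b′ κ} → (∀ {y₁ y₂} → selected κ y₁ y₂ ≡ y₂) → a′ ≡ false → b′ ≡ true → Selection a b a′ b′ κ
      vanishes : ∀ {a b a′ b′ κ} → (∀ {y₁ y₂} → selected κ y₁ y₂ ≡ 0#) → Selection a b a′ b′ κ

    selection : ∀ a b a′ b′ → Selection a b a′ b′ (kind a b a′ b′)
    selection false true  false true  = first ≡.refl ≡.refl ≡.refl λ ()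
    selection false true  false false = first ≡.refl ≡.refl ≡.refl λ ()
    selection false true  true  true  = first ≡.refl ≡.refl ≡.refl λ ()
    selection false true  true  false = vanishes ≡.refl
    selection true  false false true  = second ≡.refl ≡.refl ≡.refl
    selection true  true  false true  = second ≡.refl ≡.refl ≡.refl
    selection false false false true  = second ≡.refl ≡.refl ≡.refl
    selection true  false false false = vanishes ≡.refl
    selection true  false true  false = vanishes ≡.refl
    selection true  false true  true  = vanishes ≡.refl
    selection true  true  false false = vanishes ≡.refl
    selection true  true  true  false = vanishes ≡.refl
    selection true  true  true  true  = vanishes ≡.refl
    selection false false false false = vanishes ≡.refl
    selection false false true  false = vanishes ≡.refl
    selection false false true  true  = vanishes ≡.refl

    selected-right : ∀ {a b} → ¬ (a ≡ false × b ≡ true) → ∀ {y₁ y₂} → selected (kind a b false true) y₁ y₂ ≡ y₂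
    selected-right {false} {true}  ne = ⊥-elim (ne (≡.refl , ≡.refl))
    selected-right {true}  {false} ne = ≡.refl
    selected-right {true}  {true}  ne = ≡.refl
    selected-right {false} {false} ne = ≡.refl


  -- A coordinate of u′ can be nonzero modulo q only if the lowered pair selected for it is (A, B).
  -- Where lowering applies it is undone by raising, so this happens at (A′, B′) alone.
  leading-step : ∀ {lo hi u u′ A B A′ B′} → Adjacent lo hi → CrystalStep lo hi A B A′ B′ →
    (∀ I J → u′ I J ≡ᵣ selected (kind (lookup I lo) (lookup I hi) (lookup J lo) (lookup J hi)) (u (I ↓[ lo , hi ]) J) (u I (J ↓[ lo , hi ]))) →
    Leading A B u → Leading A′ B′ u′
  leading-step {lo} {hi} {u} {u′} {A} {B} {A′} {B′} adj s residue (one , other) = top s , rest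
    where
    top : CrystalStep lo hi A B A′ B′ → u′ A′ B′ ≡ᵣ 1#
    top (raise-left Al Ah Bl Bh) = ≡ᵣ-trans
      (≡.subst (u′ (A ↑[ lo , hi ]) B ≡ᵣ_) eq (residue (A ↑[ lo , hi ]) B)) one
      where
      eq : selected (kind (lookup (A ↑[ lo , hi ]) lo) (lookup (A ↑[ lo , hi ]) hi) (lookup B lo) (lookup B hi))
             (u (A ↑[ lo , hi ] ↓[ lo , hi ]) B) (u (A ↑[ lo , hi ]) (B ↓[ lo , hi ])) ≡ u A B
      eq rewrite ↑-lo adj A | ↑-hi adj A | Bl | Bh | ↑-↓ adj A Al Ah = ≡.refl
    top (raise-right Ane Bl Bh) = ≡ᵣ-trans
      (≡.subst (u′ A (B ↑[ lo , hi ]) ≡ᵣ_) eq (residue A (B ↑[ lo , hi ]))) one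
      where
      eq : selected (kind (lookup A lo) (lookup A hi) (lookup (B ↑[ lo , hi ]) lo) (lookup (B ↑[ lo , hi ]) hi))
             (u (A ↓[ lo , hi ]) (B ↑[ lo , hi ])) (u A (B ↑[ lo , hi ] ↓[ lo , hi ])) ≡ u A B
      eq rewrite ↑-lo adj B | ↑-hi adj B | ↑-↓ adj B Bl Bh = selected-right Ane
    not-first : CrystalStep lo hi A B A′ B′ → ∀ {I J} → ¬ (I ≡ A′ × J ≡ B′) → lookup I lo ≡ false → lookup I hi ≡ true →
      ¬ (lookup J lo ≡ true × lookup J hi ≡ false) → ¬ (I ↓[ lo , hi ] ≡ A × J ≡ B)
    not-first (raise-left _ _ _ _)  {I} ne Il Ih Jne (≡.refl , ≡.refl) = ne (≡.sym (↓-↑ adj I Il Ih) , ≡.refl)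
    not-first (raise-right _ Bl Bh)     ne Il Ih Jne (≡.refl , ≡.refl) = Jne (Bl , Bh)
    not-second : CrystalStep lo hi A B A′ B′ → ∀ {I J} → ¬ (I ≡ A′ × J ≡ B′) → lookup J lo ≡ false → lookup J hi ≡ true →
      ¬ (I ≡ A × J ↓[ lo , hi ] ≡ B)
    not-second (raise-left _ _ Bl _) {J = J} ne Jl Jh (≡.refl , ≡.refl) = true≢false (≡.trans (≡.sym (↓-lo adj J)) Bl)
    not-second (raise-right _ _ _)   {J = J} ne Jl Jh (≡.refl , ≡.refl) = ne (≡.refl , ≡.sym (↓-↑ adj J Jl Jh))
    rest : ∀ I J → ¬ (I ≡ A′ × J ≡ B′) → u′ I J ≡ᵣ 0#
    rest I J ne with kind (lookup I lo) (lookup I hi) (lookup J lo) (lookup J hi)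
                   | selection (lookup I lo) (lookup I hi) (lookup J lo) (lookup J hi) | residue I J
    ... | κ | first e Il Ih Jne | r = ≡ᵣ-trans (≡.subst (u′ I J ≡ᵣ_) e r) (other _ _ (not-first s ne Il Ih Jne))
    ... | κ | second e Jl Jh    | r = ≡ᵣ-trans (≡.subst (u′ I J ≡ᵣ_) e r) (other _ _ (not-second s ne Jl Jh))
    ... | κ | vanishes e        | r = ≡.subst (u′ I J ≡ᵣ_) e r

  leading-f̃ : ∀ i {u u′ w A B A′ B′} → Lattice u → Kashiwara-f̃ i u u′ → u′ ≡ w [mod-qL] →
    CrystalStep (Node.lo i) (Node.hi i) A B A′ B′ → Leading A B u → Leading A′ B′ w
  leading-f̃ i {u} {u′} u∈L f̃ u′≡w s lead = leading-modL u′≡w (leading-step (adj i) s residue lead)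
    where
    open Node i
    residue : ∀ I J → u′ I J ≡ᵣ selected (kind (lookup I lo) (lookup I hi) (lookup J lo) (lookup J hi)) (u (I ↓[ lo , hi ]) J) (u I (J ↓[ lo , hi ]))
    residue I J = relatedAt-residue κᵢ r (relatedAt-regular κᵢ r (reg _ _) (reg _ _)) (reg _ _) (reg _ _)
      where
      κᵢ = kind (lookup I lo) (lookup I hi) (lookup J lo) (lookup J hi)
      r = kashiwara-transition i f̃ I J
      reg = lattice-regular u∈L

  canonical-coordinates : ∀ {u} → Admissible u → Lattice u → Bar u u → ∀ w → Leading (left w) (right w) u →
    ∀ I J → u I J ≈ q^? (exponent w [] I J)
  canonical-coordinates {u} admissible u∈L u-bar w (one , other) I J =
    trans (u≈ I J) (comb-indicator w (indicator-one , indicator-zero) [] I J)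
    where
    open Admissible admissible
    u-polynomial : ∀ I J → Polynomial (u I J)
    u-polynomial I J = laurent∧regular⇒polynomial (laurent I J) (lattice-regular u∈L I J)
    weight : HasWeight 0 u
    weight I J ne with ∣ I ∣ ℕ.≟ k
    ... | no  ∣I∣≢k = supported I J (inj₁ ∣I∣≢k)
    ... | yes ∣I∣≡k = supported I J (inj₂ λ ∣J∣≡k → ne (≡.trans ∣J∣≡k (≡.sym ∣I∣≡k)))
    expansion : Expansion 0 u
    expansion = span n 0 u weight kernel u-polynomial
    coefficient = proj₁ expansion
    coefficient-polynomial = proj₁ (proj₂ expansion)
    u≈ : ∀ I J → u I J ≈ comb coefficient [] I J
    u≈ = proj₂ (proj₂ expansion)
    conjugate : Word 0 n → Carrier
    conjugate w = proj₁ (polynomial-bar (coefficient-polynomial w))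
    conjugate-bar : ∀ w → BarScalar (coefficient w) (conjugate w)
    conjugate-bar w = proj₂ (polynomial-bar (coefficient-polynomial w))
    -- Barring the expansion at (J, I) and using the bar invariance of u gives a second expansion of
    -- u, with conjugate coefficients; linear independence compares the two.
    conjugate≈coefficient : ∀ w → conjugate w ≈ coefficient w
    conjugate≈coefficient = comb-injective λ I J ∣J∣≡∣I∣ →
      let m , 2m≡      = distance-even J I ∣J∣≡∣I∣
          y , by , ey  = comb-bar conjugate-bar [] J I m (≡.trans 2m≡ (≡.sym (ℕ.+-identityʳ _)))
          z , bz , ez  = bar-related u-bar J I m 2m≡
      in begin
        comb conjugate [] I J    ≈⟨ ey ⟨
        q ^ m * y                ≈⟨ *-congˡ (BarScalar-functional by (BarScalar-cong (u≈ J I) refl bz)) ⟩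
        q ^ m * z                ≈⟨ ez ⟩
        u I J                    ≈⟨ u≈ I J ⟩
        comb coefficient [] I J  ∎
    coefficient-bar : ∀ w → BarScalar (coefficient w) (coefficient w)
    coefficient-bar w = BarScalar-cong refl (conjugate≈coefficient w) (conjugate-bar w)
    coefficient-residue : ∀ w → coefficient w ≡ᵣ u (left w) (right w)
    coefficient-residue w = let x , px , e = comb-leading coefficient-polynomial w in
      ≡ᵣ-sym (x , polynomial⇒regular px , trans (u≈ _ _) e)
    indicator-one : coefficient w ≈ 1#
    indicator-one = barInvariant-residue (coefficient-polynomial w) Polynomial-1 (coefficient-bar w) BarScalar-1
      (≡ᵣ-trans (coefficient-residue w) one)
    indicator-zero : ∀ w′ → w′ ≢ w → coefficient w′ ≈ 0#
    indicator-zero w′ w′≢w = barInvariant-residue (coefficient-polynomial w′) Polynomial-0 (coefficient-bar w′) BarScalar-0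
      (≡ᵣ-trans (coefficient-residue w′) (other _ _ λ (l , r) → w′≢w (word-unique l r)))

  module _ {G : SSYT k n → Tensor n} (canonical : IsCanonicalBasis G) where
    open IsCanonicalBasis canonical

    LeadingTerm : SSYT k n → Set _
    LeadingTerm S = ∀ {A B} → Enumerates A (Vec.head (filling S)) → Enumerates B (Vec.head (Vec.tail (filling S))) →
      Leading A B (G S)

    leadingTerm : ∀ S → LeadingTerm S
    leadingTerm S = go S (ℕ.<-wellFounded (size (filling S)))
      where
      go : ∀ S → Acc ℕ._<_ (size (filling S)) → LeadingTerm S
      go S@(ssyt (xs ∷ ys ∷ []) p) (acc rec) {A} {B} EA EB
        with highest⊎precedes k≤n (recompute (isSemistandard? (xs ∷ ys ∷ [])) p)
      ... | inj₁ e = ≡.subst₂ (λ A B → Leading A B (G S))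
              (enumerates-set (≡.subst (Enumerates _) (≡.sym (≡.cong Vec.head e)) (initial-enumerates k≤n)) EA)
              (enumerates-set (≡.subst (Enumerates _) (≡.sym (≡.cong (Vec.head ∘ Vec.tail) e)) (initial-enumerates k≤n)) EB)
              (leading-highest (highest S e))
      ... | inj₂ (S′ , precedes) =
        let open Precedes precedes
            A′ , B′ , EA′ , EB′ , rule = crystalStep EA EB
            u , f̃ , u≡ = crystal node S′ S arrow
        in leading-f̃ node (inLattice S′) f̃ u≡ rule (go S′ (rec smaller) EA′ EB′)

    basis-coordinates : ∀ S w → Enumerates (left w) (Vec.head (filling S)) → Enumerates (right w) (Vec.head (Vec.tail (filling S))) →
      ∀ I J → G S I J ≈ q^? (exponent w [] I J)
    basis-coordinates S w EA EB =
      canonical-coordinates (integralForm-admissible (integral S)) (inLattice S) (barInvariant S) w (leadingTerm S EA EB)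

  -- Specialization at q = 1.

  module _ {c′ ℓ′} (K : CommutativeRing c′ ℓ′) where
    private
      module K = CommutativeRing K
      module EK = Evaluation K

    valueAt1-zero : ∀ {x y} → x ≈ 0# → ValueAt1 K x y → y K.≈ K.0#
    valueAt1-zero {x} x≈0 (a , m , q^mx≈a , y≈a) = K.trans y≈a (EK.eval-zero K.1# (isZero a
      (trans (sym q^mx≈a) (trans (*-congˡ x≈0) (zeroʳ _)))))

    -- `ValueAt1` allows any presentation q^m x = a. For x = q^d the embedding of ℤ[q] in F forces a
    -- to be X^(m+d) coefficient by coefficient, and this has the value 1 at 1 in every ring.
    valueAt1-power : ∀ {x y} d → x ≈ q ^ d → ValueAt1 K x y → y K.≈ K.1#
    valueAt1-power {x} d x≈q^d (a , m , q^mx≈a , y≈a) = K.trans y≈a (K.trans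
      (EK.eval-equal K.1# a (Xᵖ (m ℕ.+ d)) (difference-zero a (Xᵖ (m ℕ.+ d)) (begin
        ⟦_⟧ q a               ≈⟨ q^mx≈a ⟨
        q ^ m * x             ≈⟨ *-congˡ x≈q^d ⟩
        q ^ m * q ^ d         ≈⟨ ^-homo-* q m d ⟨
        q ^ (m ℕ.+ d)         ≈⟨ eval-X q (m ℕ.+ d) ⟨
        ⟦_⟧ q (Xᵖ (m ℕ.+ d))  ∎)))
      (K.trans (EK.eval-X K.1# (m ℕ.+ d)) (one-^ (m ℕ.+ d))))
      where
      open import Algebra.Properties.Semiring.Exp K.semiring using () renaming (_^_ to _^ᴷ_)
      one-^ : ∀ m → K.1# ^ᴷ m K.≈ K.1#
      one-^ zero    = K.refl
      one-^ (suc m) = K.trans (K.*-identityˡ _) (one-^ m)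

-- Every pairing occurs exactly once in `allPairings`.

module _ {a b} {A : Set a} {B : Set b} (f : A → Maybe B) where

  mapMaybe-All : ∀ {p} {P : B → Set p} {xs} → All (λ x → ∀ y → f x ≡ just y → P y) xs → All P (List.mapMaybe f xs)
  mapMaybe-All [] = []
  mapMaybe-All {xs = x ∷ _} (px ∷ pxs) with f x
  ... | just y  = px y ≡.refl ∷ mapMaybe-All pxs
  ... | nothing = mapMaybe-All pxs

  mapMaybe-unique : (∀ {x x′ y} → f x ≡ just y → f x′ ≡ just y → x ≡ x′) → ∀ {xs} → Unique xs → Unique (List.mapMaybe f xs)
  mapMaybe-unique inj [] = []
  mapMaybe-unique inj {x ∷ _} (px ∷ pxs) with f x in eq
  ... | just y  = mapMaybe-All (All.map (λ x≢x′ _ fx′≡y y≡y′ → x≢x′ (inj eq (≡.trans fx′≡y (≡.cong just (≡.sym y≡y′))))) px)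
                  ∷ mapMaybe-unique inj pxs
  ... | nothing = mapMaybe-unique inj pxs

  ∈-mapMaybe : ∀ {x y xs} → x ∈ᴸ xs → f x ≡ just y → y ∈ᴸ List.mapMaybe f xs
  ∈-mapMaybe {x} (here ≡.refl) e with f x
  ∈-mapMaybe (here ≡.refl) ≡.refl | just _ = here ≡.refl
  ∈-mapMaybe {xs = x′ ∷ _} (there x∈) e with f x′
  ... | just _  = there (∈-mapMaybe x∈ e)
  ... | nothing = ∈-mapMaybe x∈ e

allVecs-unique : ∀ {A : Set} {xs : List A} → Unique xs → ∀ n → Unique (allVecs xs n)
allVecs-unique u zero    = [] ∷ []
allVecs-unique u (suc n) = cartesianProductWith⁺ _∷_ Vec.∷-injective u (allVecs-unique u n)

∈-allVecs : ∀ {A : Set} {xs : List A} → (∀ x → x ∈ᴸ xs) → ∀ {n} (v : Vec A n) → v ∈ᴸ allVecs xs n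
∈-allVecs all∈ []      = here ≡.refl
∈-allVecs all∈ (x ∷ v) = ∈-cartesianProductWith⁺ _∷_ (all∈ x) (∈-allVecs all∈ v)

-- The function `check` is local to the definition of `allPairings`; unification extracts it so that
-- it can be reasoned about.
allPairings-check : ∀ k n → ∃ λ (check : Vec (Fin n) n × Subset n → Maybe (Pairing k n)) → allPairings k n ≡
  List.mapMaybe check (List.cartesianProduct (allVecs (List.allFin n) n) (allVecs (true ∷ false ∷ []) n))
allPairings-check k n = _ , ≡.refl

check-yes : ∀ k n (τ : Pairing k n) → proj₁ (allPairings-check k n) (Pairing.σ τ , Pairing.T τ) ≡ just τ
check-yes k n (pairing σ T p) with isPairing? k σ T
... | yes _ = ≡.refl
... | no ¬p = ⊥-elim (¬p (recompute (isPairing? k σ T) p))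

check-just : ∀ k n x {τ} → proj₁ (allPairings-check k n) x ≡ just τ → x ≡ (Pairing.σ τ , Pairing.T τ)
check-just k n (σ , T) e with isPairing? k σ T
check-just k n (σ , T) ≡.refl | yes _ = ≡.refl

allPairings-unique : ∀ k n → Unique (allPairings k n)
allPairings-unique k n = mapMaybe-unique (proj₁ (allPairings-check k n))
  (λ {x} {x′} e e′ → ≡.trans (check-just k n x e) (≡.sym (check-just k n x′ e′)))
  (cartesianProduct⁺ (allVecs-unique (allFin⁺ n) n) (allVecs-unique (((λ ()) ∷ []) ∷ [] ∷ []) n))

∈-allPairings : (τ : Pairing k n) → τ ∈ᴸ allPairings k n
∈-allPairings {k} {n} τ = ∈-mapMaybe (proj₁ (allPairings-check k n))
  (∈-cartesianProduct⁺ (∈-allVecs ∈-allFin (Pairing.σ τ))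
    (∈-allVecs (λ { true → here ≡.refl ; false → there (here ≡.refl) }) (Pairing.T τ)))
  (check-yes k n τ)

-- Homogeneity of wedge products.

size-delete : ∀ (I : Subset n) i → lookup I i ≡ true → suc ∣ I Subset.- i ∣ ≡ ∣ I ∣
size-delete (true ∷ I)  zero    e = ≡.cong (λ I → suc ∣ I ∣) (p─⊥≡p I)
size-delete (true ∷ I)  (suc i) e = ≡.cong suc (size-delete I i e)
size-delete (false ∷ I) (suc i) e = size-delete I i e

∣initial-0∣ : ∀ n → ∣ initial n 0 ∣ ≡ 0
∣initial-0∣ n = ∣initial∣ {n} {0} ℕ.z≤n

module Wedge {c ℓ} (R : CommutativeRing c ℓ) (n : ℕ) where
  open CommutativeRing R hiding (zero; _-_)
  open import Algebra.Definitions.RawMonoid +-rawMonoid using (sum)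
  open Tensors R n

  sum-zero : ∀ {m} {t : Fin m → Carrier} → (∀ j → t j ≈ 0#) → sum t ≈ 0#
  sum-zero {zero}  t≈0 = refl
  sum-zero {suc m} t≈0 = trans (+-cong (t≈0 zero) (sum-zero (t≈0 ∘ suc))) (+-identityʳ 0#)

  ⋀-supported : ∀ k (v : Fin k → Fin n → Carrier) I → ∣ I ∣ ≢ k → ⋀ v I ≈ 0#
  ⋀-supported zero v I ne with initial n 0 ≟ₛ I
  ... | yes e = ⊥-elim (ne (≡.trans (≡.cong ∣_∣ (≡.sym e)) (∣initial-0∣ n)))
  ... | no _  = refl
  ⋀-supported (suc k) v I ne = sum-zero term
    where
    term : ∀ i → (if lookup I i then sign ∣ I ∩ initial n (toℕ i) ∣ * (v zero i * ⋀ (v ∘ suc) (I Subset.- i)) else 0#) ≈ 0#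
    term i with lookup I i in eq
    ... | false = refl
    ... | true  = trans (*-congˡ (trans (*-congˡ (⋀-supported k (v ∘ suc) (I Subset.- i)
                    λ e → ne (≡.trans (≡.sym (size-delete I i eq)) (≡.cong suc e)))) (zeroʳ _))) (zeroʳ _)

-- Surjectivity of θ through ballot words.

ssyt-≡ : ∀ {S S′ : SSYT k n} → filling S ≡ filling S′ → S ≡ S′
ssyt-≡ ≡.refl = ≡.refl

record TableauWord (S : SSYT k n) : Set where
  field
    word          : Word 0 n
    left-column   : Enumerates (left word) (Vec.head (filling S))
    right-column  : Enumerates (right word) (Vec.head (Vec.tail (filling S)))

  matching : Pairing k n
  matching = WordPairing.wordPairing word (enumerates-size left-column) (enumerates-size right-column)

tableauWord : (S : SSYT k n) → TableauWord S
tableauWord (ssyt t@(xs ∷ ys ∷ []) p) = record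
  { word         = proj₁ w
  ; left-column  = ≡.subst (λ A → Enumerates A xs) (≡.sym (proj₁ (proj₂ w))) EA
  ; right-column = ≡.subst (λ B → Enumerates B ys) (≡.sym (proj₂ (proj₂ w))) EB
  }
  where
  open IsSemistandard (recompute (isSemistandard? t) p)
  EA = column-enumerates (columns zero)
  EB = column-enumerates (columns (suc zero))
  w = columns-word EA EB (λ r → rows r {zero} {suc zero} ℕ.z≤n)

θ-matching : ∀ {S : SSYT k n} (W : TableauWord S) → θ (TableauWord.matching W) ≡ S
θ-matching {S = ssyt (xs ∷ ys ∷ []) p} W =
  ssyt-≡ (WordPairing.θ-wordPairing word (enumerates-size left-column) (enumerates-size right-column) left-column right-column)
  where open TableauWord W

-- The immanants as values of the dual basis.

module Immanants {c ℓ c′ ℓ′} (K : CommutativeRing c ℓ) (F : CommutativeRing c′ ℓ′) (q : CommutativeRing.Carrier F)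
                 (isℚ⟨q⟩ : IsRationalFunctionField F q) (k n : ℕ) (k≤n : k ℕ.≤ n) where
  open Classical K k n
  open Quantum F q isℚ⟨q⟩ k n k≤n using (IsCanonicalBasis; SpecializesTo)
  open CommutativeRing K hiding (zero; _-_)
  open Tensors K n hiding (Tensor)
  open import Relation.Binary.Reasoning.Setoid setoid
  open QuantumSide F q isℚ⟨q⟩ k n k≤n using (Admissible; integralForm-admissible; q^?; basis-coordinates; valueAt1-zero; valueAt1-power)
  open import Data.Unit.Polymorphic using (tt)
  private module F = CommutativeRing F

  sumᴸ : ∀ {a} {A : Set a} → (A → Carrier) → List A → Carrier
  sumᴸ f = List.foldr (λ x y → f x + y) 0#

  sumᴸ-zero : ∀ {a} {A : Set a} {f : A → Carrier} {xs} → All (λ x → f x ≈ 0#) xs → sumᴸ f xs ≈ 0#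
  sumᴸ-zero []            = refl
  sumᴸ-zero (fx≈0 ∷ fxs≈0) = trans (+-cong fx≈0 (sumᴸ-zero fxs≈0)) (+-identityʳ 0#)

  sumᴸ-select : ∀ {a} {A : Set a} {f : A → Carrier} {x xs} → Unique xs → x ∈ᴸ xs → (∀ y → y ≢ x → f y ≈ 0#) → sumᴸ f xs ≈ f x
  sumᴸ-select (px ∷ _) (here ≡.refl) f≈0 =
    trans (+-congˡ (sumᴸ-zero (All.map (λ x≢y → f≈0 _ (x≢y ∘ ≡.sym)) px))) (+-identityʳ _)
  sumᴸ-select (px ∷ u) (there x∈) f≈0 =
    trans (+-cong (f≈0 _ (All.lookup px x∈)) (sumᴸ-select u x∈ f≈0)) (+-identityˡ _)

  sumᴸ-filter : ∀ {a p} {A : Set a} {P : A → Set p} (P? : ∀ x → Dec (P x)) {f g : A → Carrier} →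
    (∀ x → P x → f x ≈ g x) → (∀ x → ¬ P x → g x ≈ 0#) → ∀ xs → sumᴸ f (List.filter P? xs) ≈ sumᴸ g xs
  sumᴸ-filter P? f≈g g≈0 [] = refl
  sumᴸ-filter P? f≈g g≈0 (x ∷ xs) with P? x
  ... | yes px = +-cong (f≈g x px) (sumᴸ-filter P? f≈g g≈0 xs)
  ... | no ¬px = trans (sumᴸ-filter P? f≈g g≈0 xs) (trans (sym (+-identityˡ _)) (+-congʳ (sym (g≈0 x ¬px))))

  evaluate-++ : ∀ (p r : Quadric) x → evaluate (p ++ r) x ≈ evaluate p x + evaluate r x
  evaluate-++ []       r x = sym (+-identityˡ _)
  evaluate-++ (_ ∷ p) r x = trans (+-congˡ (evaluate-++ p r x)) (sym (+-assoc _ _ _))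

  evaluate-concatMap : ∀ {a} {A : Set a} (f : A → Quadric) xs x → evaluate (concatMap f xs) x ≈ sumᴸ (λ τ → evaluate (f τ) x) xs
  evaluate-concatMap f []       x = refl
  evaluate-concatMap f (τ ∷ xs) x = trans (evaluate-++ (f τ) (concatMap f xs) x) (+-congˡ (evaluate-concatMap f xs x))

  module _ {Δ⟨_⟩ : Pairing k n → Quadric} (isTL : IsTemperleyLieb Δ⟨_⟩)
           {G : SSYT k n → Tensors.Tensor F n} (canonical : IsCanonicalBasis G)
           (G₁ : SSYT k n → ∃ (V k≤n)) (special : ∀ S → SpecializesTo K (G S) (proj₁ (G₁ S)))
           (H : SSYT k n → Dual k≤n) (dual : IsDualBasis k≤n H G₁) where

    G₁-supported : ∀ S {I J} → ∣ I ∣ ≢ k ⊎ ∣ J ∣ ≢ k → proj₁ (G₁ S) I J ≈ 0#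
    G₁-supported S {I} {J} ne = valueAt1-zero K
      (Admissible.supported (integralForm-admissible (IsCanonicalBasis.integral canonical S)) I J ne) (special S I J)

    module _ {I J : Subset n} (∣I∣≡k : ∣ I ∣ ≡ k) (∣J∣≡k : ∣ J ∣ ≡ k) (τ : Pairing k n) where

      private
        module _ (W : TableauWord (θ τ)) where
          open TableauWord W

          coordinate : G (θ τ) I J F.≈ q^? (exponent word [] I J)
          coordinate = basis-coordinates canonical (θ τ) word left-column right-column I J

          -- The word of θ(τ) gives a pairing with the same tableau, and θ is injective. This
          -- carries compatibility over between τ and the word.
          matching≡τ : matching ≡ τ
          matching≡τ = θ-injective (≡.cong filling (θ-matching W))

          compatible-value : Compatible I J τ → proj₁ (G₁ (θ τ)) I J ≈ 1#
          compatible-value compatible =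
            let m , e = exponent-compatible word [] I J (WordPairing.compatible⇒stronglyCompatible word
                          (enumerates-size left-column) (enumerates-size right-column) ∣I∣≡k ∣J∣≡k
                          (≡.subst (Compatible I J) (≡.sym matching≡τ) compatible))
            in valueAt1-power K m (F.trans coordinate (F.reflexive (≡.cong q^? e))) (special (θ τ) I J)

          incompatible-exponent : ¬ Compatible I J τ → ∀ e → exponent word [] I J ≡ e → e ≡ nothing
          incompatible-exponent incompatible nothing  eq = ≡.refl
          incompatible-exponent incompatible (just _) eq = contradiction
            (≡.subst (Compatible I J) matching≡τ (WordPairing.stronglyCompatible⇒compatible word
              (enumerates-size left-column) (enumerates-size right-column) (compatible-exponent word [] I J eq))) incompatible

          incompatible-value : ¬ Compatible I J τ → proj₁ (G₁ (θ τ)) I J ≈ 0#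
          incompatible-value incompatible = valueAt1-zero K
            (F.trans coordinate (F.reflexive (≡.cong q^? (incompatible-exponent incompatible _ ≡.refl)))) (special (θ τ) I J)

      G₁-compatible : Compatible I J τ → proj₁ (G₁ (θ τ)) I J ≈ 1#
      G₁-compatible = compatible-value (tableauWord (θ τ))

      G₁-incompatible : ¬ Compatible I J τ → proj₁ (G₁ (θ τ)) I J ≈ 0#
      G₁-incompatible = incompatible-value (tableauWord (θ τ))

    module _ (v : Fin k → Fin n → Carrier) where
      open Wedge K n

      private
        x : Exterior
        x = ⋀ v

        Δ : Pairing k n → Carrier
        Δ τ = evaluate Δ⟨ τ ⟩ x

      -- The coordinates of this identity are the defining relations of the immanants.
      square-expansion : ∀ I J → sumᴸ (λ τ → Δ τ * proj₁ (G₁ (θ τ)) I J) (allPairings k n) ≈ x I * x J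
      square-expansion I J = by-size (∣ I ∣ ℕ.≟ k) (∣ J ∣ ℕ.≟ k)
        where
        by-size : Dec (∣ I ∣ ≡ k) → Dec (∣ J ∣ ≡ k) →
          sumᴸ (λ τ → Δ τ * proj₁ (G₁ (θ τ)) I J) (allPairings k n) ≈ x I * x J
        -- The relations defining the immanants concern k-subsets only; at all other coordinates
        -- both sides vanish.
        by-size (no ∣I∣≢k) _ = trans
          (sumᴸ-zero (All.universal (λ τ → trans (*-congˡ (G₁-supported (θ τ) (inj₁ ∣I∣≢k))) (zeroʳ _)) (allPairings k n)))
          (sym (trans (*-congʳ (⋀-supported k v I ∣I∣≢k)) (zeroˡ _)))
        by-size (yes _) (no ∣J∣≢k) = trans
          (sumᴸ-zero (All.universal (λ τ → trans (*-congˡ (G₁-supported (θ τ) (inj₂ ∣J∣≢k))) (zeroʳ _)) (allPairings k n)))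
          (sym (trans (*-congˡ (⋀-supported k v J ∣J∣≢k)) (zeroʳ _)))
        by-size (yes ∣I∣≡k) (yes ∣J∣≡k) = begin
          sumᴸ (λ τ → Δ τ * proj₁ (G₁ (θ τ)) I J) (allPairings k n)
            ≈⟨ sumᴸ-filter (compatible? I J)
                 (λ τ c → sym (trans (*-congˡ (G₁-compatible ∣I∣≡k ∣J∣≡k τ c)) (*-identityʳ _)))
                 (λ τ ¬c → trans (*-congˡ (G₁-incompatible ∣I∣≡k ∣J∣≡k τ ¬c)) (zeroʳ _)) (allPairings k n) ⟨
          sumᴸ Δ (compatibles (I , ∣I∣≡k) (J , ∣J∣≡k))
            ≈⟨ evaluate-concatMap Δ⟨_⟩ (compatibles (I , ∣I∣≡k) (J , ∣J∣≡k)) x ⟨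
          evaluate (concatMap Δ⟨_⟩ (compatibles (I , ∣I∣≡k) (J , ∣J∣≡k))) x
            ≈⟨ isTL (I , ∣I∣≡k) (J , ∣J∣≡k) v ⟨
          1# * (x I * x J) + 0#
            ≈⟨ trans (+-identityʳ _) (*-identityˡ _) ⟩
          x I * x J ∎

      private
        module _ (τ₀ : Pairing k n) where
          open Dual (H (θ τ₀))

          -- A functional takes the proof of membership in V as an argument, so the combination, its
          -- membership, its coordinates and its value are built up together along the list.
          combination : (τs : List (Pairing k n)) → ∃ λ u → Σ (V k≤n u) λ p →
            (∀ I J → u I J ≈ sumᴸ (λ τ → Δ τ * proj₁ (G₁ (θ τ)) I J) τs)
            × u ⟨ p ⟩ ≈ sumᴸ (λ τ → Δ τ * (proj₁ (G₁ (θ τ)) ⟨ proj₂ (G₁ (θ τ)) ⟩)) τs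
          -- `Span` has no constructor for the zero tensor; a multiple by 0 of some element of V
          -- takes its place.
          combination [] = 0# • proj₁ (G₁ (θ τ₀)) , scale tt (proj₂ (G₁ (θ τ₀))) , (λ I J → zeroˡ _) ,
            trans (scale-⟨⟩ 0# (proj₂ (G₁ (θ τ₀)))) (zeroˡ _)
          combination (τ ∷ τs) =
            let u , p , coords , value = combination τs
                w , r = G₁ (θ τ)
            in (Δ τ • w) ⊕ u , add (scale tt r) p , (λ I J → +-congˡ (coords I J)) ,
               trans (add-⟨⟩ (scale tt r) p) (+-cong (scale-⟨⟩ (Δ τ) r) value)

      immanant-value : ∀ τ → Σ (V k≤n (x ⊗ x)) λ p → Δ τ ≈ Dual._⟨_⟩ (H (θ τ)) (x ⊗ x) p
      immanant-value τ = resp u≋x⊗x p , sym (begin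
        (x ⊗ x) ⟨ resp u≋x⊗x p ⟩
          ≈⟨ cong-⟨⟩ (resp u≋x⊗x p) p (λ I J → sym (u≋x⊗x I J)) ⟩
        u ⟨ p ⟩
          ≈⟨ value ⟩
        sumᴸ (λ τ′ → Δ τ′ * (proj₁ (G₁ (θ τ′)) ⟨ proj₂ (G₁ (θ τ′)) ⟩)) (allPairings k n)
          ≈⟨ sumᴸ-select (allPairings-unique k n) (∈-allPairings τ) (λ τ′ τ′≢τ → trans
               (*-congˡ (proj₂ dual (θ τ) (θ τ′) λ e → τ′≢τ (θ-injective (≡.cong filling (≡.sym e))))) (zeroʳ _)) ⟩
        Δ τ * (proj₁ (G₁ (θ τ)) ⟨ proj₂ (G₁ (θ τ)) ⟩)
          ≈⟨ trans (*-congˡ (proj₁ dual (θ τ))) (*-identityʳ _) ⟩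
        Δ τ ∎)
        where
        open Dual (H (θ τ))
        expansion = combination τ (allPairings k n)
        u = proj₁ expansion
        p = proj₁ (proj₂ expansion)
        value = proj₂ (proj₂ (proj₂ expansion))
        u≋x⊗x : u ≋ x ⊗ x
        u≋x⊗x I J = trans (proj₁ (proj₂ (proj₂ expansion)) I J) (square-expansion I J)

open import Data.Nat using (_≤_)

proposition3p2 : ∀ {c ℓ₁ ℓ₂ c′ ℓ′ : Level}
    (K : HeytingField c ℓ₁ ℓ₂) → CharZero K →
    (F : CommutativeRing c′ ℓ′) (q : CommutativeRing.Carrier F) (isℚ⟨q⟩ : IsRationalFunctionField F q) →
    (k n : ℕ) → 1 ≤ k → (k≤n : k ≤ n) →
    let open Classical (ringOf K) k n
        open Quantum F q isℚ⟨q⟩ k n k≤n in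
    (Δ⟨_⟩ : Pairing k n → Quadric) → IsTemperleyLieb Δ⟨_⟩ →
    (G : SSYT k n → Tensors.Tensor F n) → IsCanonicalBasis G →
    (G₁ : SSYT k n → ∃ (V k≤n)) → (∀ S → SpecializesTo (ringOf K) (G S) (proj₁ (G₁ S))) →
    (H : SSYT k n → Dual k≤n) → IsDualBasis k≤n H G₁ →
    (∀ τ → _≈V*_ k≤n Δ⟨ τ ⟩ (H (θ τ))) ×
    (∀ S → ∃ λ τ → _≈V*_ k≤n Δ⟨ τ ⟩ (H S))
proposition3p2 K charZero F q isℚ⟨q⟩ k n 1≤k k≤n Δ⟨_⟩ isTL G canonical G₁ special H dual =
  immanants , λ S → let W = tableauWord S in TableauWord.matching W ,
    ≡.subst (λ S′ → _≈V*_ k≤n Δ⟨ TableauWord.matching W ⟩ (H S′)) (θ-matching W) (immanants (TableauWord.matching W))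
  where
  open Classical (ringOf K) k n
  immanants : ∀ τ → _≈V*_ k≤n Δ⟨ τ ⟩ (H (θ τ))
  immanants τ v = Immanants.immanant-value (ringOf K) F q isℚ⟨q⟩ k n k≤n isTL canonical G₁ special H dual v τ
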